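{- Let $\Sigma$ be a covariance matrix of full rank $n$. If $\boldsymbol{\mu}$ is an $n$-tuple of umbral polynomials such that $f(\boldsymbol{\mu},\boldsymbol{t})=1+\frac12\boldsymbol{t}\Sigma^{ -1}\boldsymbol{t}^T$ and $\boldsymbol{\mu}_{\boldsymbol{x}}$ is an $n$-tuple of umbral polynomials such that $f(\boldsymbol{\mu}_{\boldsymbol{x}},\boldsymbol{t})=1+f(\boldsymbol{\mu},\boldsymbol{t}+\boldsymbol{x})-f(\boldsymbol{\mu},\boldsymbol{x})$, then for all $\boldsymbol{i}\in\mathbb{N}_0^n$ $$H_{\boldsymbol{i}}(\boldsymbol{x},\Sigma)\simeq(-1)^{|\boldsymbol{i}|}(-1\boldsymbol{.}\beta\boldsymbol{.}\boldsymbol{\mu}_{\boldsymbol{x}})^{\boldsymbol{i}},$$ i.e. $H_{\boldsymbol{i}}(\boldsymbol{x},\Sigma)=(-1)^{|\boldsymbol{i}|}E[(-1\boldsymbol{.}\beta\boldsymbol{.}\boldsymbol{\mu}_{\boldsymbol{x}})^{\boldsymbol{i}}]$.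
   Context: Vectors $\boldsymbol{x}=(x_1,\dots,x_n)$ and $\boldsymbol{t}=(t_1,\dots,t_n)$ are row vectors. Multivariate Hermite polynomials: $H_{\boldsymbol{i}}(\boldsymbol{x},\Sigma)=(-1)^{|\boldsymbol{i}|}\,D^{(\boldsymbol{i})}_{\boldsymbol{x}}\phi(\boldsymbol{x};\boldsymbol{0},\Sigma)/\phi(\boldsymbol{x};\boldsymbol{0},\Sigma)$, where $\phi(\boldsymbol{x};\boldsymbol{0},\Sigma)$ is the density of the multivariate Gaussian with mean $\boldsymbol{0}$ and covariance matrix $\Sigma$, $|\boldsymbol{i}|=i_1+\cdots+i_n$ and $D^{(\boldsymbol{i})}_{\boldsymbol{x}}=\partial^{|\boldsymbol{i}|}/\partial x_1^{i_1}\cdots\partial x_n^{i_n}$. Umbral calculus: $R$ is the real or complex field, $A$ a set of symbols (umbrae), $E$ a linear functional on $R[A]$ with $E[1]=1$ and $E[\alpha^i\gamma^j\cdots]=E[\alpha^i]E[\gamma^j]\cdots$ for distinct umbrae; the components of $\boldsymbol{x}$ are treated as constants for $E$ (moments may depend polynomially on $\boldsymbol{x}$). $p\simeq q$ means $E[p]=E[q]$. An $n$-tuple $\boldsymbol{\mu}$ of umbral polynomials (elements of $R[A]$) has moments $g_{\boldsymbol{i}}=E[\boldsymbol{\mu}^{\boldsymbol{i}}]$, $\boldsymbol{\mu}^{\boldsymbol{i}}=\mu_1^{i_1}\cdots\mu_n^{i_n}$, and generating function $f(\boldsymbol{\mu},\boldsymbol{t})=1+\sum_{\boldsymbol{i}\ne\boldsymbol{0}}g_{\boldsymbol{i}}\boldsymbol{t}^{\boldsymbol{i}}/\boldsymbol{i}!$,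 $\boldsymbol{i}!=i_1!\cdots i_n!$. A partition $\boldsymbol{\lambda}\vdash\boldsymbol{i}$ of a multi-index is a matrix of nonnegative integers with $n$ rows, no zero column, columns in lexicographic order, and $r$-th row sum $i_r$; $l(\boldsymbol{\lambda})$ is its number of columns; if its distinct columns $\boldsymbol{\lambda}_1,\boldsymbol{\lambda}_2,\dots$ have multiplicities $r_1,r_2,\dots$, then $\mathfrak{m}(\boldsymbol{\lambda})!=r_1!r_2!\cdots$, $\boldsymbol{\lambda}!=\prod_j(\boldsymbol{\lambda}_j!)^{r_j}$. For an $n$-tuple $\boldsymbol{\eta}$ with moments $g_{\boldsymbol{i}}$, put $g_{\boldsymbol{\lambda}}=\prod_jg_{\boldsymbol{\lambda}_j}^{r_j}$; the auxiliary umbra $-1\boldsymbol{.}\beta\boldsymbol{.}\boldsymbol{\eta}$ ($\beta$ denotes the Bell umbra) is the symbolic $n$-tuple with moments $$E[(-1\boldsymbol{.}\beta\boldsymbol{.}\boldsymbol{\eta})^{\boldsymbol{i}}]=\sum_{\boldsymbol{\lambda}\vdash\boldsymbol{i}}\frac{\boldsymbol{i}!}{\mathfrak{m}(\boldsymbol{\lambda})!\,\boldsymbol{\lambda}!}(-1)^{l(\boldsymbol{\lambda})}g_{\boldsymbol{\lambda}}.$$ -}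

module Defs where

open import Algebra.Bundles using (CommutativeRing; Semiring; RawSemiring)
import Algebra.Consequences.Setoid as Consequences
import Algebra.Properties.CommutativeSemigroup as CommutativeSemigroupProperties
import Algebra.Properties.Ring as RingProperties
import Algebra.Definitions.RawSemiring as RawSemiringDefs
open import Data.Bool.Base using (if_then_else_)
import Data.Fin.Properties as Fin
open import Data.Fin.Base using (Fin; zero; suc; toℕ; punchIn)
open import Data.List.Base as List using (List; []; _∷_; length; map; foldr; filter;
  upTo; allFin; concatMap; replicate; cartesianProductWith; deduplicate)
import Data.List.Properties as Listₚ
open import Data.List.Membership.Propositional using (_∈_)
open import Data.List.Membership.Propositional.Properties using
  (∈-filter⁺; ∈-filter⁻; ∈-cartesianProductWith⁺; ∈-cartesianProductWith⁻;
   ∈-concat⁺′; ∈-map⁺; ∈-upTo⁺)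
open import Data.List.Relation.Unary.All using (All; []; _∷_; all?)
import Data.List.Relation.Unary.All as All
import Data.List.Relation.Unary.All.Properties as Allₚ
open import Data.List.Relation.Unary.AllPairs using ([]; _∷_)
import Data.List.Relation.Unary.AllPairs as AllPairs
import Data.List.Relation.Unary.AllPairs.Properties as AllPairsₚ
open import Data.List.Relation.Unary.Any using (here)
open import Data.List.Relation.Unary.Linked using (Linked; linked?)
open import Data.List.Relation.Unary.Unique.Propositional using (Unique)
import Data.List.Relation.Unary.Unique.Propositional.Properties as Uniqueₚ
open import Data.Nat.Base as ℕ using (ℕ; zero; suc; _!; z≤n; s≤s)
import Data.Nat.Properties as ℕₚ
open import Data.Product.Base using (∃; ∃-syntax; _×_; _,_; proj₁; proj₂)
open import Data.Sum.Base using (inj₁; inj₂)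
open import Data.Vec.Base as Vec using (Vec; []; _∷_; lookup; zipWith)
import Data.Vec.Properties as Vecₚ
open import Data.Vec.Functional using (Vector; updateAt)
open import Data.Vec.Relation.Binary.Lex.NonStrict using (Lex-≤; ≤-dec)
open import Function.Base using (_∘_; const; id)
open import Level using (0ℓ)
open import Relation.Binary.Core using (Rel)
open import Relation.Binary.Bundles using (Setoid)
open import Relation.Binary.Structures using (IsDecTotalOrder; IsEquivalence)
open import Relation.Binary.PropositionalEquality as ≡ using (_≡_; _≢_)
open import Relation.Nullary using (¬_; Dec; does; contradiction)
open import Relation.Nullary.Decidable using (_×-dec_; ¬?)

MultiIndex : ℕ → Set
MultiIndex = Vec ℕ

module _ {n : ℕ} where

  𝟎 : MultiIndex n
  𝟎 = Vec.replicate n 0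

  infixl 6 _⊹_
  _⊹_ : MultiIndex n → MultiIndex n → MultiIndex n
  _⊹_ = zipWith ℕ._+_

  degree : MultiIndex n → ℕ
  degree = Vec.sum

  infix 8 _!ᵐ
  _!ᵐ : MultiIndex n → ℕ
  i !ᵐ = Vec.foldr′ ℕ._*_ 1 (Vec.map _! i)

  infix 4 _≟ᵐ_
  _≟ᵐ_ : (i j : MultiIndex n) → Dec (i ≡ j)
  _≟ᵐ_ = Vecₚ.≡-dec ℕₚ._≟_

  infix 4 _≤ₗₑₓ_ _≤ₗₑₓ?_
  _≤ₗₑₓ_ : Rel (MultiIndex n) 0ℓ
  _≤ₗₑₓ_ = Lex-≤ _≡_ ℕ._≤_

  _≤ₗₑₓ?_ : (i j : MultiIndex n) → Dec (i ≤ₗₑₓ j)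
  _≤ₗₑₓ?_ = ≤-dec ℕₚ._≟_ ℕₚ._≤?_

-- All j with j ≤ i componentwise.
box : ∀ {n} → MultiIndex n → List (MultiIndex n)
box []       = [] ∷ []
box (m ∷ i) = cartesianProductWith _∷_ (upTo (suc m)) (box i)

module _ {n : ℕ} where

  -- A matrix with n rows is the list of its columns; the row sums are then
  -- the entries of the sum of the columns.
  columnSum : List (MultiIndex n) → MultiIndex n
  columnSum = foldr _⊹_ 𝟎

  IsPartition : MultiIndex n → List (MultiIndex n) → Set
  IsPartition i λs = All (_≢ 𝟎) λs × Linked _≤ₗₑₓ_ λs × columnSum λs ≡ i

  isPartition? : ∀ i λs → Dec (IsPartition i λs)
  isPartition? i λs =
    all? (λ c → ¬? (c ≟ᵐ 𝟎)) λs ×-dec (linked? _≤ₗₑₓ?_ λs ×-dec (columnSum λs ≟ᵐ i))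

  words : ℕ → List (MultiIndex n) → List (List (MultiIndex n))
  words zero    cs = [] ∷ []
  words (suc k) cs = cartesianProductWith _∷_ cs (words k cs)

  -- A partition of i has at most |i| columns, each of them bounded by i.
  -- `partitions i` lists every partition of i exactly once: see
  -- ∈-partitions⁺, ∈-partitions⁻ and partitions-unique.
  partitions : MultiIndex n → List (List (MultiIndex n))
  partitions i =
    filter (isPartition? i) (concatMap (λ k → words k (box i)) (upTo (suc (degree i))))

  distinctColumns : List (MultiIndex n) → List (MultiIndex n)
  distinctColumns = deduplicate _≟ᵐ_

  multiplicity : List (MultiIndex n) → MultiIndex n → ℕ
  multiplicity λs c = length (filter (c ≟ᵐ_) λs)

  -- 𝔪(λ)! in the usual notation, with λ! below.
  multiplicities! : List (MultiIndex n) → ℕ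
  multiplicities! λs = List.product (map (λ c → multiplicity λs c !) (distinctColumns λs))

  columns! : List (MultiIndex n) → ℕ
  columns! λs = List.product (map (λ c → (c !ᵐ) ℕ.^ multiplicity λs c) (distinctColumns λs))

private
  data _≤ᵐ_ : ∀ {n} → MultiIndex n → MultiIndex n → Set where
    []  : [] ≤ᵐ []
    _∷_ : ∀ {n a b} {i j : MultiIndex n} → a ℕ.≤ b → i ≤ᵐ j → (a ∷ i) ≤ᵐ (b ∷ j)

  ≤ᵐ-⊹ˡ : ∀ {n} (i j : MultiIndex n) → i ≤ᵐ (i ⊹ j)
  ≤ᵐ-⊹ˡ []      []      = []
  ≤ᵐ-⊹ˡ (a ∷ i) (b ∷ j) = ℕₚ.m≤m+n a b ∷ ≤ᵐ-⊹ˡ i j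

  ≤ᵐ-⊹ʳ : ∀ {n} {i j : MultiIndex n} k → i ≤ᵐ j → i ≤ᵐ (k ⊹ j)
  ≤ᵐ-⊹ʳ []      []       = []
  ≤ᵐ-⊹ʳ (c ∷ k) (p ∷ ps) = ℕₚ.≤-trans p (ℕₚ.m≤n+m _ c) ∷ ≤ᵐ-⊹ʳ k ps

  ∈-box : ∀ {n} {i j : MultiIndex n} → j ≤ᵐ i → j ∈ box i
  ∈-box []       = here ≡.refl
  ∈-box (p ∷ ps) = ∈-cartesianProductWith⁺ _∷_ (∈-upTo⁺ (s≤s p)) (∈-box ps)

  box-unique : ∀ {n} (i : MultiIndex n) → Unique (box i)
  box-unique []      = [] ∷ []
  box-unique (m ∷ i) =
    Uniqueₚ.cartesianProductWith⁺ _∷_ Vecₚ.∷-injective (Uniqueₚ.upTo⁺ (suc m)) (box-unique i)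

  degree-⊹ : ∀ {n} (i j : MultiIndex n) → degree (i ⊹ j) ≡ degree i ℕ.+ degree j
  degree-⊹ []      []      = ≡.refl
  degree-⊹ (a ∷ i) (b ∷ j) = ≡.trans (≡.cong (a ℕ.+ b ℕ.+_) (degree-⊹ i j))
    (≡.trans (ℕₚ.+-assoc a b _) (≡.trans (≡.cong (a ℕ.+_) (swap b (degree i) (degree j)))
      (≡.sym (ℕₚ.+-assoc a _ _))))
    where
    swap : ∀ x y z → x ℕ.+ (y ℕ.+ z) ≡ y ℕ.+ (x ℕ.+ z)
    swap x y z = ≡.trans (≡.sym (ℕₚ.+-assoc x y z))
      (≡.trans (≡.cong (ℕ._+ z) (ℕₚ.+-comm x y)) (ℕₚ.+-assoc y x z))

  degree-pos : ∀ {n} (i : MultiIndex n) → i ≢ 𝟎 → 1 ℕ.≤ degree i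
  degree-pos []          i≢𝟎 = contradiction ≡.refl i≢𝟎
  degree-pos (zero  ∷ i) i≢𝟎 = degree-pos i (i≢𝟎 ∘ ≡.cong (0 ∷_))
  degree-pos (suc a ∷ i) i≢𝟎 = s≤s z≤n

  module _ {n : ℕ} where

    length≤degree : {λs : List (MultiIndex n)} → All (_≢ 𝟎) λs →
                    length λs ℕ.≤ degree (columnSum λs)
    length≤degree []                     = z≤n
    length≤degree {c ∷ λs} (c≢𝟎 ∷ λs≢𝟎) =
      ≡.subst (suc (length λs) ℕ.≤_) (≡.sym (degree-⊹ c (columnSum λs)))
        (ℕₚ.+-mono-≤ (degree-pos c c≢𝟎) (length≤degree λs≢𝟎))

    columns≤sum : (λs : List (MultiIndex n)) → All (_≤ᵐ columnSum λs) λs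
    columns≤sum []       = []
    columns≤sum (c ∷ λs) =
      ≤ᵐ-⊹ˡ c (columnSum λs) ∷ All.map (≤ᵐ-⊹ʳ c) (columns≤sum λs)

    ∈-words : ∀ {cs λs : List (MultiIndex n)} → All (_∈ cs) λs → λs ∈ words (length λs) cs
    ∈-words []       = here ≡.refl
    ∈-words (p ∷ ps) = ∈-cartesianProductWith⁺ _∷_ p (∈-words ps)

    words-length : ∀ k {cs λs : List (MultiIndex n)} → λs ∈ words k cs → length λs ≡ k
    words-length zero    (here ≡.refl) = ≡.refl
    words-length (suc k) {cs} λs∈
      with _ , _ , _ , ws∈ , ≡.refl ← ∈-cartesianProductWith⁻ _∷_ cs (words k cs) λs∈
      = ≡.cong suc (words-length k ws∈)

    words-unique : ∀ k {cs : List (MultiIndex n)} → Unique cs → Unique (words k cs)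
    words-unique zero    _   = [] ∷ []
    words-unique (suc k) cs! =
      Uniqueₚ.cartesianProductWith⁺ _∷_ Listₚ.∷-injective cs! (words-unique k cs!)

module _ {n : ℕ} {i : MultiIndex n} where

  ∈-partitions⁻ : ∀ {λs} → λs ∈ partitions i → IsPartition i λs
  ∈-partitions⁻ λs∈ = proj₂
    (∈-filter⁻ (isPartition? i) {xs = concatMap (λ k → words k (box i)) (upTo (suc (degree i)))} λs∈)

  ∈-partitions⁺ : ∀ {λs} → IsPartition i λs → λs ∈ partitions i
  ∈-partitions⁺ {λs} λs⊢i@(λs≢𝟎 , _ , ≡.refl) = ∈-filter⁺ (isPartition? i)
    (∈-concat⁺′ (∈-words (All.map ∈-box (columns≤sum λs)))
                (∈-map⁺ (λ k → words k (box i)) (∈-upTo⁺ (s≤s (length≤degree λs≢𝟎)))))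
    λs⊢i

  partitions-unique : Unique (partitions i)
  partitions-unique = Uniqueₚ.filter⁺ (isPartition? i) {xs = candidates} candidates-unique
    where
    block : ℕ → List (List (MultiIndex n))
    block k = words k (box i)

    candidates : List (List (MultiIndex n))
    candidates = concatMap block (upTo (suc (degree i)))

    candidates-unique : Unique candidates
    candidates-unique = Uniqueₚ.concat⁺ {xss = map block (upTo (suc (degree i)))}
      (Allₚ.map⁺ (All.universal (λ k → words-unique k (box-unique i)) (upTo (suc (degree i)))))
      (AllPairsₚ.map⁺ (AllPairs.map
        (λ {j} {k} j≢k {_} (p , q) → j≢k (≡.trans (≡.sym (words-length j p)) (words-length k q)))
        (Uniqueₚ.upTo⁺ (suc (degree i)))))

-- The real field is specified, up to isomorphism, as a (classical) complete
-- ordered field. The inverse is total, and unspecified at 0.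
record CompleteOrderedField : Set₁ where
  infix  8 _⁻¹
  infix  4 _≤_ _<_
  field
    commutativeRing : CommutativeRing 0ℓ 0ℓ

  open CommutativeRing commutativeRing public

  field
    _≤_             : Rel Carrier 0ℓ
    isDecTotalOrder : IsDecTotalOrder _≈_ _≤_
    0≉1             : ¬ 0# ≈ 1#
    +-monoˡ-≤       : ∀ x {y z} → y ≤ z → y + x ≤ z + x
    *-nonNeg        : ∀ {x y} → 0# ≤ x → 0# ≤ y → 0# ≤ x * y
    _⁻¹             : Carrier → Carrier
    ⁻¹-cong         : ∀ {x y} → x ≈ y → x ⁻¹ ≈ y ⁻¹
    ⁻¹-inverseʳ     : ∀ {x} → ¬ x ≈ 0# → x * x ⁻¹ ≈ 1#

  IsUpperBound : (Carrier → Set) → Carrier → Set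
  IsUpperBound P b = ∀ {x} → P x → x ≤ b

  field
    supremum : (P : Carrier → Set) → ∃ P → ∃ (IsUpperBound P) →
               ∃[ s ] IsUpperBound P s × (∀ b → IsUpperBound P b → s ≤ b)

  _<_ : Rel Carrier 0ℓ
  x < y = x ≤ y × ¬ x ≈ y

  open IsDecTotalOrder isDecTotalOrder public using (total; _≟_; _≤?_)
    renaming (refl to ≤-refl; reflexive to ≤-reflexive; trans to ≤-trans; antisym to ≤-antisym)

  open RawSemiringDefs (Semiring.rawSemiring semiring) public
    using (sum; _^_) renaming (_×_ to _·_)

  ∣_∣ : Carrier → Carrier
  ∣ x ∣ with total 0# x
  ... | inj₁ _ = x
  ... | inj₂ _ = - x

  fromℕ : ℕ → Carrier
  fromℕ m = m · 1#

  ½ : Carrier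
  ½ = fromℕ 2 ⁻¹

module RealAnalysis (𝓡 : CompleteOrderedField) where

  open CompleteOrderedField 𝓡 hiding (zero) renaming (Carrier to ℝ)

  -- The limit of the difference quotients, with the division by h cleared.
  HasDerivativeAt : (ℝ → ℝ) → ℝ → ℝ → Set
  HasDerivativeAt f a L = ∀ ε → 0# < ε → ∃[ δ ] 0# < δ ×
    (∀ h → ∣ h ∣ < δ → ∣ f (a + h) - (f a + L * h) ∣ ≤ ε * ∣ h ∣)

  ConvergesTo : (ℕ → ℝ) → ℝ → Set
  ConvergesTo s l = ∀ ε → 0# < ε → ∃[ N ] (∀ m → N ℕ.≤ m → ∣ s m - l ∣ < ε)

  -- exp is the unique homomorphism from (ℝ, +) to (ℝ∖0, ·) with derivative 1 at 0;
  -- π / 4 is the sum of the Leibniz series.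
  record ElementaryFunctions : Set where
    field
      exp            : ℝ → ℝ
      exp-cong       : ∀ {x y} → x ≈ y → exp x ≈ exp y
      exp-+          : ∀ x y → exp (x + y) ≈ exp x * exp y
      exp-derivative : HasDerivativeAt exp 0# 1#
      π              : ℝ
      π-leibniz      : ConvergesTo
        (λ N → fromℕ 4 * sum {N} (λ k → (- 1#) ^ toℕ k * fromℕ (suc (2 ℕ.* toℕ k)) ⁻¹)) π

  Point : ℕ → Set
  Point = Vector ℝ

  Matrix : ℕ → Set
  Matrix n = Fin n → Fin n → ℝ

  identity : ∀ {n} → Matrix n
  identity r s = if does (r Fin.≟ s) then 1# else 0#

  infixl 7 _⊠_
  _⊠_ : ∀ {n} → Matrix n → Matrix n → Matrix n
  (M ⊠ N) r s = sum (λ k → M r k * N k s)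

  -- Laplace expansion along the first row.
  det : ∀ {n} → Matrix n → ℝ
  det {zero}  M = 1#
  det {suc n} M = sum (λ s → (- 1#) ^ toℕ s * M zero s * det (λ r k → M (suc r) (punchIn s k)))

  quadraticForm : ∀ {n} → Matrix n → Point n → ℝ
  quadraticForm M x = sum (λ r → sum (λ s → x r * M r s * x s))

  module _ {n : ℕ} where

    IsInverse : Matrix n → Matrix n → Set
    IsInverse M N = (∀ r s → (M ⊠ N) r s ≈ identity r s) × (∀ r s → (N ⊠ M) r s ≈ identity r s)

    -- The covariance matrices of random vectors are exactly the symmetric
    -- positive semidefinite matrices.
    IsCovariance : Matrix n → Set
    IsCovariance M = (∀ r s → M r s ≈ M s r) × (∀ x → 0# ≤ quadraticForm M x)

    -- The n rows are linearly independent.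
    HasFullRank : Matrix n → Set
    HasFullRank M = ∀ (v : Point n) → (∀ s → sum (λ r → v r * M r s) ≈ 0#) → ∀ r → v r ≈ 0#

    IsPartialDerivative : Fin n → (Point n → ℝ) → (Point n → ℝ) → Set
    IsPartialDerivative r f g =
      ∀ x → HasDerivativeAt (λ y → f (updateAt x r (const y))) (x r) (g x)

    -- g = ∂/∂x_r₁ (∂/∂x_r₂ (… f)) for the list r₁ ∷ r₂ ∷ … of directions.
    IsIteratedDerivative : List (Fin n) → (Point n → ℝ) → (Point n → ℝ) → Set
    IsIteratedDerivative []       f g = ∀ x → f x ≈ g x
    IsIteratedDerivative (r ∷ rs) f g =
      ∃[ h ] IsIteratedDerivative rs f h × IsPartialDerivative r h g

    directions : MultiIndex n → List (Fin n)
    directions i = concatMap (λ r → replicate (lookup i r) r) (allFin n)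

    -- H is the value at x of (-1)^|i| D⁽ⁱ⁾φ / φ.
    IsHermite : (Point n → ℝ) → MultiIndex n → Point n → ℝ → Set
    IsHermite φ i x H =
      ∃[ D ] IsIteratedDerivative (directions i) φ D × H ≈ (- 1#) ^ degree i * D x * φ x ⁻¹

    module _ (𝓕 : ElementaryFunctions) where

      open ElementaryFunctions 𝓕

      -- φ is the density of N(0, Σ). The normalising constant
      -- c = ((2π)ⁿ det Σ)^(-1/2) is given as the positive solution of
      -- c² (2π)ⁿ det Σ = 1. The second matrix is to be the inverse of the first.
      IsGaussianDensity : Matrix n → Matrix n → (Point n → ℝ) → Set
      IsGaussianDensity Σ Σ⁻¹ φ = ∃[ c ] 0# < c
        × c * c * ((fromℕ 2 * π) ^ n * det Σ) ≈ 1#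
        × (∀ x → φ x ≈ c * exp (- (½ * quadraticForm Σ⁻¹ x)))

  private
    _≈ᶜ_ : Rel (ℝ × ℝ) 0ℓ
    (a , b) ≈ᶜ (c , d) = a ≈ c × b ≈ d

    ℂ-isEquivalence : IsEquivalence _≈ᶜ_
    ℂ-isEquivalence = record
      { refl  = refl , refl
      ; sym   = λ (p , q) → sym p , sym q
      ; trans = λ (p , q) (p′ , q′) → trans p p′ , trans q q′
      }

    _*ᶜ_ : ℝ × ℝ → ℝ × ℝ → ℝ × ℝ
    (a , b) *ᶜ (c , d) = a * c - b * d , a * d + b * c

    open RingProperties ring
    open CommutativeSemigroupProperties +-commutativeSemigroup using (interchange)

    permute : ∀ p q r s → (p + q) + (r + s) ≈ (p + r) + (s + q)
    permute p q r s = trans (interchange p q r s) (+-congˡ (+-comm q s))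

    neg-+ : ∀ x y → - (x + y) ≈ - x + - y
    neg-+ x y = sym (-‿+-comm x y)

    *ᶜ-cong : ∀ {u u′ v v′} → u ≈ᶜ u′ → v ≈ᶜ v′ → (u *ᶜ v) ≈ᶜ (u′ *ᶜ v′)
    *ᶜ-cong (p , q) (p′ , q′) =
      +-cong (*-cong p p′) (-‿cong (*-cong q q′)) , +-cong (*-cong p q′) (*-cong q p′)

    *ᶜ-assoc : ∀ u v w → ((u *ᶜ v) *ᶜ w) ≈ᶜ (u *ᶜ (v *ᶜ w))
    *ᶜ-assoc (a , b) (c , d) (e , f) =
        trans (+-cong ([y-z]x≈yx-zx e (a * c) (b * d))
                      (trans (-‿cong (distribʳ f (a * d) (b * c))) (neg-+ _ _)))
        (trans (permute _ _ _ _)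
        (sym (trans (+-cong (x[y-z]≈xy-xz a (c * e) (d * f))
                            (trans (-‿cong (distribˡ b (c * f) (d * e))) (neg-+ _ _)))
        (+-cong (+-cong (sym (*-assoc a c e)) (-‿cong (sym (*-assoc a d f))))
                (+-cong (-‿cong (sym (*-assoc b c f))) (-‿cong (sym (*-assoc b d e))))))))
      , trans (+-cong ([y-z]x≈yx-zx f (a * c) (b * d)) (distribʳ e (a * d) (b * c)))
        (trans (permute _ _ _ _)
        (sym (trans (+-cong (distribˡ a (c * f) (d * e)) (x[y-z]≈xy-xz b (c * e) (d * f)))
        (+-cong (+-cong (sym (*-assoc a c f)) (sym (*-assoc a d e)))
                (+-cong (sym (*-assoc b c e)) (-‿cong (sym (*-assoc b d f))))))))

    *ᶜ-comm : ∀ u v → (u *ᶜ v) ≈ᶜ (v *ᶜ u)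
    *ᶜ-comm (a , b) (c , d) =
        +-cong (*-comm a c) (-‿cong (*-comm b d))
      , trans (+-cong (*-comm a d) (*-comm b c)) (+-comm (d * a) (c * b))

    *ᶜ-identityˡ : ∀ u → ((1# , 0#) *ᶜ u) ≈ᶜ u
    *ᶜ-identityˡ (a , b) =
        trans (+-cong (*-identityˡ a) (trans (-‿cong (zeroˡ b)) -0#≈0#)) (+-identityʳ a)
      , trans (+-cong (*-identityˡ b) (zeroˡ a)) (+-identityʳ b)

    _+ᶜ_ : ℝ × ℝ → ℝ × ℝ → ℝ × ℝ
    (a , b) +ᶜ (c , d) = a + c , b + d

    +ᶜ-cong : ∀ {u u′ v v′} → u ≈ᶜ u′ → v ≈ᶜ v′ → (u +ᶜ v) ≈ᶜ (u′ +ᶜ v′)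
    +ᶜ-cong (p , q) (p′ , q′) = +-cong p p′ , +-cong q q′

    *ᶜ-distribˡ : ∀ u v w → (u *ᶜ (v +ᶜ w)) ≈ᶜ ((u *ᶜ v) +ᶜ (u *ᶜ w))
    *ᶜ-distribˡ (a , b) (c , d) (e , f) =
        trans (+-cong (distribˡ a c e) (trans (-‿cong (distribˡ b d f)) (neg-+ _ _)))
              (interchange _ _ _ _)
      , trans (+-cong (distribˡ a d f) (distribˡ b c e)) (interchange _ _ _ _)

    ℂ-setoid : Setoid 0ℓ 0ℓ
    ℂ-setoid = record { isEquivalence = ℂ-isEquivalence }

    open Consequences ℂ-setoid
      using (comm∧idˡ⇒id; comm∧distrˡ⇒distr)

  ℂ : CommutativeRing 0ℓ 0ℓ
  ℂ = record
    { Carrier = ℝ × ℝ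
    ; _≈_     = _≈ᶜ_
    ; _+_     = _+ᶜ_
    ; _*_     = _*ᶜ_
    ; -_      = λ (a , b) → - a , - b
    ; 0#      = 0# , 0#
    ; 1#      = 1# , 0#
    ; isCommutativeRing = record
      { isRing = record
        { +-isAbelianGroup = record
          { isGroup = record
            { isMonoid = record
              { isSemigroup = record
                { isMagma = record { isEquivalence = ℂ-isEquivalence ; ∙-cong = +ᶜ-cong }
                ; assoc   = λ (a , b) (c , d) (e , f) → +-assoc a c e , +-assoc b d f
                }
              ; identity = (λ (a , b) → +-identityˡ a , +-identityˡ b)
                         , (λ (a , b) → +-identityʳ a , +-identityʳ b)
              }
            ; inverse = (λ (a , b) → -‿inverseˡ a , -‿inverseˡ b)
                      , (λ (a , b) → -‿inverseʳ a , -‿inverseʳ b)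
            ; ⁻¹-cong = λ (p , q) → -‿cong p , -‿cong q
            }
          ; comm = λ (a , b) (c , d) → +-comm a c , +-comm b d
          }
        ; *-cong     = *ᶜ-cong
        ; *-assoc    = *ᶜ-assoc
        ; *-identity = comm∧idˡ⇒id *ᶜ-comm *ᶜ-identityˡ
        ; distrib    = comm∧distrˡ⇒distr +ᶜ-cong *ᶜ-comm *ᶜ-distribˡ
        }
      ; *-comm = *ᶜ-comm
      }
    }

  data RealOrComplex : Set where
    real complex : RealOrComplex

  scalars : RealOrComplex → CommutativeRing 0ℓ 0ℓ
  scalars real    = commutativeRing
  scalars complex = ℂ

  fromReal : ∀ 𝔽 → ℝ → CommutativeRing.Carrier (scalars 𝔽)
  fromReal real    a = a
  fromReal complex a = a , 0#

module Polynomials (R : CommutativeRing 0ℓ 0ℓ) where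

  open CommutativeRing R renaming (Carrier to K)

  infix  4 _≐_
  infixl 6 _⊕_
  infixl 7 _⊗_

  -- R[V] is presented as the free commutative R-algebra on the set V:
  -- formal expressions modulo the congruence _≐_.
  data Poly (V : Set) : Set where
    con     : K → Poly V
    var     : V → Poly V
    _⊕_ _⊗_ : Poly V → Poly V → Poly V

  data _≐_ {V : Set} : Rel (Poly V) 0ℓ where
    ≐-refl      : ∀ {p} → p ≐ p
    ≐-sym       : ∀ {p q} → p ≐ q → q ≐ p
    ≐-trans     : ∀ {p q r} → p ≐ q → q ≐ r → p ≐ r
    con-cong    : ∀ {a b} → a ≈ b → con a ≐ con b
    ⊕-cong      : ∀ {p p′ q q′} → p ≐ p′ → q ≐ q′ → p ⊕ q ≐ p′ ⊕ q′
    ⊗-cong      : ∀ {p p′ q q′} → p ≐ p′ → q ≐ q′ → p ⊗ q ≐ p′ ⊗ q′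
    con-+       : ∀ a b → con (a + b) ≐ con a ⊕ con b
    con-*       : ∀ a b → con (a * b) ≐ con a ⊗ con b
    ⊕-assoc     : ∀ p q r → p ⊕ q ⊕ r ≐ p ⊕ (q ⊕ r)
    ⊕-comm      : ∀ p q → p ⊕ q ≐ q ⊕ p
    ⊕-identityˡ : ∀ p → con 0# ⊕ p ≐ p
    ⊕-inverseˡ  : ∀ p → con (- 1#) ⊗ p ⊕ p ≐ con 0#
    ⊗-assoc     : ∀ p q r → p ⊗ q ⊗ r ≐ p ⊗ (q ⊗ r)
    ⊗-comm      : ∀ p q → p ⊗ q ≐ q ⊗ p
    ⊗-identityˡ : ∀ p → con 1# ⊗ p ≐ p
    ⊗-distribˡ  : ∀ p q r → p ⊗ (q ⊕ r) ≐ p ⊗ q ⊕ p ⊗ r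

  polyRawSemiring : Set → RawSemiring 0ℓ 0ℓ
  polyRawSemiring V = record
    { Carrier = Poly V; _≈_ = _≐_; _+_ = _⊕_; _*_ = _⊗_; 0# = con 0#; 1# = con 1# }

  module _ {V : Set} (S : RawSemiring 0ℓ 0ℓ)
           (ι : K → RawSemiring.Carrier S) (ρ : V → RawSemiring.Carrier S) where

    private
      module S = RawSemiring S

    evaluate : Poly V → S.Carrier
    evaluate (con a) = ι a
    evaluate (var v) = ρ v
    evaluate (p ⊕ q) = evaluate p S.+ evaluate q
    evaluate (p ⊗ q) = evaluate p S.* evaluate q

  substitute : ∀ {V W} → (V → Poly W) → Poly V → Poly W
  substitute {W = W} = evaluate (polyRawSemiring W) con

  value : ∀ {V} → (V → K) → Poly V → K
  value = evaluate (Semiring.rawSemiring semiring) id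

  listSum : {X : Set} → List X → (X → K) → K
  listSum xs f = foldr _+_ 0# (map f xs)

  listProduct : {X : Set} → List X → (X → K) → K
  listProduct xs f = foldr _*_ 1# (map f xs)

  -- f : Series n stands for the formal power series Σᵢ f(i) tⁱ.
  Series : ℕ → Set
  Series n = MultiIndex n → K

  module _ {n : ℕ} where

    infix 4 _≋_
    _≋_ : Rel (Series n) 0ℓ
    f ≋ g = ∀ i → f i ≈ g i

    infixl 6 _⟨+⟩_ _⟨-⟩_
    infixl 7 _⟨*⟩_
    _⟨+⟩_ _⟨-⟩_ _⟨*⟩_ : Series n → Series n → Series n
    (f ⟨+⟩ g) i = f i + g i
    (f ⟨-⟩ g) i = f i - g i
    (f ⟨*⟩ g) i = listSum (box i) (λ j → f j * g (zipWith ℕ._∸_ i j))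

    monomial : MultiIndex n → Series n
    monomial j i = if does (i ≟ᵐ j) then 1# else 0#

    constant : K → Series n
    constant a i = a * monomial 𝟎 i

    t : Fin n → Series n
    t r = monomial (𝟎 Vec.[ r ]≔ 1)

    seriesRawSemiring : RawSemiring 0ℓ 0ℓ
    seriesRawSemiring = record
      { Carrier = Series n; _≈_ = _≋_; _+_ = _⟨+⟩_; _*_ = _⟨*⟩_
      ; 0# = constant 0#; 1# = constant 1# }

    toSeries : Poly (Fin n) → Series n
    toSeries = evaluate seriesRawSemiring constant t

    -- f(t + x) and f(x) make sense for series f that are polynomials in t.
    IsPolynomial : Series n → Set
    IsPolynomial f = ∃[ p ] f ≋ toSeries p

    infix 9 _[t+_] _[_]
    _[t+_] : ∀ {f} → IsPolynomial f → (Fin n → K) → Series n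
    (p , _) [t+ x ] = toSeries (substitute (λ r → var r ⊕ con (x r)) p)

    _[_] : ∀ {f} → IsPolynomial f → (Fin n → K) → K
    (p , _) [ x ] = value x p

module Umbral (𝓡 : CompleteOrderedField) (𝔽 : RealAnalysis.RealOrComplex 𝓡) where

  open RealAnalysis 𝓡 using (scalars; fromReal)

  private
    module ℝ = CompleteOrderedField 𝓡
    R = scalars 𝔽
    open CommutativeRing R renaming (Carrier to K)
    open module PolyPowers {A : Set} = RawSemiringDefs (Polynomials.polyRawSemiring R A) using ()
      renaming (_^_ to _⊗^_; sum to ∑; product to ∏)

  open RawSemiringDefs (Semiring.rawSemiring semiring) public using (_^_)
  open Polynomials R public

  ι : ℝ.Carrier → K
  ι = fromReal 𝔽

  -- The quotient a / b of two natural numbers, as a scalar.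
  ratio : ℕ → ℕ → K
  ratio a b = ι (ℝ.fromℕ a ℝ.* ℝ.fromℕ b ℝ.⁻¹)

  record UmbralCalculus (A : Set) : Set where
    field
      E            : Poly A → K
      E-cong       : ∀ {p q} → p ≐ q → E p ≈ E q
      E-additive   : ∀ p q → E (p ⊕ q) ≈ E p + E q
      E-homogeneous : ∀ a p → E (con a ⊗ p) ≈ a * E p
      E-1          : E (con 1#) ≈ 1#
      uncorrelated : (ms : List (A × ℕ)) → Unique (map proj₁ ms) →
        E (foldr _⊗_ (con 1#) (map (λ (α , k) → var α ⊗^ k) ms))
          ≈ listProduct ms (λ (α , k) → E (var α ⊗^ k))

  module _ {A : Set} {n : ℕ} where

    infix 9 _^ᵐ_
    _^ᵐ_ : (Fin n → Poly A) → MultiIndex n → Poly A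
    μ ^ᵐ i = ∏ (λ r → μ r ⊗^ lookup i r)

    module _ (𝓤 : UmbralCalculus A) where

      open UmbralCalculus 𝓤

      moment : (Fin n → Poly A) → MultiIndex n → K
      moment μ i = E (μ ^ᵐ i)

      -- The coefficient at i = 𝟎 is E[1] = 1.
      generatingFunction : (Fin n → Poly A) → Series n
      generatingFunction μ i = ratio 1 (i !ᵐ) * moment μ i

      -- The components of -1.β.η are auxiliary symbols, not elements of Poly A:
      -- the tuple is defined only through its moments E[(-1.β.η)ⁱ].
      moment[-1·β·_] : (Fin n → Poly A) → MultiIndex n → K
      moment[-1·β· η ] i = listSum (partitions i) λ λs →
        ratio (i !ᵐ) (multiplicities! λs ℕ.* columns! λs)
          * (- 1#) ^ length λs
          * listProduct (distinctColumns λs) (λ c → moment η c ^ multiplicity λs c)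

  1+½t_tᵀ : ∀ {n} → (Fin n → Fin n → ℝ.Carrier) → Poly (Fin n)
  1+½t_tᵀ M = con 1# ⊕ con (ι ℝ.½) ⊗ ∑ (λ r → ∑ (λ s → var r ⊗ con (ι (M r s)) ⊗ var s))

-- Put F(t) = ½ t Σ⁻¹ tᵀ + x Σ⁻¹ tᵀ, so that the i-th moment of μₓ is i! times the
-- coefficient of tⁱ in F, and let p(x) be the series Σ_i E[(−1.β.μₓ)ⁱ] tⁱ / i!,
-- formally exp(−F). Removing one column from a partition shows that
-- tᵣ ∂p/∂tᵣ = −(tᵣ ∂F/∂tᵣ) p, that is
--
--   ∂p/∂tᵣ = −(Σ_b Bᵣ_b t_b + βᵣ) p   with B the symmetrized Σ⁻¹ and β = x B.
--
-- By induction on the degree, p is determined by this equation, and differentiating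
-- the equation along xᵣ gives ∂p/∂xᵣ = −(Σ_b Bᵣ_b t_b) p. Since ∂φ/∂xᵣ = −βᵣ φ, the
-- product rule yields ∂(pφ)/∂xᵣ = ∂p/∂tᵣ φ, whence D⁽ⁱ⁾φ = i! pᵢ φ.
-- Everything happens over ℝ; only the moments are transported to the scalar field.
module Submission where

open import Defs
open import Algebra.Bundles using (CommutativeMonoid; CommutativeRing; RawRing)
import Algebra.Definitions.RawSemiring as RawSemiringDefs
open import Algebra.Morphism.Structures using (IsRingHomomorphism)
import Algebra.Properties.AbelianGroup as AbelianGroupProperties
import Algebra.Properties.CommutativeSemigroup as CommutativeSemigroupProperties
import Algebra.Properties.Monoid.Mult.TCOptimised as OptimisedMult
import Algebra.Properties.Ring as RingProperties
import Algebra.Properties.Semiring.Exp as SemiringExp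
import Algebra.Properties.Semiring.Mult as SemiringMult
import Algebra.Properties.Semiring.Mult.TCOptimised as OptimisedSemiringMult
import Algebra.Properties.Semiring.Sum as SemiringSum
import Algebra.Solver.Ring as RingSolver
open import Algebra.Solver.Ring.AlmostCommutativeRing
  using (fromCommutativeRing; _-Raw-AlmostCommutative⟶_; Induced-equivalence)
open import Data.Bool.Base using (true; false)
open import Data.Fin.Base using (Fin; zero; suc)
import Data.Fin.Properties as Finₚ
open import Data.List.Base
  using (List; []; _∷_; _++_; map; foldr; length; upTo; concatMap; replicate; allFin)
import Data.List.Membership.DecPropositional as DecMembership
open import Data.List.Membership.Propositional using (_∈_; _∉_)
open import Data.List.Membership.Propositional.Properties using
  (∈-∃++; ∈-map⁺; ∈-map⁻; ∈-upTo⁺; ∈-upTo⁻; ∈-cartesianProductWith⁺; ∈-cartesianProductWith⁻;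
   ∈-deduplicate⁺; ∈-deduplicate⁻; ∈-allFin)
import Data.List.Properties as Listₚ
import Data.List.Relation.Binary.Permutation.Homogeneous as Homogeneous
import Data.List.Relation.Binary.Permutation.Propositional as Perm
open Perm using (_↭_; ↭-sym; ↭-trans; ↭-prep)
open import Data.List.Relation.Binary.Permutation.Propositional.Properties
  using (shift; ∈-resp-↭; All-resp-↭; drop-∷; ↭-length; filter-↭)
import Data.List.Relation.Binary.Permutation.Setoid.Properties as PermSetoid
import Data.List.Relation.Binary.Pointwise as ListPointwise
open import Data.List.Relation.Unary.All as All using (All; []; _∷_)
open import Data.List.Relation.Unary.AllPairs using ([]; _∷_)
open import Data.List.Relation.Unary.Any using (here; there)
open import Data.List.Relation.Unary.Linked as Linked using (Linked)
import Data.List.Relation.Unary.Sorted.TotalOrder.Properties as Sortedₚ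
import Data.List.Relation.Unary.Unique.DecPropositional.Properties as DecUniqueₚ
open import Data.List.Relation.Unary.Unique.Propositional using (Unique)
import Data.List.Relation.Unary.Unique.Propositional.Properties as Uniqueₚ
import Data.List.Sort
open import Data.Maybe.Base using (Maybe; just; nothing)
open import Data.Nat.Base as ℕ using (ℕ; zero; suc; s≤s; _!)
import Data.Nat.Properties as ℕₚ
open import Data.Product.Base using (∃-syntax; _×_; _,_; proj₁; proj₂)
open import Data.Product.Properties using (≡-dec)
open import Data.Sum.Base using (_⊎_; inj₁; inj₂)
open import Data.Vec.Base as Vec using ([]; _∷_; lookup; zipWith)
open import Data.Vec.Functional using (updateAt)
import Data.Vec.Functional.Properties as VecFₚ
import Data.Vec.Properties as Vecₚ
import Data.Vec.Relation.Binary.Lex.NonStrict as Lex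
import Data.Vec.Relation.Binary.Pointwise.Inductive as VecPointwise
open import Function.Base using (_∘_; const)
open import Level using (0ℓ)
open import Relation.Binary.Bundles using (DecTotalOrder)
open import Relation.Binary.PropositionalEquality as ≡ using (_≡_; _≢_)
import Relation.Binary.Reasoning.Setoid as ≈-Reasoning
open import Relation.Nullary using (¬_; contradiction; yes; no; does)

-- Behind the argument stands the formal identity φ(x + t) = p(x) φ(x): expanding the translated
-- quadratic form subtracts exactly F(t) from the exponent of φ. So pᵢ φ is a Taylor coefficient of
-- φ at x, and ∂/∂xᵣ and ∂/∂tᵣ agree on p φ because both move the single argument x + t. Using this
-- directly would require composing exp with a power series and knowing that φ is analytic. Instead
-- `p` is the partition sum itself, and its equation comes from double counting: the r-th row of a
-- partition of i sums to iᵣ, which explains the factor tᵣ. The other obstacle is the derivative of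
-- pᵢ in x, since the partition sum buries its dependence on x in products of powers. The equation
-- expresses the coefficient at `unit a ⊹ k` through coefficients of lower degree, so
-- differentiability and the value of the derivative come out of one induction. The symmetrization
-- enters because a quadratic form sees only the symmetric part of its matrix; the same B governs
-- both F and the exponent of φ.

Unique-resp-↭ : {X : Set} {xs ys : List X} → xs ↭ ys → Unique xs → Unique ys
Unique-resp-↭ {X} p = PermSetoid.Unique-resp-↭ (≡.setoid X) (Perm.↭⇒↭ₛ p)

∈⇒↭∷ : {X : Set} {x : X} {xs : List X} → x ∈ xs → ∃[ ys ] xs ↭ x ∷ ys
∈⇒↭∷ x∈xs with ys , zs , ≡.refl ← ∈-∃++ x∈xs = ys ++ zs , shift _ ys zs

-- Finite sums and products over lists

module Fold (M : CommutativeMonoid 0ℓ 0ℓ) where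

  open CommutativeMonoid M
  open CommutativeSemigroupProperties commutativeSemigroup using (interchange; x∙yz≈y∙xz)

  fold : {X : Set} → List X → (X → Carrier) → Carrier
  fold xs f = foldr _∙_ ε (map f xs)

  module _ {X : Set} where

    fold-cong : ∀ (xs : List X) {f g : X → Carrier} → (∀ {x} → x ∈ xs → f x ≈ g x) → fold xs f ≈ fold xs g
    fold-cong []       eq = refl
    fold-cong (x ∷ xs) eq = ∙-cong (eq (here ≡.refl)) (fold-cong xs (eq ∘ there))

    fold-∙ : ∀ (xs : List X) (f g : X → Carrier) → fold xs (λ x → f x ∙ g x) ≈ fold xs f ∙ fold xs g
    fold-∙ []       f g = sym (identityˡ ε)
    fold-∙ (x ∷ xs) f g = trans (∙-congˡ (fold-∙ xs f g)) (interchange _ _ _ _)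

    fold-ε : ∀ (xs : List X) {f : X → Carrier} → (∀ {x} → x ∈ xs → f x ≈ ε) → fold xs f ≈ ε
    fold-ε []       f≈ε = refl
    fold-ε (x ∷ xs) f≈ε = trans (∙-cong (f≈ε (here ≡.refl)) (fold-ε xs (f≈ε ∘ there))) (identityˡ ε)

    fold-↭ : ∀ {xs ys : List X} (f : X → Carrier) → xs ↭ ys → fold xs f ≈ fold ys f
    fold-↭ f Perm.refl          = refl
    fold-↭ f (Perm.prep x p)    = ∙-congˡ (fold-↭ f p)
    fold-↭ f (Perm.swap x y p)  = trans (x∙yz≈y∙xz _ _ _) (∙-congˡ (∙-congˡ (fold-↭ f p)))
    fold-↭ f (Perm.trans p q)   = trans (fold-↭ f p) (fold-↭ f q)

    -- Induction on `ys`: each `y` is permuted to the front of `xs`, and uniqueness keeps it from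
    -- turning up again in the rest. Once `ys` is exhausted, what is left of `xs` contributes only
    -- `ε`. Sums over different index lists are compared in this way.
    fold-⊆ : ∀ {xs ys : List X} (f : X → Carrier) → Unique xs → Unique ys →
             (∀ {x} → x ∈ ys → x ∈ xs) → (∀ {x} → x ∈ xs → x ∉ ys → f x ≈ ε) →
             fold xs f ≈ fold ys f
    fold-⊆ {xs} {[]}     f xs! ys! ys⊆xs off = fold-ε xs (λ x∈xs → off x∈xs λ ())
    fold-⊆ {xs} {y ∷ ys} f xs! (y∉ys ∷ ys!) ys⊆xs off
      with xs′ , p ← ∈⇒↭∷ (ys⊆xs (here ≡.refl))
      with y∉xs′ ∷ xs′! ← Unique-resp-↭ p xs!
      = trans (fold-↭ f p) (∙-congˡ (fold-⊆ f xs′! ys! ys⊆xs′ off′))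
      where
      ys⊆xs′ : ∀ {x} → x ∈ ys → x ∈ xs′
      ys⊆xs′ x∈ys with ∈-resp-↭ p (ys⊆xs (there x∈ys))
      ... | here ≡.refl = contradiction ≡.refl (All.lookup y∉ys x∈ys)
      ... | there x∈xs′ = x∈xs′

      off′ : ∀ {x} → x ∈ xs′ → x ∉ ys → f x ≈ ε
      off′ x∈xs′ x∉ys = off (∈-resp-↭ (Perm.↭-sym p) (there x∈xs′))
        λ { (here ≡.refl) → All.lookup y∉xs′ x∈xs′ ≡.refl ; (there x∈ys) → x∉ys x∈ys }

    fold-single : ∀ {xs : List X} {x} (f : X → Carrier) → Unique xs → x ∈ xs →
                  (∀ {y} → y ≢ x → f y ≈ ε) → fold xs f ≈ f x
    fold-single f xs! x∈xs off = trans
      (fold-⊆ f xs! ([] ∷ []) (λ { (here ≡.refl) → x∈xs }) (λ _ y∉ → off (y∉ ∘ here)))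
      (identityʳ _)

    -- Serves the situation in which one multiplicity grows by one and all others stay.
    fold-update : ∀ {xs : List X} {x} {f g : X → Carrier} {a} → Unique xs → x ∈ xs →
                  f x ≈ a ∙ g x → (∀ {y} → y ≢ x → f y ≈ g y) → fold xs f ≈ a ∙ fold xs g
    fold-update {f = f} {g} xs! x∈xs at off
      with ys , p ← ∈⇒↭∷ x∈xs
      with x∉ys ∷ _ ← Unique-resp-↭ p xs!
      = trans (fold-↭ f p)
        (trans (∙-cong at (fold-cong ys λ y∈ys → off λ y≡x → All.lookup x∉ys y∈ys (≡.sym y≡x)))
        (trans (assoc _ _ _) (∙-congˡ (sym (fold-↭ g p)))))

  module _ {X Y : Set} where

    fold-map : ∀ (h : X → Y) (xs : List X) (f : Y → Carrier) → fold (map h xs) f ≡ fold xs (f ∘ h)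
    fold-map h []       f = ≡.refl
    fold-map h (x ∷ xs) f = ≡.cong (f (h x) ∙_) (fold-map h xs f)

    fold-swap : ∀ (xs : List X) (ys : List Y) (f : X → Y → Carrier) →
                fold xs (λ x → fold ys (f x)) ≈ fold ys (λ y → fold xs (λ x → f x y))
    fold-swap []       ys f = sym (fold-ε ys (λ _ → refl))
    fold-swap (x ∷ xs) ys f = trans (∙-congˡ (fold-swap xs ys f)) (sym (fold-∙ ys _ _))

-- A ring solver over an arbitrary commutative ring, with integer coefficients
-- a − b presented as pairs (a , b), kept reduced so that normal forms are unique.
module Solver (R : CommutativeRing 0ℓ 0ℓ) where

  open CommutativeRing R
  open AbelianGroupProperties +-abelianGroup using (⁻¹-∙-comm)
  open RingProperties ring
  open CommutativeSemigroupProperties +-commutativeSemigroup using (interchange)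
  open ≈-Reasoning setoid

  private
    open OptimisedMult +-monoid using (×-homo-+) renaming (_×_ to _·_)
    open OptimisedSemiringMult semiring using (×1-homo-*)

    reduce : ℕ × ℕ → ℕ × ℕ
    reduce (a , b) = a ℕ.∸ b , b ℕ.∸ a

    Coefficient : RawRing 0ℓ 0ℓ
    Coefficient = record
      { Carrier = ℕ × ℕ
      ; _≈_ = _≡_
      ; _+_ = λ (a , b) (c , d) → reduce (a ℕ.+ c , b ℕ.+ d)
      ; _*_ = λ (a , b) (c , d) → reduce (a ℕ.* c ℕ.+ b ℕ.* d , a ℕ.* d ℕ.+ b ℕ.* c)
      ; -_  = λ (a , b) → b , a
      ; 0#  = 0 , 0
      ; 1#  = 1 , 0
      }

    -- Split so that the coefficients 0 and 1 are 0# and 1# on the nose.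
    ⟦_⟧ : ℕ × ℕ → Carrier
    ⟦ a , zero  ⟧ = a · 1#
    ⟦ a , suc b ⟧ = a · 1# - suc b · 1#

    ⟦⟧-spec : ∀ a b → ⟦ a , b ⟧ ≈ a · 1# - b · 1#
    ⟦⟧-spec a zero    = sym (trans (+-congˡ -0#≈0#) (+-identityʳ _))
    ⟦⟧-spec a (suc b) = refl

    minus-+ : ∀ w x y z → (w + x) - (y + z) ≈ (w - y) + (x - z)
    minus-+ w x y z = trans (+-congˡ (sym (⁻¹-∙-comm y z))) (interchange _ _ _ _)

    reduce-correct : ∀ p → ⟦ reduce p ⟧ ≈ ⟦ p ⟧
    reduce-correct (a , b) = begin
      ⟦ a ℕ.∸ b , b ℕ.∸ a ⟧
        ≈⟨ ⟦⟧-spec (a ℕ.∸ b) (b ℕ.∸ a) ⟩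
      (a ℕ.∸ b) · 1# - (b ℕ.∸ a) · 1#
        -- The minimum `a ⊓ b` is what `reduce` removes from both components; it is added back to
        -- both.
        ≈⟨ cancel _ _ _ ⟨
      ((a ℕ.∸ b) · 1# + (a ℕ.⊓ b) · 1#) - ((b ℕ.∸ a) · 1# + (a ℕ.⊓ b) · 1#)
        ≈⟨ +-cong (×-homo-+ 1# (a ℕ.∸ b) (a ℕ.⊓ b)) (-‿cong (×-homo-+ 1# (b ℕ.∸ a) (a ℕ.⊓ b))) ⟨
      (a ℕ.∸ b ℕ.+ a ℕ.⊓ b) · 1# - (b ℕ.∸ a ℕ.+ a ℕ.⊓ b) · 1#
        ≡⟨ ≡.cong₂ (λ k l → k · 1# - l · 1#) (restore a b)
             (≡.trans (≡.cong (b ℕ.∸ a ℕ.+_) (ℕₚ.⊓-comm a b)) (restore b a)) ⟩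
      a · 1# - b · 1#
        ≈⟨ ⟦⟧-spec a b ⟨
      ⟦ a , b ⟧ ∎
      where
      cancel : ∀ x y z → (x + z) - (y + z) ≈ x - y
      cancel x y z = trans (minus-+ x z y z) (trans (+-congˡ (-‿inverseʳ z)) (+-identityʳ _))

      restore : ∀ k l → k ℕ.∸ l ℕ.+ k ℕ.⊓ l ≡ k
      restore k l = ≡.trans (ℕₚ.+-comm (k ℕ.∸ l) _) (≡.trans (≡.cong (ℕ._+ (k ℕ.∸ l)) (ℕₚ.⊓-comm k l)) (ℕₚ.m⊓n+n∸m≡n l k))

    homo-+ : ∀ p q → ⟦ RawRing._+_ Coefficient p q ⟧ ≈ ⟦ p ⟧ + ⟦ q ⟧
    homo-+ (a , b) (c , d) = begin
      ⟦ reduce (a ℕ.+ c , b ℕ.+ d) ⟧                 ≈⟨ reduce-correct (a ℕ.+ c , b ℕ.+ d) ⟩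
      ⟦ a ℕ.+ c , b ℕ.+ d ⟧                          ≈⟨ ⟦⟧-spec (a ℕ.+ c) (b ℕ.+ d) ⟩
      (a ℕ.+ c) · 1# - (b ℕ.+ d) · 1#                ≈⟨ +-cong (×-homo-+ 1# a c) (-‿cong (×-homo-+ 1# b d)) ⟩
      (a · 1# + c · 1#) - (b · 1# + d · 1#)          ≈⟨ minus-+ _ _ _ _ ⟩
      (a · 1# - b · 1#) + (c · 1# - d · 1#)          ≈⟨ +-cong (⟦⟧-spec a b) (⟦⟧-spec c d) ⟨
      ⟦ a , b ⟧ + ⟦ c , d ⟧                          ∎

    minus-* : ∀ w x y z → (w - x) * (y - z) ≈ (w * y + x * z) - (w * z + x * y)
    minus-* w x y z = begin
      (w - x) * (y - z)                          ≈⟨ x[y-z]≈xy-xz (w - x) y z ⟩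
      (w - x) * y - (w - x) * z                  ≈⟨ +-cong ([y-z]x≈yx-zx y w x) (-‿cong ([y-z]x≈yx-zx z w x)) ⟩
      (w * y - x * y) - (w * z - x * z)          ≈⟨ +-congˡ (⁻¹-∙-comm _ _) ⟨
      (w * y - x * y) + (- (w * z) - - (x * z))  ≈⟨ +-congˡ (+-congˡ (-‿involutive _)) ⟩
      (w * y - x * y) + (- (w * z) + x * z)      ≈⟨ +-congˡ (+-comm _ _) ⟩
      (w * y - x * y) + (x * z - w * z)          ≈⟨ minus-+ _ _ _ _ ⟨
      (w * y + x * z) - (x * y + w * z)          ≈⟨ +-congˡ (-‿cong (+-comm _ _)) ⟩
      (w * y + x * z) - (w * z + x * y)          ∎

    homo-* : ∀ p q → ⟦ RawRing._*_ Coefficient p q ⟧ ≈ ⟦ p ⟧ * ⟦ q ⟧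
    homo-* (a , b) (c , d) = begin
      ⟦ reduce (a ℕ.* c ℕ.+ b ℕ.* d , a ℕ.* d ℕ.+ b ℕ.* c) ⟧
        ≈⟨ reduce-correct (a ℕ.* c ℕ.+ b ℕ.* d , a ℕ.* d ℕ.+ b ℕ.* c) ⟩
      ⟦ a ℕ.* c ℕ.+ b ℕ.* d , a ℕ.* d ℕ.+ b ℕ.* c ⟧
        ≈⟨ ⟦⟧-spec (a ℕ.* c ℕ.+ b ℕ.* d) (a ℕ.* d ℕ.+ b ℕ.* c) ⟩
      (a ℕ.* c ℕ.+ b ℕ.* d) · 1# - (a ℕ.* d ℕ.+ b ℕ.* c) · 1#
        ≈⟨ +-cong (split a c b d) (-‿cong (split a d b c)) ⟩
      (a · 1# * c · 1# + b · 1# * d · 1#) - (a · 1# * d · 1# + b · 1# * c · 1#)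
        ≈⟨ minus-* _ _ _ _ ⟨
      (a · 1# - b · 1#) * (c · 1# - d · 1#)
        ≈⟨ *-cong (⟦⟧-spec a b) (⟦⟧-spec c d) ⟨
      ⟦ a , b ⟧ * ⟦ c , d ⟧ ∎
      where
      split : ∀ k l m n → (k ℕ.* l ℕ.+ m ℕ.* n) · 1# ≈ k · 1# * l · 1# + m · 1# * n · 1#
      split k l m n = trans (×-homo-+ 1# (k ℕ.* l) (m ℕ.* n)) (+-cong (×1-homo-* k l) (×1-homo-* m n))

    homo-neg : ∀ p → ⟦ RawRing.-_ Coefficient p ⟧ ≈ - ⟦ p ⟧
    homo-neg (a , b) = begin
      ⟦ b , a ⟧                 ≈⟨ ⟦⟧-spec b a ⟩
      b · 1# - a · 1#           ≈⟨ +-congʳ (-‿involutive _) ⟨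
      - - (b · 1#) - a · 1#     ≈⟨ ⁻¹-∙-comm _ _ ⟩
      - (- (b · 1#) + a · 1#)   ≈⟨ -‿cong (+-comm _ _) ⟩
      - (a · 1# - b · 1#)       ≈⟨ -‿cong (⟦⟧-spec a b) ⟨
      - ⟦ a , b ⟧               ∎

    morphism : Coefficient -Raw-AlmostCommutative⟶ fromCommutativeRing R
    morphism = record
      { ⟦_⟧ = ⟦_⟧ ; +-homo = homo-+ ; *-homo = homo-* ; -‿homo = homo-neg
      ; 0-homo = refl ; 1-homo = refl }

    _≟ᶜ_ : ∀ p q → Maybe (Induced-equivalence morphism p q)
    p ≟ᶜ q with ≡-dec ℕₚ._≟_ ℕₚ._≟_ p q
    ... | yes p≡q = just (reflexive (≡.cong ⟦_⟧ p≡q))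
    ... | no  _   = nothing

  open RingSolver Coefficient (fromCommutativeRing R) morphism _≟ᶜ_ public
    using (solve; _:=_; _:+_; _:*_; _:-_; :-_; con)

-- Multi-indices and the box below a multi-index

module _ {n : ℕ} where

  ⊹-assoc : (i j k : MultiIndex n) → (i ⊹ j) ⊹ k ≡ i ⊹ (j ⊹ k)
  ⊹-assoc = Vecₚ.zipWith-assoc ℕₚ.+-assoc

  ⊹-comm : (i j : MultiIndex n) → i ⊹ j ≡ j ⊹ i
  ⊹-comm = Vecₚ.zipWith-comm ℕₚ.+-comm

  ⊹-identityˡ : (i : MultiIndex n) → 𝟎 ⊹ i ≡ i
  ⊹-identityˡ = Vecₚ.zipWith-identityˡ ℕₚ.+-identityˡ

  x⊹yz≡y⊹xz : (i j k : MultiIndex n) → i ⊹ (j ⊹ k) ≡ j ⊹ (i ⊹ k)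
  x⊹yz≡y⊹xz i j k = ≡.trans (≡.sym (⊹-assoc i j k)) (≡.trans (≡.cong (_⊹ k) (⊹-comm i j)) (⊹-assoc j i k))

⊹-∸ : ∀ {n} (i j : MultiIndex n) → zipWith ℕ._∸_ (i ⊹ j) i ≡ j
⊹-∸ []      []      = ≡.refl
⊹-∸ (a ∷ i) (b ∷ j) = ≡.cong₂ _∷_ (ℕₚ.m+n∸m≡n a b) (⊹-∸ i j)

⊹-cancelˡ : ∀ {n} (i : MultiIndex n) {j k} → i ⊹ j ≡ i ⊹ k → j ≡ k
⊹-cancelˡ i {j} {k} eq =
  ≡.trans (≡.sym (⊹-∸ i j)) (≡.trans (≡.cong (λ l → zipWith ℕ._∸_ l i) eq) (⊹-∸ i k))

∈-box⁺ : ∀ {n} (i j : MultiIndex n) → i ∈ box (i ⊹ j)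
∈-box⁺ []      []      = here ≡.refl
∈-box⁺ (a ∷ i) (b ∷ j) = ∈-cartesianProductWith⁺ _∷_ (∈-upTo⁺ (s≤s (ℕₚ.m≤m+n a b))) (∈-box⁺ i j)

∈-box⁻ : ∀ {n} {c} (i : MultiIndex n) → c ∈ box i → ∃[ j ] c ⊹ j ≡ i
∈-box⁻ []      (here ≡.refl) = [] , ≡.refl
∈-box⁻ (a ∷ i) c∈
  with b , c , b∈ , c∈′ , ≡.refl ← ∈-cartesianProductWith⁻ _∷_ (upTo (suc a)) (box i) c∈
  with j , ≡.refl ← ∈-box⁻ i c∈′
  = a ℕ.∸ b ∷ j , ≡.cong (_∷ c ⊹ j) (ℕₚ.m+[n∸m]≡n (ℕₚ.≤-pred (∈-upTo⁻ b∈)))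

box-unique : ∀ {n} (i : MultiIndex n) → Unique (box i)
box-unique []      = [] ∷ []
box-unique (m ∷ i) =
  Uniqueₚ.cartesianProductWith⁺ _∷_ Vecₚ.∷-injective (Uniqueₚ.upTo⁺ (suc m)) (box-unique i)

-- Injectivity is asked only on entries of `xs`, because the map to be used, insertion of a column
-- followed by sorting, forgets the order of its argument and is injective only on sorted lists.
map-unique : {X Y : Set} {f : X → Y} {xs : List X} →
             (∀ {x y} → x ∈ xs → y ∈ xs → f x ≡ f y → x ≡ y) → Unique xs → Unique (map f xs)
map-unique inj []           = []
map-unique {f = f} {x ∷ xs} inj (x∉xs ∷ xs!) =
  All.tabulate (λ fy∈ fx≡fy → let y , y∈xs , eq = ∈-map⁻ f fy∈ in
    All.lookup x∉xs y∈xs (inj (here ≡.refl) (there y∈xs) (≡.trans fx≡fy eq)))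
  ∷ map-unique (λ x∈ y∈ → inj (there x∈) (there y∈)) xs!

-- Inserting and removing a column of a partition

module _ {n : ℕ} where

  lexOrder : DecTotalOrder 0ℓ 0ℓ 0ℓ
  lexOrder = Lex.≤-decTotalOrder ℕₚ.≤-decTotalOrder n

  open Data.List.Sort lexOrder using (sort; sort-↭; sort-↗)

  -- Makes partitions canonical representatives of multisets of columns, so that equality of
  -- partitions can be checked up to permutation. The conversions are there because `lexOrder`
  -- compares columns with pointwise equality.
  sorted-unique : {λs μs : List (MultiIndex n)} →
                  Linked _≤ₗₑₓ_ λs → Linked _≤ₗₑₓ_ μs → λs ↭ μs → λs ≡ μs
  sorted-unique λs↗ μs↗ p = ListPointwise.Pointwise-≡⇒≡ (ListPointwise.map VecPointwise.Pointwise-≡⇒≡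
    (Sortedₚ.↗↭↗⇒≋ (DecTotalOrder.totalOrder lexOrder) λs↗ μs↗
      (Homogeneous.map VecPointwise.≡⇒Pointwise-≡ (Perm.↭⇒↭ₛ p))))

  columnSum-↭ : {λs μs : List (MultiIndex n)} → λs ↭ μs → columnSum λs ≡ columnSum μs
  columnSum-↭ Perm.refl         = ≡.refl
  columnSum-↭ (Perm.prep c p)   = ≡.cong (c ⊹_) (columnSum-↭ p)
  columnSum-↭ (Perm.swap c d p) = ≡.trans (x⊹yz≡y⊹xz c d _) (≡.cong (λ i → d ⊹ (c ⊹ i)) (columnSum-↭ p))
  columnSum-↭ (Perm.trans p q)  = ≡.trans (columnSum-↭ p) (columnSum-↭ q)

  insert : MultiIndex n → List (MultiIndex n) → List (MultiIndex n)
  insert c λs = sort (c ∷ λs)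

  insert-↭ : ∀ c λs → insert c λs ↭ c ∷ λs
  insert-↭ c λs = sort-↭ (c ∷ λs)

  insert-partition : ∀ {c j λs} → c ≢ 𝟎 → IsPartition j λs → IsPartition (c ⊹ j) (insert c λs)
  insert-partition {c} {λs = λs} c≢𝟎 (λs≢𝟎 , _ , ≡.refl) =
      All-resp-↭ (↭-sym (insert-↭ c λs)) (c≢𝟎 ∷ λs≢𝟎)
    , sort-↗ (c ∷ λs)
    , columnSum-↭ (insert-↭ c λs)

  insert-injective : ∀ {c j λs μs} → IsPartition j λs → IsPartition j μs →
                     insert c λs ≡ insert c μs → λs ≡ μs
  insert-injective {c} {λs = λs} {μs} (_ , λs↗ , _) (_ , μs↗ , _) eq = sorted-unique λs↗ μs↗
    (drop-∷ (↭-trans (↭-sym (insert-↭ c λs)) (≡.subst (_↭ c ∷ μs) (≡.sym eq) (insert-↭ c μs))))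

  uninsert : ∀ {c j λs} → c ∈ λs → IsPartition (c ⊹ j) λs → ∃[ μs ] IsPartition j μs × λs ≡ insert c μs
  uninsert {c} {j} {λs} c∈λs (λs≢𝟎 , λs↗ , sum≡)
    with μs , p ← ∈⇒↭∷ c∈λs
    -- Sorting the remainder again supplies its order directly; the result is compared with `λs` up
    -- to permutation only.
    = sort μs
    , ( All-resp-↭ (↭-sym (sort-↭ μs)) (All.tail (All-resp-↭ p λs≢𝟎))
      , sort-↗ μs
      , ⊹-cancelˡ c (≡.trans (≡.sym (columnSum-↭ q)) sum≡) )
    , sorted-unique λs↗ (sort-↗ (c ∷ sort μs)) (↭-trans q (↭-sym (insert-↭ c (sort μs))))
    where
    q : λs ↭ c ∷ sort μs
    q = ↭-trans p (↭-prep c (↭-sym (sort-↭ μs)))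

  module _ (M : CommutativeMonoid 0ℓ 0ℓ) where

    open CommutativeMonoid M using (Carrier; _≈_; ε; trans; reflexive)
    open Fold M

    -- The partitions of `c ⊹ j` with a column `c` are exactly the insertions of `c` into partitions
    -- of `j`, each obtained once; on all others `G` is trivial.
    fold-partitions-insert : ∀ {c} j (G : List (MultiIndex n) → Carrier) → c ≢ 𝟎 →
      (∀ {λs} → c ∉ λs → G λs ≈ ε) →
      fold (partitions (c ⊹ j)) G ≈ fold (partitions j) (G ∘ insert c)
    fold-partitions-insert {c} j G c≢𝟎 off = trans
      (fold-⊆ G partitions-unique
        (map-unique (λ λs∈ μs∈ → insert-injective (∈-partitions⁻ λs∈) (∈-partitions⁻ μs∈))
                    (partitions-unique {i = j}))
        (λ λs∈ → let μs , μs∈ , eq = ∈-map⁻ (insert c) λs∈ in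
          ≡.subst (_∈ partitions (c ⊹ j)) (≡.sym eq) (∈-partitions⁺ (insert-partition c≢𝟎 (∈-partitions⁻ μs∈))))
        (λ {λs} λs∈ λs∉ → off λ c∈λs → let μs , μs⊢j , eq = uninsert c∈λs (∈-partitions⁻ λs∈) in
          λs∉ (≡.subst (_∈ map (insert c) (partitions j)) (≡.sym eq)
                (∈-map⁺ (insert c) (∈-partitions⁺ μs⊢j)))))
      (reflexive (fold-map (insert c) (partitions j) G))

  multiplicity-here : ∀ c (λs : List (MultiIndex n)) → multiplicity (c ∷ λs) c ≡ suc (multiplicity λs c)
  multiplicity-here c λs = ≡.cong length (Listₚ.filter-accept (c ≟ᵐ_) ≡.refl)

  multiplicity-there : ∀ {c d} (λs : List (MultiIndex n)) → d ≢ c → multiplicity (c ∷ λs) d ≡ multiplicity λs d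
  multiplicity-there {c} {d} λs d≢c = ≡.cong length (Listₚ.filter-reject (d ≟ᵐ_) d≢c)

  multiplicity-∉ : ∀ {c} (λs : List (MultiIndex n)) → c ∉ λs → multiplicity λs c ≡ 0
  multiplicity-∉ {c} λs c∉λs = ≡.cong length (Listₚ.filter-none (c ≟ᵐ_)
    (All.tabulate λ d∈λs c≡d → c∉λs (≡.subst (_∈ λs) (≡.sym c≡d) d∈λs)))

  multiplicity-↭ : ∀ {λs μs : List (MultiIndex n)} → λs ↭ μs → ∀ c → multiplicity λs c ≡ multiplicity μs c
  multiplicity-↭ p c = ↭-length (filter-↭ (c ≟ᵐ_) p)

  multiplicity-insert : ∀ c (λs : List (MultiIndex n)) → multiplicity (insert c λs) c ≡ suc (multiplicity λs c)
  multiplicity-insert c λs = ≡.trans (multiplicity-↭ (insert-↭ c λs) c) (multiplicity-here c λs)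

  distinctColumns-unique : (λs : List (MultiIndex n)) → Unique (distinctColumns λs)
  distinctColumns-unique = DecUniqueₚ.deduplicate-! _≟ᵐ_

  ∈-distinctColumns⁺ : ∀ {c} {λs : List (MultiIndex n)} → c ∈ λs → c ∈ distinctColumns λs
  ∈-distinctColumns⁺ = ∈-deduplicate⁺ _≟ᵐ_

  ∈-distinctColumns⁻ : ∀ {c} (λs : List (MultiIndex n)) → c ∈ distinctColumns λs → c ∈ λs
  ∈-distinctColumns⁻ λs = ∈-deduplicate⁻ _≟ᵐ_ λs

  module _ (M : CommutativeMonoid 0ℓ 0ℓ) where

    open CommutativeMonoid M using (Carrier; _≈_; _∙_; ε; trans; reflexive; sym)
    open Fold M

    -- Covers the products 𝔪(λ)!, λ! and g_λ at once. Since `F d 0` is trivial, a column absent from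
    -- `λs` counts as one of multiplicity 0, and new and repeated columns are treated alike.
    fold-distinctColumns-insert : (F : MultiIndex n → ℕ → Carrier) → (∀ d → F d 0 ≈ ε) →
      ∀ c λs {a} → F c (suc (multiplicity λs c)) ≈ a ∙ F c (multiplicity λs c) →
      fold (distinctColumns (insert c λs)) (λ d → F d (multiplicity (insert c λs) d))
        ≈ a ∙ fold (distinctColumns λs) (λ d → F d (multiplicity λs d))
    fold-distinctColumns-insert F F0 c λs {a} step = trans
      (fold-update {g = λ d → F d (multiplicity λs d)} (distinctColumns-unique (insert c λs))
        (∈-distinctColumns⁺ (∈-resp-↭ (↭-sym p) (here ≡.refl)))
        (trans (reflexive (≡.cong (F c) (multiplicity-insert c λs))) step)
        (λ {d} d≢c → reflexive (≡.cong (F d)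
          (≡.trans (multiplicity-↭ p d) (multiplicity-there λs d≢c)))))
      (∙-congˡ (fold-⊆ _ (distinctColumns-unique (insert c λs)) (distinctColumns-unique λs)
        (λ d∈ → ∈-distinctColumns⁺ (∈-resp-↭ (↭-sym p) (there (∈-distinctColumns⁻ λs d∈))))
        (λ {d} _ d∉ → trans (reflexive (≡.cong (F d) (multiplicity-∉ λs (d∉ ∘ ∈-distinctColumns⁺)))) (F0 d))))
      where
      open CommutativeMonoid M using (∙-congˡ)
      p = insert-↭ c λs

module _ {n : ℕ} where

  open Fold ℕₚ.+-0-commutativeMonoid

  fold-multiplicity : (f : MultiIndex n → ℕ) {U : List (MultiIndex n)} → Unique U → ∀ {λs} → All (_∈ U) λs →
                      fold U (λ c → f c ℕ.* multiplicity λs c) ≡ fold λs f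
  fold-multiplicity f {U} U! []              = fold-ε U λ {c} _ → ℕₚ.*-zeroʳ (f c)
  fold-multiplicity f {U} U! {d ∷ λs} (d∈U ∷ λs⊆U) = ≡.trans
    (fold-update U! d∈U
      (≡.trans (≡.cong (f d ℕ.*_) (multiplicity-here d λs)) (ℕₚ.*-suc (f d) _))
      (λ {c} c≢d → ≡.cong (f c ℕ.*_) (multiplicity-there λs c≢d)))
    (≡.cong (f d ℕ.+_) (fold-multiplicity f U! λs⊆U))

  lookup-columnSum : ∀ r (λs : List (MultiIndex n)) → fold λs (λ c → lookup c r) ≡ lookup (columnSum λs) r
  lookup-columnSum r []       = ≡.sym (Vecₚ.lookup-replicate r 0)
  lookup-columnSum r (c ∷ λs) = ≡.trans (≡.cong (lookup c r ℕ.+_) (lookup-columnSum r λs))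
    (≡.sym (Vecₚ.lookup-zipWith ℕ._+_ r c (columnSum λs)))

  ∈⇒∈-box : {c : MultiIndex n} {λs : List (MultiIndex n)} → c ∈ λs → c ∈ box (columnSum λs)
  ∈⇒∈-box {c} {λs} c∈λs with μs , p ← ∈⇒↭∷ c∈λs =
    ≡.subst (λ i → c ∈ box i) (≡.sym (columnSum-↭ p)) (∈-box⁺ c (columnSum μs))

  -- The r-th row sum grouped by equal columns. The sum runs over `box i` and not over the columns
  -- that occur, so that its range is the same for all partitions of `i` and can be exchanged with
  -- the sum over them.
  fold-lookup-multiplicity : ∀ {i λs} r → IsPartition {n} i λs →
                             fold (box i) (λ c → lookup c r ℕ.* multiplicity λs c) ≡ lookup i r
  fold-lookup-multiplicity {i} {λs} r (_ , _ , ≡.refl) = ≡.trans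
    (fold-multiplicity (λ c → lookup c r) (box-unique i) {λs} (All.tabulate ∈⇒∈-box))
    (lookup-columnSum r λs)

unit : ∀ {n} → Fin n → MultiIndex n
unit r = 𝟎 Vec.[ r ]≔ 1

-- Products of power series and the translated quadratic form

module SeriesProperties (R : CommutativeRing 0ℓ 0ℓ) where

  open CommutativeRing R hiding (zero) renaming (Carrier to K)
  open Polynomials R
  open Fold +-commutativeMonoid
  open SemiringSum semiring using (sum; sum-cong-≋)
  open ≈-Reasoning setoid

  *-distribˡ-fold : ∀ {X : Set} a (xs : List X) (f : X → K) → a * fold xs f ≈ fold xs (λ x → a * f x)
  *-distribˡ-fold a []       f = zeroʳ a
  *-distribˡ-fold a (x ∷ xs) f = trans (distribˡ _ _ _) (+-congˡ (*-distribˡ-fold a xs f))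

  module _ {n : ℕ} where

    monomial-refl : (i : MultiIndex n) → monomial i i ≈ 1#
    monomial-refl i with i ≟ᵐ i
    ... | yes _   = refl
    ... | no  i≢i = contradiction ≡.refl i≢i

    monomial-≢ : {i j : MultiIndex n} → i ≢ j → monomial j i ≈ 0#
    monomial-≢ {i} {j} i≢j with i ≟ᵐ j
    ... | yes i≡j = contradiction i≡j i≢j
    ... | no  _   = refl

    monomial-⟨*⟩-⊹ : ∀ j k (f : Series n) → (monomial j ⟨*⟩ f) (j ⊹ k) ≈ f k
    monomial-⟨*⟩-⊹ j k f = begin
      (monomial j ⟨*⟩ f) (j ⊹ k)
        ≈⟨ fold-single _ (box-unique (j ⊹ k)) (∈-box⁺ j k)
             (λ c≢j → trans (*-congʳ (monomial-≢ c≢j)) (zeroˡ _)) ⟩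
      monomial j j * f (zipWith ℕ._∸_ (j ⊹ k) j)
        ≈⟨ *-cong (monomial-refl j) (reflexive (≡.cong f (⊹-∸ j k))) ⟩
      1# * f k
        ≈⟨ *-identityˡ _ ⟩
      f k ∎

    monomial-⟨*⟩-∉ : ∀ {i j} (f : Series n) → j ∉ box i → (monomial j ⟨*⟩ f) i ≈ 0#
    monomial-⟨*⟩-∉ {i} f j∉ = fold-ε (box i) λ {c} c∈ →
      trans (*-congʳ (monomial-≢ λ c≡j → j∉ (≡.subst (_∈ box i) c≡j c∈))) (zeroˡ _)

    ⟨*⟩-distribˡ : ∀ (f g h : Series n) i → (f ⟨*⟩ (g ⟨+⟩ h)) i ≈ (f ⟨*⟩ g) i + (f ⟨*⟩ h) i
    ⟨*⟩-distribˡ f g h i = trans (fold-cong (box i) (λ _ → distribˡ _ _ _)) (fold-∙ (box i) _ _)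

    ⟨*⟩-distribʳ : ∀ (f g h : Series n) i → ((g ⟨+⟩ h) ⟨*⟩ f) i ≈ (g ⟨*⟩ f) i + (h ⟨*⟩ f) i
    ⟨*⟩-distribʳ f g h i = trans (fold-cong (box i) (λ _ → distribʳ _ _ _)) (fold-∙ (box i) _ _)

    ⟨*⟩-scaleˡ : ∀ a {f g : Series n} (h : Series n) → (∀ i → f i ≈ a * g i) → ∀ i → (f ⟨*⟩ h) i ≈ a * (g ⟨*⟩ h) i
    ⟨*⟩-scaleˡ a h f≈ag i = trans (fold-cong (box i) (λ _ → trans (*-congʳ (f≈ag _)) (*-assoc _ _ _)))
      (sym (*-distribˡ-fold a (box i) _))

    constant-⟨*⟩ : ∀ a (f : Series n) i → (constant a ⟨*⟩ f) i ≈ a * f i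
    constant-⟨*⟩ a f i = begin
      (constant a ⟨*⟩ f) i               ≈⟨ ⟨*⟩-scaleˡ a f (λ _ → refl) i ⟩
      a * (monomial 𝟎 ⟨*⟩ f) i           ≡⟨ ≡.cong (λ j → a * (monomial 𝟎 ⟨*⟩ f) j) (⊹-identityˡ i) ⟨
      a * (monomial 𝟎 ⟨*⟩ f) (𝟎 ⊹ i)     ≈⟨ *-congˡ (monomial-⟨*⟩-⊹ 𝟎 i f) ⟩
      a * f i                            ∎

    ⊹-identityʳ : (i : MultiIndex n) → i ⊹ 𝟎 ≡ i
    ⊹-identityʳ = Vecₚ.zipWith-identityʳ ℕₚ.+-identityʳ

    -- In the convolution only the split that gives all of `i` to `f` leaves the exponent 𝟎 for the
    -- constant.
    ⟨*⟩-constant : ∀ a (f : Series n) i → (f ⟨*⟩ constant a) i ≈ a * f i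
    ⟨*⟩-constant a f i = begin
      (f ⟨*⟩ constant a) i
        ≈⟨ fold-⊆ _ (box-unique i) ([] ∷ []) (λ { (here ≡.refl) → i∈box }) off ⟩
      f i * (a * monomial 𝟎 (zipWith ℕ._∸_ i i)) + 0#
        ≈⟨ trans (+-identityʳ _) (*-congˡ (*-congˡ (trans (reflexive (≡.cong (monomial 𝟎) i∸i)) (monomial-refl 𝟎)))) ⟩
      f i * (a * 1#)
        ≈⟨ trans (*-congˡ (*-identityʳ a)) (*-comm _ _) ⟩
      a * f i ∎
      where
      i∈box : i ∈ box i
      i∈box = ≡.subst (λ j → i ∈ box j) (⊹-identityʳ i) (∈-box⁺ i 𝟎)

      i∸i : zipWith ℕ._∸_ i i ≡ 𝟎
      i∸i = ≡.trans (≡.cong (λ j → zipWith ℕ._∸_ j i) (≡.sym (⊹-identityʳ i))) (⊹-∸ i 𝟎)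

      off : ∀ {c} → c ∈ box i → c ∉ i ∷ [] → f c * (a * monomial 𝟎 (zipWith ℕ._∸_ i c)) ≈ 0#
      off {c} c∈ c≢i with k , ≡.refl ← ∈-box⁻ i c∈ =
        trans (*-congˡ (trans (*-congˡ (monomial-≢ λ eq → c≢i (here
          (≡.sym (≡.trans (≡.cong (c ⊹_) (≡.trans (≡.sym (⊹-∸ c k)) eq)) (⊹-identityʳ c))))))
          (zeroʳ a))) (zeroʳ _)

    monomial-⟨*⟩-monomial : ∀ (j k i : MultiIndex n) → (monomial j ⟨*⟩ monomial k) i ≈ monomial (j ⊹ k) i
    monomial-⟨*⟩-monomial j k i with i ≟ᵐ j ⊹ k
    ... | yes ≡.refl = trans (monomial-⟨*⟩-⊹ j k (monomial k)) (monomial-refl k)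
    ... | no  i≢j⊹k  = fold-ε (box i) (λ {c} → off {c})
      where
      off : ∀ {c} → c ∈ box i → monomial j c * monomial k (zipWith ℕ._∸_ i c) ≈ 0#
      off {c} c∈ with c ≟ᵐ j
      ... | no  _      = zeroˡ _
      ... | yes ≡.refl with l , ≡.refl ← ∈-box⁻ i c∈ =
        trans (*-congˡ (monomial-≢ λ eq → i≢j⊹k (≡.cong (c ⊹_) (≡.trans (≡.sym (⊹-∸ c l)) eq)))) (zeroʳ _)

    -- One entry of the form (t + x) M (t + x)ᵀ; `i ≢ 𝟎` removes its constant term x m y.
    linear-product : ∀ a b x m y {i} → i ≢ 𝟎 →
      ((t a ⟨+⟩ constant x) ⟨*⟩ constant m ⟨*⟩ (t b ⟨+⟩ constant y)) i
        ≈ m * (monomial (unit a ⊹ unit b) i + y * monomial (unit a) i + x * monomial (unit b) i)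
    linear-product a b x m y {i} i≢𝟎 = begin
      ((t a ⟨+⟩ constant x) ⟨*⟩ constant m ⟨*⟩ (t b ⟨+⟩ constant y)) i
        ≈⟨ ⟨*⟩-scaleˡ m (t b ⟨+⟩ constant y) (⟨*⟩-constant m (t a ⟨+⟩ constant x)) i ⟩
      m * ((t a ⟨+⟩ constant x) ⟨*⟩ (t b ⟨+⟩ constant y)) i
        ≈⟨ *-congˡ (⟨*⟩-distribʳ (t b ⟨+⟩ constant y) (t a) (constant x) i) ⟩
      m * ((t a ⟨*⟩ (t b ⟨+⟩ constant y)) i + (constant x ⟨*⟩ (t b ⟨+⟩ constant y)) i)
        ≈⟨ *-congˡ (+-cong (⟨*⟩-distribˡ (t a) (t b) (constant y) i) (constant-⟨*⟩ x (t b ⟨+⟩ constant y) i)) ⟩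
      m * ((t a ⟨*⟩ t b) i + (t a ⟨*⟩ constant y) i + x * (t b i + y * monomial 𝟎 i))
        ≈⟨ *-congˡ (+-cong (+-cong (monomial-⟨*⟩-monomial (unit a) (unit b) i) (⟨*⟩-constant y (t a) i))
             (*-congˡ (trans (+-congˡ (trans (*-congˡ (monomial-≢ i≢𝟎)) (zeroʳ y))) (+-identityʳ _)))) ⟩
      m * (monomial (unit a ⊹ unit b) i + y * monomial (unit a) i + x * monomial (unit b) i) ∎

    toSeries-substitute-sum : ∀ {V : Set} {k} (σ : V → Poly (Fin n)) (p : Fin k → Poly V) i →
      toSeries (substitute σ (RawSemiringDefs.sum (polyRawSemiring V) p)) i
        ≈ sum (λ r → toSeries (substitute σ (p r)) i)
    toSeries-substitute-sum {k = zero}  σ p i = zeroˡ _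
    toSeries-substitute-sum {k = suc k} σ p i = +-congˡ (toSeries-substitute-sum σ (p ∘ suc) i)

    -- The polynomial is spelled out in the shape of `1+½t_tᵀ`. Its constant 1 and the value of the
    -- form at `x` sit in degree zero, so for `i ≢ 𝟎` the quadratic and the linear part remain.
    toSeries-shift : ∀ h (m : Fin n → Fin n → K) (x : Fin n → K) {i} → i ≢ 𝟎 →
      toSeries (substitute (λ r → var r ⊕ con (x r))
        (con 1# ⊕ con h ⊗ RawSemiringDefs.sum (polyRawSemiring (Fin n)) λ r →
          RawSemiringDefs.sum (polyRawSemiring (Fin n)) λ s → var r ⊗ con (m r s) ⊗ var s)) i
        ≈ h * sum (λ r → sum λ s →
            m r s * (monomial (unit r ⊹ unit s) i + x s * monomial (unit r) i + x r * monomial (unit s) i))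
    toSeries-shift h m x {i} i≢𝟎 = trans
      (+-cong (trans (*-congˡ (monomial-≢ i≢𝟎)) (zeroʳ _))
              (constant-⟨*⟩ h (toSeries (substitute σ (∑ row))) i))
      (trans (+-identityˡ _) (*-congˡ (trans (toSeries-substitute-sum σ row i)
        (sum-cong-≋ λ r → trans (toSeries-substitute-sum σ (entry r) i)
          (sum-cong-≋ λ s → linear-product r s (x r) (m r s) (x s) i≢𝟎)))))
      where
      ∑ : ∀ {k} → (Fin k → Poly (Fin n)) → Poly (Fin n)
      ∑ = RawSemiringDefs.sum (polyRawSemiring (Fin n))

      σ : Fin n → Poly (Fin n)
      σ r = var r ⊕ con (x r)

      entry : Fin n → Fin n → Poly (Fin n)
      entry r s = var r ⊗ con (m r s) ⊗ var s

      row : Fin n → Poly (Fin n)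
      row r = ∑ (entry r)

-- Unit multi-indices; multiplication and differentiation of series

lookup-⊹ : ∀ {n} (i j : MultiIndex n) r → lookup (i ⊹ j) r ≡ lookup i r ℕ.+ lookup j r
lookup-⊹ i j r = Vecₚ.lookup-zipWith ℕ._+_ r i j

lookup-unit : ∀ {n} (r : Fin n) → lookup (unit r) r ≡ 1
lookup-unit {n} r = Vecₚ.lookup∘updateAt r (𝟎 {n})

lookup-unit-≢ : ∀ {n} {r s : Fin n} → r ≢ s → lookup (unit r) s ≡ 0
lookup-unit-≢ {n} {r} {s} r≢s =
  ≡.trans (Vecₚ.lookup∘updateAt′ s r (r≢s ∘ ≡.sym) (𝟎 {n})) (Vecₚ.lookup-replicate s 0)

unit-view : ∀ {n} (r : Fin n) i → (∃[ k ] i ≡ unit r ⊹ k) ⊎ lookup i r ≡ 0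
unit-view zero    (zero  ∷ i) = inj₂ ≡.refl
unit-view zero    (suc m ∷ i) = inj₁ (m ∷ i , ≡.cong (suc m ∷_) (≡.sym (⊹-identityˡ i)))
unit-view (suc r) (m ∷ i) with unit-view r i
... | inj₁ (k , eq) = inj₁ (m ∷ k , ≡.cong (m ∷_) eq)
... | inj₂ eq       = inj₂ eq

unit∉box : ∀ {n} (r : Fin n) {i} → lookup i r ≡ 0 → unit r ∉ box i
unit∉box r {i} ir≡0 r∈ with k , ≡.refl ← ∈-box⁻ i r∈ =
  ℕₚ.1+n≢0 (≡.trans (≡.cong (ℕ._+ lookup k r) (≡.sym (lookup-unit r))) (≡.trans (≡.sym (lookup-⊹ (unit r) k r)) ir≡0))

-- The series operators f ↦ tᵃ f and f ↦ ∂f/∂tᵣ.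
module Operators (R : CommutativeRing 0ℓ 0ℓ) where

  open CommutativeRing R hiding (zero) renaming (Carrier to K)
  open Polynomials R
  open SeriesProperties R
  open Fold +-commutativeMonoid
  open SemiringSum semiring using (sum; sum-cong-≋; sum-replicate-zero; *-distribˡ-sum; ∑-distrib-+; ∑-comm)
  open SemiringMult semiring using (×-homo-+; ×-congˡ) renaming (_×_ to _·_)
  open RingProperties ring using (-‿distribʳ-*; -1*x≈-x)
  open ≈-Reasoning setoid
  open Solver R

  module _ {n : ℕ} where

    -- The Kronecker delta, read off from `unit` so that the exponents appearing as factors under
    -- differentiation are `δ` by definition.
    δ : Fin n → Fin n → K
    δ a r = lookup (unit a) r · 1#

    δ-refl : ∀ a → δ a a ≈ 1#
    δ-refl a = trans (×-congˡ (lookup-unit a)) (+-identityʳ 1#)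

    δ-≢ : ∀ {a b} → a ≢ b → δ a b ≈ 0#
    δ-≢ a≢b = ×-congˡ (lookup-unit-≢ a≢b)

  sum-δ : ∀ {n} r (f : Fin n → K) → sum (λ a → δ a r * f a) ≈ f r
  sum-δ {suc n} zero f = begin
    δ {suc n} zero zero * f zero + sum (λ a → δ (suc a) zero * f (suc a))
      ≈⟨ +-cong (trans (*-congʳ (δ-refl {suc n} zero)) (*-identityˡ _))
           (trans (sum-cong-≋ {n} (λ a → zeroˡ _)) (sum-replicate-zero n)) ⟩
    f zero + 0#
      ≈⟨ +-identityʳ _ ⟩
    f zero ∎
  sum-δ {suc n} (suc r) f = begin
    δ {suc n} zero (suc r) * f zero + sum (λ a → δ a r * f (suc a))
      ≈⟨ +-cong (trans (*-congʳ (δ-≢ {suc n} {zero} {suc r} λ ())) (zeroˡ _)) (sum-δ r (f ∘ suc)) ⟩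
    0# + f (suc r)
      ≈⟨ +-identityˡ _ ⟩
    f (suc r) ∎

  module _ {n : ℕ} where

    infixr 8 _⊳_
    -- Opaque so that d and f can be inferred from d ⊳ f.
    opaque
      _⊳_ : MultiIndex n → Series n → Series n
      d ⊳ f = monomial d ⟨*⟩ f

      ⊳-cong : ∀ d {f g : Series n} → f ≋ g → d ⊳ f ≋ d ⊳ g
      ⊳-cong d f≋g i = fold-cong (box i) (λ _ → *-congˡ (f≋g _))

      ⊳-+ : ∀ d (f g : Series n) i → (d ⊳ (f ⟨+⟩ g)) i ≈ (d ⊳ f) i + (d ⊳ g) i
      ⊳-+ d = ⟨*⟩-distribˡ (monomial d)

      ⊳-* : ∀ d a (f : Series n) i → (d ⊳ (λ j → a * f j)) i ≈ a * (d ⊳ f) i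
      ⊳-* d a f i = trans (fold-cong (box i) (λ _ → solve 3 (λ x y z → x :* (y :* z) := y :* (x :* z)) refl _ _ _))
        (sym (*-distribˡ-fold a (box i) _))

      ⊳-0 : ∀ d i → (d ⊳ (λ _ → 0#)) i ≈ 0#
      ⊳-0 d i = fold-ε (box i) (λ _ → zeroʳ _)

      ⊳-self : ∀ d (f : Series n) i → (d ⊳ f) (d ⊹ i) ≈ f i
      ⊳-self d f i = monomial-⟨*⟩-⊹ d i f

      ⊳-∉ : ∀ {d} (f : Series n) {i} → d ∉ box i → (d ⊳ f) i ≈ 0#
      ⊳-∉ f {i} = monomial-⟨*⟩-∉ {i = i} f

    ⊳-sum : ∀ d {k} (f : Fin k → Series n) i → (d ⊳ (λ j → sum λ r → f r j)) i ≈ sum (λ r → (d ⊳ f r) i)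
    ⊳-sum d {zero}  f i = ⊳-0 d i
    ⊳-sum d {suc k} f i = trans (⊳-+ d (f zero) _ i) (+-congˡ (⊳-sum d (f ∘ suc) i))

    -- A common monomial factor cancels. Both sides vanish unless `d′` lies in the box of `i`, and
    -- otherwise both pick the same coefficient of `f`.
    ⊳-⊹ : ∀ d d′ (f : Series n) i → ((d ⊹ d′) ⊳ f) (d ⊹ i) ≈ (d′ ⊳ f) i
    ⊳-⊹ d d′ f i with d′ ∈? box i
      where open DecMembership _≟ᵐ_ using (_∈?_)
    ... | no d′∉ = trans (⊳-∉ f λ ∈box → let k , eq = ∈-box⁻ (d ⊹ i) ∈box in
                     d′∉ (≡.subst (λ j → d′ ∈ box j) (⊹-cancelˡ d (≡.trans (≡.sym (⊹-assoc d d′ k)) eq)) (∈-box⁺ d′ k)))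
                   (sym (⊳-∉ f d′∉))
    ... | yes d′∈ with k , ≡.refl ← ∈-box⁻ i d′∈ = begin
      ((d ⊹ d′) ⊳ f) (d ⊹ (d′ ⊹ k))  ≡⟨ ≡.cong ((d ⊹ d′) ⊳ f) (⊹-assoc d d′ k) ⟨
      ((d ⊹ d′) ⊳ f) (d ⊹ d′ ⊹ k)    ≈⟨ ⊳-self (d ⊹ d′) f k ⟩
      f k                            ≈⟨ ⊳-self d′ f k ⟨
      (d′ ⊳ f) (d′ ⊹ k)              ∎

    unit-⊳-0 : ∀ r (f : Series n) {i} → lookup i r ≡ 0 → (unit r ⊳ f) i ≈ 0#
    unit-⊳-0 r f {i} ir≡0 = ⊳-∉ f (unit∉box r {i} ir≡0)

    unit-⊳-⊳ : ∀ r s (f : Series n) i → (unit r ⊳ unit s ⊳ f) i ≈ ((unit r ⊹ unit s) ⊳ f) i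
    unit-⊳-⊳ r s f i with unit-view r i
    ... | inj₁ (k , ≡.refl) = trans (⊳-self (unit r) _ k) (sym (⊳-⊹ (unit r) (unit s) f k))
    ... | inj₂ ir≡0 = trans (unit-⊳-0 r _ ir≡0) (sym (⊳-∉ f λ ∈box → let k , eq = ∈-box⁻ i ∈box in
            unit∉box r {i} ir≡0 (≡.subst (λ j → unit r ∈ box j)
              (≡.trans (≡.sym (⊹-assoc (unit r) (unit s) k)) eq) (∈-box⁺ (unit r) (unit s ⊹ k)))))

    unit-⊳-comm : ∀ r s (f : Series n) i → (unit r ⊳ unit s ⊳ f) i ≈ (unit s ⊳ unit r ⊳ f) i
    unit-⊳-comm r s f i = trans (unit-⊳-⊳ r s f i) (trans
      (reflexive (≡.cong (λ d → (d ⊳ f) i) (⊹-comm (unit r) (unit s)))) (sym (unit-⊳-⊳ s r f i)))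

    ∂ : Fin n → Series n → Series n
    ∂ a f k = suc (lookup k a) · 1# * f (unit a ⊹ k)

    ∂-sum : ∀ a {m} (f : Fin m → Series n) i → ∂ a (λ j → sum λ r → f r j) i ≈ sum (λ r → ∂ a (f r) i)
    ∂-sum a f i = *-distribˡ-sum _ (λ r → f r (unit a ⊹ i))

    -- The commutation relation [∂ₐ, tₛ] = δₛₐ, verified on coefficients according to whether tₛ
    -- divides tⁱ.
    ∂-commutator : ∀ a s (f : Series n) i → ∂ a (unit s ⊳ f) i ≈ (unit s ⊳ ∂ a f) i + δ s a * f i
    ∂-commutator a s f i with unit-view s i
    ... | inj₁ (k , ≡.refl) = begin
      suc (lookup (unit s ⊹ k) a) · 1# * (unit s ⊳ f) (unit a ⊹ (unit s ⊹ k))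
        ≈⟨ *-cong
             (trans (×-congˡ (≡.cong suc (lookup-⊹ (unit s) k a))) (+-congˡ (×-homo-+ 1# (lookup (unit s) a) (lookup k a))))
             (trans (reflexive (≡.cong (unit s ⊳ f) (x⊹yz≡y⊹xz (unit a) (unit s) k)))
                    (⊳-self (unit s) f (unit a ⊹ k))) ⟩
      (1# + (δ s a + κ)) * f (unit a ⊹ k)
        ≈⟨ solve 4 (λ o d κ x → (o :+ (d :+ κ)) :* x := (o :+ κ) :* x :+ d :* x) refl 1# (δ s a) κ (f (unit a ⊹ k)) ⟩
      (1# + κ) * f (unit a ⊹ k) + δ s a * f (unit a ⊹ k)
        ≈⟨ +-cong (sym (⊳-self (unit s) (∂ a f) k)) same ⟩
      (unit s ⊳ ∂ a f) (unit s ⊹ k) + δ s a * f (unit s ⊹ k) ∎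
      where
      κ = lookup k a · 1#
      same : δ s a * f (unit a ⊹ k) ≈ δ s a * f (unit s ⊹ k)
      same with s Finₚ.≟ a
      ... | yes ≡.refl = refl
      ... | no  s≢a    = trans (*-congʳ (δ-≢ s≢a)) (trans (zeroˡ _) (sym (trans (*-congʳ (δ-≢ s≢a)) (zeroˡ _))))
    ... | inj₂ is≡0 = begin
      suc (lookup i a) · 1# * (unit s ⊳ f) (unit a ⊹ i)  ≈⟨ lhs ⟩
      δ s a * f i                                        ≈⟨ +-identityˡ _ ⟨
      0# + δ s a * f i                                   ≈⟨ +-congʳ (unit-⊳-0 s _ is≡0) ⟨
      (unit s ⊳ ∂ a f) i + δ s a * f i                   ∎
      where
      lhs : suc (lookup i a) · 1# * (unit s ⊳ f) (unit a ⊹ i) ≈ δ s a * f i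
      lhs with s Finₚ.≟ a
      ... | yes ≡.refl = *-cong (×-congˡ (≡.trans (≡.cong suc is≡0) (≡.sym (lookup-unit s))))
                                (⊳-self (unit s) f i)
      ... | no  s≢a    = trans (*-congˡ (unit-⊳-0 s f (≡.trans (lookup-⊹ (unit a) i s)
                           (≡.cong₂ ℕ._+_ (lookup-unit-≢ (s≢a ∘ ≡.sym)) is≡0))))
                         (trans (zeroʳ _) (sym (trans (*-congʳ (δ-≢ s≢a)) (zeroˡ _))))

    infixr 8 _⊲_
    -- Multiplication by the linear form Σ_b c_b t_b. With `c` a row of B this is the part of ∂F/∂tᵣ
    -- that depends on t.
    _⊲_ : (Fin n → K) → Series n → Series n
    (c ⊲ f) i = sum (λ b → c b * (unit b ⊳ f) i)

    ⊲-cong : ∀ c {f g : Series n} → f ≋ g → c ⊲ f ≋ c ⊲ g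
    ⊲-cong c f≋g i = sum-cong-≋ (λ b → *-congˡ (⊳-cong (unit b) f≋g i))

    ⊲-+ : ∀ c (f g : Series n) i → (c ⊲ (f ⟨+⟩ g)) i ≈ (c ⊲ f) i + (c ⊲ g) i
    ⊲-+ c f g i = trans (sum-cong-≋ (λ b → trans (*-congˡ (⊳-+ (unit b) f g i)) (distribˡ _ _ _)))
      (∑-distrib-+ (λ b → c b * (unit b ⊳ f) i) _)

    ⊲-* : ∀ c a (f : Series n) i → (c ⊲ (λ j → a * f j)) i ≈ a * (c ⊲ f) i
    ⊲-* c a f i = trans
      (sum-cong-≋ (λ b → trans (*-congˡ (⊳-* (unit b) a f i))
        (solve 3 (λ x y z → x :* (y :* z) := y :* (x :* z)) refl (c b) a _)))
      (sym (*-distribˡ-sum a (λ b → c b * (unit b ⊳ f) i)))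

    ⊲-comm : ∀ c d (f : Series n) i → (c ⊲ d ⊲ f) i ≈ (d ⊲ c ⊲ f) i
    ⊲-comm c d f i = trans (expand c d) (trans (∑-comm {n} {n} _) (trans
      (sum-cong-≋ λ b → sum-cong-≋ λ a → trans
        (*-congˡ (*-congˡ (unit-⊳-comm a b f i)))
        (solve 3 (λ x y z → x :* (y :* z) := y :* (x :* z)) refl (c a) (d b) _))
      (sym (expand d c))))
      where
      expand : ∀ c d → (c ⊲ d ⊲ f) i ≈ sum (λ a → sum λ b → c a * (d b * (unit a ⊳ unit b ⊳ f) i))
      expand c d = sum-cong-≋ λ a → trans
        (*-congˡ (trans (⊳-sum (unit a) (λ b j → d b * (unit b ⊳ f) j) i)
          (sum-cong-≋ λ b → ⊳-* (unit a) (d b) (unit b ⊳ f) i)))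
        (*-distribˡ-sum (c a) (λ b → d b * (unit a ⊳ unit b ⊳ f) i))

    ∂-⊲-commutator : ∀ a c (f : Series n) i → ∂ a (c ⊲ f) i ≈ (c ⊲ ∂ a f) i + c a * f i
    ∂-⊲-commutator a c f i = begin
      ∂ a (c ⊲ f) i
        ≈⟨ ∂-sum a (λ b j → c b * (unit b ⊳ f) j) i ⟩
      sum (λ b → suc (lookup i a) · 1# * (c b * (unit b ⊳ f) (unit a ⊹ i)))
        ≈⟨ sum-cong-≋ (λ b → trans
             (solve 3 (λ x y z → x :* (y :* z) := y :* (x :* z)) refl _ (c b) _)
             (trans (*-congˡ (∂-commutator a b f i))
             (solve 4 (λ x y z w → x :* (y :+ z :* w) := x :* y :+ z :* (x :* w)) refl (c b) _ (δ b a) (f i)))) ⟩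
      sum (λ b → c b * (unit b ⊳ ∂ a f) i + δ b a * (c b * f i))
        ≈⟨ ∑-distrib-+ (λ b → c b * (unit b ⊳ ∂ a f) i) _ ⟩
      (c ⊲ ∂ a f) i + sum (λ b → δ b a * (c b * f i))
        ≈⟨ +-congˡ (sum-δ a (λ b → c b * f i)) ⟩
      (c ⊲ ∂ a f) i + c a * f i ∎

    -- The equation satisfied by exp(− ½ t B tᵀ − β tᵀ).
    Gaussian : (Fin n → Fin n → K) → (Fin n → K) → Series n → Set
    Gaussian B β f = ∀ a i → ∂ a f i ≈ - ((B a ⊲ f) i + β a * f i)

    -- Differentiating the equation for f with respect to a parameter on which β
    -- depends with derivative B r shows that − B r ⊲ f solves the equation for
    -- the derivative of f.
    Gaussian-derivative : ∀ {B β f} → (∀ a b → B a b ≈ B b a) → Gaussian B β f → ∀ r a i →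
      ∂ a (λ j → - (B r ⊲ f) j) i
        ≈ - ((B a ⊲ (λ j → - (B r ⊲ f) j)) i + (β a * - (B r ⊲ f) i + B a r * f i))
    Gaussian-derivative {B} {β} {f} B-sym ∂f r a i = begin
      ∂ a (λ j → - (B r ⊲ f) j) i
        ≈⟨ -‿distribʳ-* _ _ ⟨
      - ∂ a (B r ⊲ f) i
        -- The commutator leaves `B r a * f i`. By symmetry of `B` this is the term that arises from
        -- differentiating the coefficient `β a` along xᵣ.
        ≈⟨ -‿cong (∂-⊲-commutator a (B r) f i) ⟩
      - ((B r ⊲ ∂ a f) i + B r a * f i)
        ≈⟨ -‿cong (+-cong (trans (⊲-cong (B r) (λ j → trans (∂f a j)
             (solve 3 (λ o x y → :- (x :+ y) := :- x :+ :- y) refl 1# _ _)) i)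
             (trans (⊲-+ (B r) (λ j → - (B a ⊲ f) j) (λ j → - (β a * f j)) i)
               (+-cong (trans (neg-⊲ (B r) (B a ⊲ f)) (-‿cong (⊲-comm (B r) (B a) f i)))
                       (trans (neg-⊲ (B r) _) (-‿cong (⊲-* (B r) (β a) f i))))))
             (*-congʳ (B-sym r a))) ⟩
      - ((- (B a ⊲ B r ⊲ f) i + - (β a * (B r ⊲ f) i)) + B a r * f i)
        ≈⟨ solve 4 (λ x b y z → :- ((:- x :+ :- (b :* y)) :+ z) := :- (:- x :+ (b :* :- y :+ z))) refl _ (β a) _ _ ⟩
      - (- (B a ⊲ B r ⊲ f) i + (β a * - (B r ⊲ f) i + B a r * f i))
        ≈⟨ -‿cong (+-congʳ (neg-⊲ (B a) (B r ⊲ f))) ⟨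
      - ((B a ⊲ (λ j → - (B r ⊲ f) j)) i + (β a * - (B r ⊲ f) i + B a r * f i)) ∎
      where
      neg-⊲ : ∀ c (g : Series n) → (c ⊲ (λ j → - g j)) i ≈ - (c ⊲ g) i
      neg-⊲ c g = begin
        (c ⊲ (λ j → - g j)) i         ≈⟨ ⊲-cong c (λ j → sym (-1*x≈-x (g j))) i ⟩
        (c ⊲ (λ j → - 1# * g j)) i    ≈⟨ ⊲-* c (- 1#) g i ⟩
        - 1# * (c ⊲ g) i              ≈⟨ -1*x≈-x _ ⟩
        - (c ⊲ g) i                   ∎

-- From the Euler equation to the Gaussian equation

module Euler (R : CommutativeRing 0ℓ 0ℓ) where

  open CommutativeRing R hiding (zero) renaming (Carrier to K)
  open Polynomials R
  open SeriesProperties R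
  open Operators R
  open Fold +-commutativeMonoid
  open SemiringSum semiring using (sum; sum-cong-≋; *-distribˡ-sum; *-distribʳ-sum; ∑-distrib-+)
  open SemiringMult semiring using (×-homo-+; ×-congˡ) renaming (_×_ to _·_)
  open ≈-Reasoning setoid
  open Solver R

  module _ {n : ℕ} where

    -- The coefficient of tᵏ in (tᵣ ∂F/∂tᵣ) f.
    euler : Fin n → Series n → Series n → MultiIndex n → K
    euler r F f k = fold (box k) (λ c → lookup c r · 1# * (F c * f (zipWith ℕ._∸_ k c)))

    -- The coefficients in positive degree of h ((t + x) M (t + x)ᵀ).
    coefficient : K → (Fin n → Fin n → K) → (Fin n → K) → Series n
    coefficient h M x c = h * sum (λ r → sum λ s →
      M r s * (monomial (unit r ⊹ unit s) c + x s * monomial (unit r) c + x r * monomial (unit s) c))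

    module _ (r : Fin n) (f : Series n) (k : MultiIndex n) where

      -- The index 𝟎 has weight `lookup 𝟎 r`, which is 0, so agreement in positive degree suffices.
      -- `coefficient` describes the translated form only there.
      euler-cong : ∀ {F G} → (∀ {c} → c ≢ 𝟎 → F c ≈ G c) → euler r F f k ≈ euler r G f k
      euler-cong {F} {G} F≈G = fold-cong (box k) (λ {c} _ → pointwise c)
        where
        pointwise : ∀ c → lookup c r · 1# * (F c * f (zipWith ℕ._∸_ k c)) ≈ lookup c r · 1# * (G c * f (zipWith ℕ._∸_ k c))
        pointwise c with c ≟ᵐ 𝟎
        ... | no  c≢𝟎    = *-congˡ (*-congʳ (F≈G c≢𝟎))
        ... | yes ≡.refl = trans (trans (*-congʳ 0·) (zeroˡ _)) (sym (trans (*-congʳ 0·) (zeroˡ _)))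
          where
          0· : lookup (𝟎 {n}) r · 1# ≈ 0#
          0· = ×-congˡ (Vecₚ.lookup-replicate r 0)

      euler-+ : ∀ F G → euler r (F ⟨+⟩ G) f k ≈ euler r F f k + euler r G f k
      euler-+ F G = trans
        (fold-cong (box k) (λ _ → solve 4 (λ l a b x → l :* ((a :+ b) :* x) := l :* (a :* x) :+ l :* (b :* x)) refl _ _ _ _))
        (fold-∙ (box k) _ _)

      euler-* : ∀ a F → euler r (λ c → a * F c) f k ≈ a * euler r F f k
      euler-* a F = trans
        (fold-cong (box k) (λ _ → solve 4 (λ l a b x → l :* ((a :* b) :* x) := a :* (l :* (b :* x))) refl _ _ _ _))
        (sym (*-distribˡ-fold a (box k) _))

      euler-sum : ∀ {m} (F : Fin m → Series n) → euler r (λ c → sum λ a → F a c) f k ≈ sum (λ a → euler r (F a) f k)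
      euler-sum {zero}  F = fold-ε (box k) (λ _ → trans (*-congˡ (zeroˡ _)) (zeroʳ _))
      euler-sum {suc m} F = trans (euler-+ (F zero) _) (+-congˡ (euler-sum (F ∘ suc)))

      opaque
        unfolding _⊳_

        euler-monomial : ∀ d → euler r (monomial d) f k ≈ lookup d r · 1# * (d ⊳ f) k
        euler-monomial d = trans (fold-cong (box k) (λ {c} _ → pointwise c)) (sym (*-distribˡ-fold _ (box k) _))
          where
          pointwise : ∀ c → lookup c r · 1# * (monomial d c * f (zipWith ℕ._∸_ k c))
                            ≈ lookup d r · 1# * (monomial d c * f (zipWith ℕ._∸_ k c))
          pointwise c with c ≟ᵐ d
          ... | yes ≡.refl = refl
          ... | no  _      = trans (trans (*-congˡ (zeroˡ _)) (zeroʳ _)) (sym (trans (*-congˡ (zeroˡ _)) (zeroʳ _)))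

      euler-coefficient : ∀ h M x → euler r (coefficient h M x) f k ≈
        h * sum (λ a → sum λ b → M a b *
          ((δ a r + δ b r) * ((unit a ⊹ unit b) ⊳ f) k + x b * (δ a r * (unit a ⊳ f) k) + x a * (δ b r * (unit b ⊳ f) k)))
      euler-coefficient h M x = trans (euler-* h _) (*-congˡ
        (trans (euler-sum (λ a c → sum λ b → term a b c)) (sum-cong-≋ λ a →
        trans (euler-sum (term a)) (sum-cong-≋ λ b → trans (euler-* (M a b) _) (*-congˡ
          (trans (euler-+ (λ c → monomial (unit a ⊹ unit b) c + x b * monomial (unit a) c) _)
          (+-cong (trans (euler-+ (monomial (unit a ⊹ unit b)) _)
            (+-cong
              (trans (euler-monomial (unit a ⊹ unit b)) (*-congʳ
                (trans (×-congˡ (lookup-⊹ (unit a) (unit b) r)) (×-homo-+ 1# (lookup (unit a) r) (lookup (unit b) r)))))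
              (trans (euler-* (x b) (monomial (unit a))) (*-congˡ (euler-monomial (unit a))))))
            (trans (euler-* (x a) (monomial (unit b))) (*-congˡ (euler-monomial (unit b)))))))))))
        where
        term : Fin n → Fin n → Series n
        term a b c = M a b * (monomial (unit a ⊹ unit b) c + x b * monomial (unit a) c + x a * monomial (unit b) c)

    module _ (h : K) (M : Fin n → Fin n → K) where

      -- The Hessian of h t M tᵀ; for h = ½ it is the symmetric part of `M`.
      symmetrized : Fin n → Fin n → K
      symmetrized a b = h * (M a b + M b a)

      symmetrized-sym : ∀ a b → symmetrized a b ≈ symmetrized b a
      symmetrized-sym a b = *-congˡ (+-comm _ _)

      module _ (x : Fin n → K) where

        -- The gradient of h x M xᵀ at `x`, which is also the coefficient vector of the linear part
        -- of F.
        slope : Fin n → K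
        slope a = sum (λ b → symmetrized a b * x b)

        -- Reading the Euler equation at the exponent `unit r ⊹ i` cancels the factor tᵣ on both
        -- sides.
        euler⇒gaussian : ∀ {F f} → (∀ {c} → c ≢ 𝟎 → F c ≈ coefficient h M x c) →
          (∀ r k → lookup k r · 1# * f k ≈ - euler r F f k) → Gaussian symmetrized slope f
        euler⇒gaussian {F} {f} F≈ eq r i = begin
          suc (lookup i r) · 1# * f k
            ≈⟨ *-congʳ (×-congˡ (≡.trans (lookup-⊹ (unit r) i r) (≡.cong (ℕ._+ lookup i r) (lookup-unit r)))) ⟨
          lookup k r · 1# * f k
            ≈⟨ eq r k ⟩
          - euler r F f k
            ≈⟨ -‿cong (trans (euler-cong r f k F≈) (euler-coefficient r f k h M x)) ⟩
          - (h * sum (λ a → sum λ b → M a b *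
              ((δ a r + δ b r) * ((unit a ⊹ unit b) ⊳ f) k + x b * (δ a r * (unit a ⊳ f) k) + x a * (δ b r * (unit b ⊳ f) k))))
            -- The product rule splits each entry into a part carrying `δ a r` and a part carrying
            -- `δ b r`; the deltas collapse the double sum to row r plus column r of `M`.
            ≈⟨ -‿cong (*-congˡ (trans (sum-cong-≋ λ a → trans (sum-cong-≋ (summand a)) (∑-distrib-+ (λ b → δ a r * (M a b * y b)) _))
                 (trans (∑-distrib-+ (λ a → sum λ b → δ a r * (M a b * y b)) _) (+-cong
                   (trans (sum-cong-≋ λ a → sym (*-distribˡ-sum (δ a r) (λ b → M a b * y b)))
                     (sum-δ r (λ a → sum λ b → M a b * y b)))
                   (sum-cong-≋ λ a → sum-δ r (λ b → M a b * y a)))))) ⟩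
          - (h * (sum (λ b → M r b * y b) + sum (λ a → M a r * y a)))
            ≈⟨ -‿cong (trans (*-congˡ (sym (∑-distrib-+ (λ b → M r b * y b) _))) (trans (*-distribˡ-sum h (λ b → M r b * y b + M b r * y b))
                 (sum-cong-≋ λ b → solve 6 (λ h p q u v z → h :* (p :* (u :+ v :* z) :+ q :* (u :+ v :* z))
                    := h :* (p :+ q) :* u :+ h :* (p :+ q) :* v :* z) refl h (M r b) (M b r) _ (x b) (f i)))) ⟩
          - sum (λ b → symmetrized r b * (unit b ⊳ f) i + symmetrized r b * x b * f i)
            ≈⟨ -‿cong (trans (∑-distrib-+ (λ b → symmetrized r b * (unit b ⊳ f) i) _)
                 (+-congˡ (sym (*-distribʳ-sum (f i) (λ b → symmetrized r b * x b))))) ⟩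
          - ((symmetrized r ⊲ f) i + slope r * f i) ∎
          where
          k : MultiIndex n
          k = unit r ⊹ i

          -- The coefficient of tⁱ in (t_b + x_b) f.
          y : Fin n → K
          y b = (unit b ⊳ f) i + x b * f i

          -- Under the factor `δ a r` one may assume a = r, and only then does `unit a` match the
          -- `unit r` contained in `k`.
          cancel : ∀ {a} {u v} → (a ≡ r → u ≈ v) → δ a r * u ≈ δ a r * v
          cancel {a} u≈v with a Finₚ.≟ r
          ... | yes a≡r = *-congˡ (u≈v a≡r)
          ... | no  a≢r = trans (trans (*-congʳ (δ-≢ a≢r)) (zeroˡ _)) (sym (trans (*-congʳ (δ-≢ a≢r)) (zeroˡ _)))

          summand : ∀ a b → M a b *
              ((δ a r + δ b r) * ((unit a ⊹ unit b) ⊳ f) k + x b * (δ a r * (unit a ⊳ f) k) + x a * (δ b r * (unit b ⊳ f) k))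
            ≈ δ a r * (M a b * y b) + δ b r * (M a b * y a)
          summand a b = trans
            (solve 8 (λ m p q s z t w v → m :* ((p :+ q) :* s :+ z :* (p :* t) :+ w :* (q :* v))
               := m :* (p :* (s :+ z :* t)) :+ m :* (q :* (s :+ w :* v))) refl (M a b) (δ a r) (δ b r) _ (x b) _ (x a) _)
            (trans (+-cong
              (*-congˡ (cancel λ { ≡.refl → +-cong (⊳-⊹ (unit a) (unit b) f i) (*-congˡ (⊳-self (unit a) f i)) }))
              (*-congˡ (cancel λ { ≡.refl → +-cong
                (trans (reflexive (≡.cong (λ d → (d ⊳ f) k) (⊹-comm (unit a) (unit b)))) (⊳-⊹ (unit b) (unit a) f i))
                (*-congˡ (⊳-self (unit b) f i)) })))
            (solve 5 (λ m p q u v → m :* (p :* u) :+ m :* (q :* v) := p :* (m :* u) :+ q :* (m :* v)) refl (M a b) _ _ _ _))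

-- The factorials in the denominators

module ℕProduct = Fold ℕₚ.*-1-commutativeMonoid

fold-≢0 : {X : Set} (xs : List X) {f : X → ℕ} → (∀ x → f x ≢ 0) → ℕProduct.fold xs f ≢ 0
fold-≢0 []       f≢0 = λ ()
fold-≢0 (x ∷ xs) f≢0 eq with ℕₚ.m*n≡0⇒m≡0∨n≡0 _ eq
... | inj₁ fx≡0 = f≢0 x fx≡0
... | inj₂ rest = fold-≢0 xs f≢0 rest

!≢0 : ∀ k → k ! ≢ 0
!≢0 k = ℕ.≢-nonZero⁻¹ (k !) {{ℕₚ._!≢0 k}}

!ᵐ≢0 : ∀ {n} (i : MultiIndex n) → i !ᵐ ≢ 0
!ᵐ≢0 []      = λ ()
!ᵐ≢0 (m ∷ i) eq with ℕₚ.m*n≡0⇒m≡0∨n≡0 (m !) eq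
... | inj₁ m!≡0 = !≢0 m m!≡0
... | inj₂ rest = !ᵐ≢0 i rest

module _ {n : ℕ} where

  multiplicities!-insert : ∀ c (λs : List (MultiIndex n)) →
    multiplicities! (insert c λs) ≡ suc (multiplicity λs c) ℕ.* multiplicities! λs
  multiplicities!-insert c λs =
    fold-distinctColumns-insert ℕₚ.*-1-commutativeMonoid (λ _ k → k !) (λ _ → ≡.refl) c λs {suc (multiplicity λs c)} ≡.refl

  columns!-insert : ∀ c (λs : List (MultiIndex n)) → columns! (insert c λs) ≡ c !ᵐ ℕ.* columns! λs
  columns!-insert c λs =
    fold-distinctColumns-insert ℕₚ.*-1-commutativeMonoid (λ d k → (d !ᵐ) ℕ.^ k) (λ _ → ≡.refl) c λs {c !ᵐ} ≡.refl

  multiplicities!≢0 : (λs : List (MultiIndex n)) → multiplicities! λs ≢ 0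
  multiplicities!≢0 λs = fold-≢0 (distinctColumns λs) (λ c → !≢0 (multiplicity λs c))

  columns!≢0 : (λs : List (MultiIndex n)) → columns! λs ≢ 0
  columns!≢0 λs = fold-≢0 (distinctColumns λs) (λ c eq → !ᵐ≢0 c (ℕₚ.m^n≡0⇒m≡0 (c !ᵐ) (multiplicity λs c) eq))

  denominator : List (MultiIndex n) → ℕ
  denominator λs = multiplicities! λs ℕ.* columns! λs

  denominator≢0 : ∀ λs → denominator λs ≢ 0
  denominator≢0 λs eq with ℕₚ.m*n≡0⇒m≡0∨n≡0 (multiplicities! λs) eq
  ... | inj₁ p = multiplicities!≢0 λs p
  ... | inj₂ p = columns!≢0 λs p

  denominator-insert : ∀ c λs →
    denominator (insert c λs) ≡ suc (multiplicity λs c) ℕ.* (c !ᵐ ℕ.* denominator λs)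
  denominator-insert c λs = ≡.trans
    (≡.cong₂ ℕ._*_ (multiplicities!-insert c λs) (columns!-insert c λs))
    (≡.trans (ℕₚ.*-assoc (suc (multiplicity λs c)) (multiplicities! λs) (c !ᵐ ℕ.* columns! λs)) (≡.cong (suc (multiplicity λs c) ℕ.*_)
      (x∙yz≈y∙xz (multiplicities! λs) (c !ᵐ) (columns! λs))))
    where open CommutativeSemigroupProperties ℕₚ.*-commutativeSemigroup using (x∙yz≈y∙xz)

-- Ordered fields, and the sum over partitions

module FieldProperties (𝓡 : CompleteOrderedField) where

  open CompleteOrderedField 𝓡 hiding (zero) renaming (Carrier to ℝ)
  open Solver commutativeRing
  open RingProperties ring using (-0#≈0#; -1*x≈-x)
  open SemiringMult semiring using (×-homo-+; ×-congˡ; ×1-homo-*)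
  open ≈-Reasoning setoid

  ≤-cong : ∀ {x x′ y y′} → x ≈ x′ → y ≈ y′ → x ≤ y → x′ ≤ y′
  ≤-cong p q x≤y = ≤-trans (≤-reflexive (sym p)) (≤-trans x≤y (≤-reflexive q))

  +-mono-≤ : ∀ {w x y z} → w ≤ x → y ≤ z → w + y ≤ x + z
  +-mono-≤ {w} {x} {y} {z} w≤x y≤z =
    ≤-trans (+-monoˡ-≤ y w≤x) (≤-cong (+-comm y x) (+-comm z x) (+-monoˡ-≤ x y≤z))

  neg-≤ : ∀ {x y} → x ≤ y → - y ≤ - x
  neg-≤ {x} {y} x≤y = ≤-cong
    (solve 2 (λ x y → x :+ (:- x :+ :- y) := :- y) refl x y)
    (solve 2 (λ x y → y :+ (:- x :+ :- y) := :- x) refl x y)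
    (+-monoˡ-≤ (- x + - y) x≤y)

  0≤-⇒≤ : ∀ {x y} → 0# ≤ y - x → x ≤ y
  0≤-⇒≤ {x} {y} p = ≤-cong (+-identityˡ x) (solve 2 (λ x y → (y :- x) :+ x := y) refl x y) (+-monoˡ-≤ x p)

  0≤1 : 0# ≤ 1#
  0≤1 with total 0# 1#
  ... | inj₁ 0≤1 = 0≤1
  ... | inj₂ 1≤0 = ≤-cong refl (trans (solve 1 (λ x → :- x :* :- x := x :* x) refl 1#) (*-identityˡ 1#))
    (*-nonNeg 0≤-1 0≤-1)
    where
    0≤-1 : 0# ≤ - 1#
    0≤-1 = ≤-cong -0#≈0# refl (neg-≤ 1≤0)

  0<1 : 0# < 1#
  0<1 = 0≤1 , 0≉1

  fromℕ-nonNeg : ∀ k → 0# ≤ fromℕ k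
  fromℕ-nonNeg zero    = ≤-refl
  fromℕ-nonNeg (suc k) = ≤-cong (+-identityˡ 0#) refl (+-mono-≤ 0≤1 (fromℕ-nonNeg k))

  fromℕ≉0 : ∀ k → k ≢ 0 → ¬ fromℕ k ≈ 0#
  fromℕ≉0 zero    k≢0 _  = k≢0 ≡.refl
  fromℕ≉0 (suc k) _   eq = 0≉1 (≤-antisym 0≤1
    (≤-cong (+-identityʳ 1#) eq (+-mono-≤ ≤-refl (fromℕ-nonNeg k))))

  ⁻¹-unique : ∀ {x y} → x * y ≈ 1# → x ⁻¹ ≈ y
  ⁻¹-unique {x} {y} xy≈1 = begin
    x ⁻¹             ≈⟨ *-identityˡ _ ⟨
    1# * x ⁻¹        ≈⟨ *-congʳ xy≈1 ⟨
    x * y * x ⁻¹     ≈⟨ solve 3 (λ x y z → x :* y :* z := y :* (x :* z)) refl x y _ ⟩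
    y * (x * x ⁻¹)   ≈⟨ *-congˡ (⁻¹-inverseʳ (λ x≈0 → 0≉1 (trans (sym (trans (*-congʳ x≈0) (zeroˡ y))) xy≈1))) ⟩
    y * 1#           ≈⟨ *-identityʳ y ⟩
    y                ∎

  1⁻¹ : 1# ⁻¹ ≈ 1#
  1⁻¹ = ⁻¹-unique (*-identityˡ 1#)

  ⁻¹-* : ∀ {x y} → ¬ x ≈ 0# → ¬ y ≈ 0# → (x * y) ⁻¹ ≈ x ⁻¹ * y ⁻¹
  ⁻¹-* {x} {y} x≉0 y≉0 = ⁻¹-unique (begin
    x * y * (x ⁻¹ * y ⁻¹)     ≈⟨ solve 4 (λ x y z w → x :* y :* (z :* w) := (x :* z) :* (y :* w)) refl x y _ _ ⟩
    (x * x ⁻¹) * (y * y ⁻¹)   ≈⟨ *-cong (⁻¹-inverseʳ x≉0) (⁻¹-inverseʳ y≉0) ⟩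
    1# * 1#                   ≈⟨ *-identityˡ 1# ⟩
    1#                        ∎)

  ⁻¹-cancelˡ : ∀ {x y} → ¬ x ≈ 0# → x ⁻¹ * (x * y) ≈ y
  ⁻¹-cancelˡ {x} {y} x≉0 = trans (solve 3 (λ x y z → z :* (x :* y) := (x :* z) :* y) refl x y _)
    (trans (*-congʳ (⁻¹-inverseʳ x≉0)) (*-identityˡ y))

  fromℕ-* : ∀ a b → fromℕ (a ℕ.* b) ≈ fromℕ a * fromℕ b
  fromℕ-* = ×1-homo-*

  private module ℕFold = Fold ℕₚ.+-0-commutativeMonoid
  open Fold +-commutativeMonoid using (fold; fold-cong; fold-swap; fold-⊆)
  open SeriesProperties commutativeRing using (*-distribˡ-fold)
  open Polynomials commutativeRing using (Series; listSum; listProduct)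
  open Euler commutativeRing using (euler)

  fromℕ-fold : {X : Set} (xs : List X) (f : X → ℕ) → fromℕ (ℕFold.fold xs f) ≈ fold xs (fromℕ ∘ f)
  fromℕ-fold []       f = refl
  fromℕ-fold (x ∷ xs) f = trans (×-homo-+ 1# (f x) _) (+-congˡ (fromℕ-fold xs f))

  module _ {n : ℕ} (g : Series n) where

    -- The summand of E[(-1.β.η)ⁱ] divided by i!. Without that factor it refers to the columns
    -- alone, as it must because insertion changes the partitioned index.
    weight : List (MultiIndex n) → ℝ
    weight λs = fromℕ (denominator λs) ⁻¹ * (- 1#) ^ length λs
      * listProduct (distinctColumns λs) (λ c → g c ^ multiplicity λs c)

    partitionSum : Series n
    partitionSum i = listSum (partitions i) weight

    normalized : Series n
    normalized c = fromℕ (c !ᵐ) ⁻¹ * g c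

    -- Insertion multiplies 𝔪(λ)! by the new multiplicity of `c`, λ! by c!, the sign by -1 and g_λ
    -- by `g c`. The factor in front cancels the new multiplicity.
    weight-insert : ∀ c λs → fromℕ (suc (multiplicity λs c)) * weight (insert c λs) ≈ - normalized c * weight λs
    weight-insert c λs = begin
      s * weight (insert c λs)
        ≈⟨ *-congˡ (*-cong (*-cong inverse sign) (fold-distinctColumns-insert *-commutativeMonoid
             (λ d k → g d ^ k) (λ _ → refl) c λs refl)) ⟩
      s * (s ⁻¹ * (c! ⁻¹ * d ⁻¹) * (- 1# * l) * (g c * p))
        ≈⟨ trans (solve 8 (λ s t c d o l g p → s :* (t :* (c :* d) :* (:- o :* l) :* (g :* p))
             := (s :* t) :* (:- (o :* (c :* g)) :* (d :* l :* p))) refl s (s ⁻¹) (c! ⁻¹) (d ⁻¹) 1# l (g c) p)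
             (trans (*-cong (⁻¹-inverseʳ (fromℕ≉0 (suc (multiplicity λs c)) λ ())) (*-congʳ (-‿cong (*-identityˡ _)))) (*-identityˡ _)) ⟩
      - normalized c * weight λs ∎
      where
      s  = fromℕ (suc (multiplicity λs c))
      c! = fromℕ (c !ᵐ)
      d  = fromℕ (denominator λs)
      l  = (- 1#) ^ length λs
      p  = listProduct (distinctColumns λs) (λ c → g c ^ multiplicity λs c)

      inverse : fromℕ (denominator (insert c λs)) ⁻¹ ≈ s ⁻¹ * (c! ⁻¹ * d ⁻¹)
      inverse = trans
        (⁻¹-cong (trans (reflexive (≡.cong fromℕ (denominator-insert c λs)))
          (trans (fromℕ-* (suc (multiplicity λs c)) (c !ᵐ ℕ.* denominator λs)) (*-congˡ (fromℕ-* (c !ᵐ) (denominator λs))))))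
        (trans (⁻¹-* (fromℕ≉0 (suc (multiplicity λs c)) λ ()) (λ eq → fromℕ≉0 (c !ᵐ ℕ.* denominator λs) c!d≢0 (trans (fromℕ-* (c !ᵐ) (denominator λs)) eq)))
          (*-congˡ (⁻¹-* (fromℕ≉0 (c !ᵐ) (!ᵐ≢0 c)) (fromℕ≉0 (denominator λs) (denominator≢0 λs)))))
        where
        c!d≢0 : c !ᵐ ℕ.* denominator λs ≢ 0
        c!d≢0 eq with ℕₚ.m*n≡0⇒m≡0∨n≡0 (c !ᵐ) eq
        ... | inj₁ q = !ᵐ≢0 c q
        ... | inj₂ q = denominator≢0 λs q

      sign : (- 1#) ^ length (insert c λs) ≈ - 1# * l
      sign = reflexive (≡.cong ((- 1#) ^_) (↭-length (insert-↭ c λs)))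

    -- The factor `multiplicity λs c` kills the partitions without a column `c`; on the others it is
    -- the multiplicity that `weight-insert` absorbs.
    partitionSum-remove : ∀ {c} j → c ≢ 𝟎 →
      fold (partitions (c ⊹ j)) (λ λs → fromℕ (multiplicity λs c) * weight λs) ≈ - normalized c * partitionSum j
    partitionSum-remove {c} j c≢𝟎 = trans
      (fold-partitions-insert +-commutativeMonoid j (λ λs → fromℕ (multiplicity λs c) * weight λs) c≢𝟎
        (λ {λs} c∉λs → trans (*-congʳ (×-congˡ (multiplicity-∉ λs c∉λs))) (zeroˡ _)))
      (trans (fold-cong (partitions j) (λ {λs} _ →
          trans (*-congʳ (×-congˡ (multiplicity-insert c λs))) (weight-insert c λs)))
        (sym (*-distribˡ-fold (- normalized c) (partitions j) weight)))

    -- Every partition of i is counted i_r = Σ_c c_r (multiplicity of c) times.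
    partitionSum-euler : ∀ r i → fromℕ (lookup i r) * partitionSum i ≈ - euler r normalized partitionSum i
    partitionSum-euler r i = begin
      fromℕ (lookup i r) * partitionSum i
        ≈⟨ *-distribˡ-fold _ (partitions i) weight ⟩
      fold (partitions i) (λ λs → fromℕ (lookup i r) * weight λs)
        ≈⟨ fold-cong (partitions i) (λ {λs} λs∈ → trans
             (*-congʳ (trans (reflexive (≡.cong fromℕ (≡.sym (fold-lookup-multiplicity r (∈-partitions⁻ λs∈)))))
               (fromℕ-fold (box i) _)))
             (trans (*-comm _ _) (trans (*-distribˡ-fold _ (box i) _) (fold-cong (box i) (λ {c} _ →
               trans (*-congˡ (fromℕ-* (lookup c r) _))
                 (solve 3 (λ w a b → w :* (a :* b) := a :* (b :* w)) refl (weight λs) _ _)))))) ⟩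
      fold (partitions i) (λ λs → fold (box i) (λ c → fromℕ (lookup c r) * (fromℕ (multiplicity λs c) * weight λs)))
        ≈⟨ fold-swap (partitions i) (box i) _ ⟩
      fold (box i) (λ c → fold (partitions i) (λ λs → fromℕ (lookup c r) * (fromℕ (multiplicity λs c) * weight λs)))
        ≈⟨ fold-cong (box i) (λ {c} c∈ → trans (sym (*-distribˡ-fold _ (partitions i) _)) (column c∈)) ⟩
      fold (box i) (λ c → - 1# * (fromℕ (lookup c r) * (normalized c * partitionSum (zipWith ℕ._∸_ i c))))
        ≈⟨ trans (sym (*-distribˡ-fold (- 1#) (box i) _)) (-1*x≈-x _) ⟩
      - euler r normalized partitionSum i ∎
      where
      column : ∀ {c} → c ∈ box i →
        fromℕ (lookup c r) * fold (partitions i) (λ λs → fromℕ (multiplicity λs c) * weight λs)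
          ≈ - 1# * (fromℕ (lookup c r) * (normalized c * partitionSum (zipWith ℕ._∸_ i c)))
      column {c} c∈ with c ≟ᵐ 𝟎
      -- A zero column cannot be removed from a partition, but its weight `lookup 𝟎 r` makes both
      -- sides vanish.
      ... | yes ≡.refl = trans (trans (*-congʳ 0·) (zeroˡ _)) (sym (trans (*-congˡ (trans (*-congʳ 0·) (zeroˡ _))) (zeroʳ _)))
        where
        0· : fromℕ (lookup (𝟎 {n}) r) ≈ 0#
        0· = ×-congˡ (Vecₚ.lookup-replicate r 0)
      ... | no c≢𝟎 with j , ≡.refl ← ∈-box⁻ i c∈ = trans
        (*-congˡ (trans (partitionSum-remove j c≢𝟎)
          (*-congˡ (reflexive (≡.cong partitionSum (≡.sym (⊹-∸ c j)))))))
        (trans (solve 3 (λ l a b → l :* (:- a :* b) := :- (l :* (a :* b))) refl _ _ _) (sym (-1*x≈-x _)))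

    -- Zero columns are excluded, so only the empty matrix is summed. This is the initial value that
    -- accompanies the Gaussian equation.
    partitionSum-𝟎 : partitionSum 𝟎 ≈ 1#
    partitionSum-𝟎 = trans
      (fold-⊆ weight partitions-unique ([] ∷ [])
        (λ { (here ≡.refl) → ∈-partitions⁺ ([] , Linked.[] , ≡.refl) })
        (λ λs∈ λs≢[] → contradiction (empty (∈-partitions⁻ λs∈)) (λ eq → λs≢[] (here eq))))
      (trans (+-identityʳ _) (trans (*-identityʳ _) (trans (*-identityʳ _)
        (trans (⁻¹-cong (+-identityʳ 1#)) 1⁻¹))))
      where
      empty : ∀ {λs : List (MultiIndex n)} → IsPartition 𝟎 λs → λs ≡ []
      empty {[]}     _ = ≡.refl
      empty {c ∷ λs} (c≢𝟎 ∷ _ , _ , eq) = contradiction (⊹-≡𝟎 c eq) c≢𝟎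
        where
        ⊹-≡𝟎 : ∀ {m} (i : MultiIndex m) {j} → i ⊹ j ≡ 𝟎 → i ≡ 𝟎
        ⊹-≡𝟎 []      {[]}    _  = ≡.refl
        ⊹-≡𝟎 (a ∷ i) {b ∷ j} eq = ≡.cong₂ _∷_ (ℕₚ.m+n≡0⇒m≡0 a (Vecₚ.∷-injectiveˡ eq)) (⊹-≡𝟎 i (Vecₚ.∷-injectiveʳ eq))

-- Absolute values, first-order expansions and the exponential function

module Calculus (𝓡 : CompleteOrderedField) where

  open CompleteOrderedField 𝓡 hiding (zero) renaming (Carrier to ℝ)
  open RealAnalysis 𝓡 using (ElementaryFunctions)
  open FieldProperties 𝓡
  open Solver commutativeRing
  open RingProperties ring using (-0#≈0#)
  open ≈-Reasoning setoid

  abs-cases : ∀ x → (0# ≤ x × ∣ x ∣ ≈ x) ⊎ (x ≤ 0# × ∣ x ∣ ≈ - x)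
  abs-cases x with total 0# x
  ... | inj₁ 0≤x = inj₁ (0≤x , refl)
  ... | inj₂ x≤0 = inj₂ (x≤0 , refl)

  ≤0⇒0≤- : ∀ {x} → x ≤ 0# → 0# ≤ - x
  ≤0⇒0≤- x≤0 = ≤-cong -0#≈0# refl (neg-≤ x≤0)

  0≤abs : ∀ x → 0# ≤ ∣ x ∣
  0≤abs x with abs-cases x
  ... | inj₁ (0≤x , eq) = ≤-cong refl (sym eq) 0≤x
  ... | inj₂ (x≤0 , eq) = ≤-cong refl (sym eq) (≤0⇒0≤- x≤0)

  x≤abs : ∀ x → x ≤ ∣ x ∣
  x≤abs x with abs-cases x
  ... | inj₁ (0≤x , eq) = ≤-reflexive (sym eq)
  ... | inj₂ (x≤0 , eq) = ≤-trans x≤0 (≤-cong refl (sym eq) (≤0⇒0≤- x≤0))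

  -x≤abs : ∀ x → - x ≤ ∣ x ∣
  -x≤abs x with abs-cases x
  ... | inj₁ (0≤x , eq) = ≤-trans (≤-cong refl -0#≈0# (neg-≤ 0≤x)) (≤-cong refl (sym eq) 0≤x)
  ... | inj₂ (x≤0 , eq) = ≤-reflexive (sym eq)

  abs-≤ : ∀ {x b} → x ≤ b → - x ≤ b → ∣ x ∣ ≤ b
  abs-≤ {x} p q with abs-cases x
  ... | inj₁ (_ , eq) = ≤-cong (sym eq) refl p
  ... | inj₂ (_ , eq) = ≤-cong (sym eq) refl q

  -- `total` may decide differently on equal arguments, so the defining case split gives no
  -- congruence. The bounds by `x` and `- x` give both inequalities.
  abs-cong : ∀ {x y} → x ≈ y → ∣ x ∣ ≈ ∣ y ∣
  abs-cong {x} {y} x≈y = ≤-antisym (half x≈y) (half (sym x≈y))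
    where
    half : ∀ {x y} → x ≈ y → ∣ x ∣ ≤ ∣ y ∣
    half {y = y} x≈y = abs-≤ (≤-cong (sym x≈y) refl (x≤abs y)) (≤-cong (-‿cong (sym x≈y)) refl (-x≤abs y))

  abs-+ : ∀ x y → ∣ x + y ∣ ≤ ∣ x ∣ + ∣ y ∣
  abs-+ x y = abs-≤ (+-mono-≤ (x≤abs x) (x≤abs y))
    (≤-cong (solve 2 (λ x y → :- x :+ :- y := :- (x :+ y)) refl x y) refl (+-mono-≤ (-x≤abs x) (-x≤abs y)))

  nonNeg⇒abs : ∀ {x} → 0# ≤ x → ∣ x ∣ ≈ x
  nonNeg⇒abs {x} 0≤x = ≤-antisym (abs-≤ ≤-refl (≤-trans (≤-cong refl -0#≈0# (neg-≤ 0≤x)) 0≤x)) (x≤abs x)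

  abs-neg : ∀ x → ∣ - x ∣ ≈ ∣ x ∣
  abs-neg x = ≤-antisym
    (abs-≤ (-x≤abs x) (≤-cong (solve 1 (λ x → x := :- :- x) refl x) refl (x≤abs x)))
    (abs-≤ (≤-cong (solve 1 (λ x → :- :- x := x) refl x) refl (-x≤abs (- x))) (x≤abs (- x)))

  abs-0 : ∣ 0# ∣ ≈ 0#
  abs-0 = nonNeg⇒abs ≤-refl

  *-monoˡ-≤ : ∀ {a x y} → 0# ≤ a → x ≤ y → a * x ≤ a * y
  *-monoˡ-≤ {a} {x} {y} 0≤a x≤y = 0≤-⇒≤ (≤-cong refl
    (solve 3 (λ a x y → a :* (y :- x) := a :* y :- a :* x) refl a x y)
    (*-nonNeg 0≤a (≤-cong (-‿inverseʳ x) refl (+-monoˡ-≤ (- x) x≤y))))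

  *-mono-≤ : ∀ {a b x y} → 0# ≤ x → 0# ≤ b → a ≤ b → x ≤ y → a * x ≤ b * y
  *-mono-≤ {a} {b} {x} 0≤x 0≤b a≤b x≤y =
    ≤-trans (≤-cong (*-comm x a) (*-comm x b) (*-monoˡ-≤ 0≤x a≤b)) (*-monoˡ-≤ 0≤b x≤y)

  abs-*-≤ : ∀ x y → ∣ x * y ∣ ≤ ∣ x ∣ * ∣ y ∣
  abs-*-≤ x y with abs-cases x | abs-cases y
  ... | inj₁ (p , e) | inj₁ (q , f) = ≤-reflexive (trans (nonNeg⇒abs (*-nonNeg p q)) (sym (*-cong e f)))
  ... | inj₁ (p , e) | inj₂ (q , f) = ≤-reflexive (trans (sym (abs-neg (x * y)))
    (trans (nonNeg⇒abs (≤-cong refl (solve 2 (λ x y → x :* :- y := :- (x :* y)) refl x y) (*-nonNeg p (≤0⇒0≤- q))))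
    (trans (solve 2 (λ x y → :- (x :* y) := x :* :- y) refl x y) (sym (*-cong e f)))))
  ... | inj₂ (p , e) | inj₁ (q , f) = ≤-reflexive (trans (sym (abs-neg (x * y)))
    (trans (nonNeg⇒abs (≤-cong refl (solve 2 (λ x y → :- x :* y := :- (x :* y)) refl x y) (*-nonNeg (≤0⇒0≤- p) q)))
    (trans (solve 2 (λ x y → :- (x :* y) := :- x :* y) refl x y) (sym (*-cong e f)))))
  ... | inj₂ (p , e) | inj₂ (q , f) = ≤-reflexive (trans
    (nonNeg⇒abs (≤-cong refl (solve 2 (λ x y → :- x :* :- y := x :* y) refl x y) (*-nonNeg (≤0⇒0≤- p) (≤0⇒0≤- q))))
    (trans (solve 2 (λ x y → x :* y := :- x :* :- y) refl x y) (sym (*-cong e f))))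

  <-≤-trans : ∀ {x y z} → x < y → y ≤ z → x < z
  <-≤-trans (x≤y , x≉y) y≤z = ≤-trans x≤y y≤z , λ x≈z → x≉y (≤-antisym x≤y (≤-cong refl (sym x≈z) y≤z))

  <⇒≉0 : ∀ {x} → 0# < x → ¬ x ≈ 0#
  <⇒≉0 (_ , 0≉x) x≈0 = 0≉x (sym x≈0)

  *-pos : ∀ {x y} → 0# < x → 0# < y → 0# < x * y
  *-pos {x} {y} 0<x 0<y = *-nonNeg (proj₁ 0<x) (proj₁ 0<y) , λ 0≈xy → <⇒≉0 0<y
    (trans (sym (⁻¹-cancelˡ (<⇒≉0 0<x))) (trans (*-congˡ (sym 0≈xy)) (zeroʳ _)))

  ⁻¹-pos : ∀ {x} → 0# < x → 0# < x ⁻¹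
  ⁻¹-pos {x} 0<x = nonNeg , λ 0≈x⁻¹ → 0≉1 (trans (sym (zeroʳ x)) (trans (*-congˡ 0≈x⁻¹) (⁻¹-inverseʳ (<⇒≉0 0<x))))
    where
    nonNeg : 0# ≤ x ⁻¹
    nonNeg with total 0# (x ⁻¹)
    ... | inj₁ p = p
    ... | inj₂ p = contradiction (≤-antisym 0≤1 (≤-cong (solve 1 (λ x → :- :- x := x) refl 1#) -0#≈0# (neg-≤ 0≤-1))) 0≉1
      where
      0≤-1 : 0# ≤ - 1#
      0≤-1 = ≤-cong refl (trans (solve 2 (λ x y → x :* :- y := :- (x :* y)) refl x _) (-‿cong (⁻¹-inverseʳ (<⇒≉0 0<x))))
        (*-nonNeg (proj₁ 0<x) (≤0⇒0≤- p))

  <-+ : ∀ {x} y → 0# < x → 0# ≤ y → 0# < x + y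
  <-+ {x} y 0<x 0≤y = <-≤-trans 0<x (≤-cong (+-identityʳ x) refl (+-mono-≤ ≤-refl 0≤y))

  0<2 : 0# < fromℕ 2
  0<2 = <-+ (fromℕ 1) 0<1 (fromℕ-nonNeg 1)

  0<½ : 0# < ½
  0<½ = ⁻¹-pos 0<2

  ½+½ : ½ + ½ ≈ 1#
  ½+½ = begin
    ½ + ½                ≈⟨ +-cong (*-identityʳ ½) (trans (+-identityʳ _) (*-identityʳ ½)) ⟨
    ½ * 1# + (½ * 1# + 0#) ≈⟨ solve 2 (λ h o → h :* o :+ (h :* o :+ con (0 , 0)) := (o :+ (o :+ con (0 , 0))) :* h) refl ½ 1# ⟩
    fromℕ 2 * ½          ≈⟨ ⁻¹-inverseʳ (<⇒≉0 0<2) ⟩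
    1#                   ∎

  minimum : ∀ {x y} → 0# < x → 0# < y → ∃[ z ] 0# < z × z ≤ x × z ≤ y
  minimum {x} {y} 0<x 0<y with total x y
  ... | inj₁ x≤y = x , 0<x , ≤-refl , x≤y
  ... | inj₂ y≤x = y , 0<y , y≤x , ≤-refl

  -- r(h) = o(h) as h → 0.
  Small : (ℝ → ℝ) → Set
  Small r = ∀ ε → 0# < ε → ∃[ δ ] 0# < δ × (∀ h → ∣ h ∣ < δ → ∣ r h ∣ ≤ ε * ∣ h ∣)

  LocallyBounded : (ℝ → ℝ) → Set
  LocallyBounded k = ∃[ C ] 0# < C × ∃[ δ ] 0# < δ × (∀ h → ∣ h ∣ < δ → ∣ k h ∣ ≤ C)

  small-cong : ∀ {r s} → (∀ h → r h ≈ s h) → Small r → Small s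
  small-cong r≈s sr ε 0<ε = let δ , 0<δ , bound = sr ε 0<ε in
    δ , 0<δ , λ h h<δ → ≤-cong (abs-cong (r≈s h)) refl (bound h h<δ)

  small-0 : Small (λ _ → 0#)
  small-0 ε 0<ε = ε , 0<ε , λ h _ → ≤-cong (sym abs-0) refl (*-nonNeg (proj₁ 0<ε) (0≤abs h))

  small-+ : ∀ {r s} → Small r → Small s → Small (λ h → r h + s h)
  small-+ sr ss ε 0<ε =
    let ε/2 = ε * ½
        0<ε/2 = *-pos 0<ε 0<½
        δ₁ , 0<δ₁ , bound₁ = sr ε/2 0<ε/2
        δ₂ , 0<δ₂ , bound₂ = ss ε/2 0<ε/2
        δ , 0<δ , δ≤δ₁ , δ≤δ₂ = minimum 0<δ₁ 0<δ₂
    in δ , 0<δ , λ h h<δ → ≤-trans (abs-+ _ _) (≤-cong refl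
         (trans (solve 3 (λ e k x → e :* k :* x :+ e :* k :* x := e :* (k :+ k) :* x) refl ε ½ ∣ h ∣)
           (*-congʳ (trans (*-congˡ ½+½) (*-identityʳ ε))))
         (+-mono-≤ (bound₁ h (<-≤-trans h<δ δ≤δ₁)) (bound₂ h (<-≤-trans h<δ δ≤δ₂))))

  bounded-*-small : ∀ {k r} → LocallyBounded k → Small r → Small (λ h → k h * r h)
  bounded-*-small (C , 0<C , δ₁ , 0<δ₁ , bound₁) sr ε 0<ε =
    let δ₂ , 0<δ₂ , bound₂ = sr (C ⁻¹ * ε) (*-pos (⁻¹-pos 0<C) 0<ε)
        δ , 0<δ , δ≤δ₁ , δ≤δ₂ = minimum 0<δ₁ 0<δ₂
    in δ , 0<δ , λ h h<δ → ≤-trans (abs-*-≤ _ _) (≤-cong refl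
         (trans (solve 4 (λ c i e x → c :* (i :* e :* x) := (c :* i) :* (e :* x)) refl C (C ⁻¹) ε ∣ h ∣)
           (trans (*-congʳ (⁻¹-inverseʳ (<⇒≉0 0<C))) (*-identityˡ _)))
         (*-mono-≤ (0≤abs _) (proj₁ 0<C) (bound₁ h (<-≤-trans h<δ δ≤δ₁)) (bound₂ h (<-≤-trans h<δ δ≤δ₂))))

  small-square : Small (λ h → h * h)
  small-square ε 0<ε = ε , 0<ε , λ h h<ε →
    ≤-trans (abs-*-≤ h h) (*-mono-≤ (0≤abs h) (proj₁ 0<ε) (proj₁ h<ε) ≤-refl)

  bounded-const : ∀ a → LocallyBounded (λ _ → a)
  -- The summand 1 keeps the bound strictly positive when `a` is zero.
  bounded-const a = 1# + ∣ a ∣ , <-+ ∣ a ∣ 0<1 (0≤abs a) , 1# , 0<1 , λ _ _ →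
    ≤-cong (+-identityˡ _) refl (+-mono-≤ 0≤1 ≤-refl)

  bounded-id : LocallyBounded (λ h → h)
  bounded-id = 1# , 0<1 , 1# , 0<1 , λ h h<1 → proj₁ h<1

  bounded-+ : ∀ {k l} → LocallyBounded k → LocallyBounded l → LocallyBounded (λ h → k h + l h)
  bounded-+ (C , 0<C , δ₁ , 0<δ₁ , bound₁) (D , 0<D , δ₂ , 0<δ₂ , bound₂) =
    let δ , 0<δ , δ≤δ₁ , δ≤δ₂ = minimum 0<δ₁ 0<δ₂
    in C + D , <-+ D 0<C (proj₁ 0<D) , δ , 0<δ , λ h h<δ → ≤-trans (abs-+ _ _)
         (+-mono-≤ (bound₁ h (<-≤-trans h<δ δ≤δ₁)) (bound₂ h (<-≤-trans h<δ δ≤δ₂)))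

  bounded-* : ∀ {k l} → LocallyBounded k → LocallyBounded l → LocallyBounded (λ h → k h * l h)
  bounded-* (C , 0<C , δ₁ , 0<δ₁ , bound₁) (D , 0<D , δ₂ , 0<δ₂ , bound₂) =
    let δ , 0<δ , δ≤δ₁ , δ≤δ₂ = minimum 0<δ₁ 0<δ₂
    in C * D , *-pos 0<C 0<D , δ , 0<δ , λ h h<δ → ≤-trans (abs-*-≤ _ _)
         (*-mono-≤ (0≤abs _) (proj₁ 0<C) (bound₁ h (<-≤-trans h<δ δ≤δ₁)) (bound₂ h (<-≤-trans h<δ δ≤δ₂)))

  bounded-cong : ∀ {k l} → (∀ h → k h ≈ l h) → LocallyBounded k → LocallyBounded l
  bounded-cong k≈l (C , 0<C , δ , 0<δ , bound) =
    C , 0<C , δ , 0<δ , λ h h<δ → ≤-cong (abs-cong (k≈l h)) refl (bound h h<δ)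

  bounded-linear : ∀ a b → LocallyBounded (λ h → a + b * h)
  bounded-linear a b = bounded-+ (bounded-const a) (bounded-* (bounded-const b) bounded-id)

  small⇒bounded : ∀ {r} → Small r → LocallyBounded r
  small⇒bounded sr =
    let δ₁ , 0<δ₁ , bound = sr 1# 0<1
        δ , 0<δ , δ≤δ₁ , δ≤1 = minimum 0<δ₁ 0<1
    in 1# , 0<1 , δ , 0<δ , λ h h<δ → ≤-trans (bound h (<-≤-trans h<δ δ≤δ₁))
         (≤-cong (sym (*-identityˡ _)) refl (proj₁ (<-≤-trans h<δ δ≤1)))

  -- If |k| ≤ C near 0 then |k(h) h| ≤ C |h|, so an error small against k(h) h is small against h;
  -- the tolerance is divided by C.
  small-∘ : ∀ {r k} → Small r → LocallyBounded k → Small (λ h → r (k h * h))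
  small-∘ {r} {k} sr (C , 0<C , δ₁ , 0<δ₁ , bound₁) ε 0<ε =
    let δ₂ , 0<δ₂ , bound₂ = sr (C ⁻¹ * ε) (*-pos (⁻¹-pos 0<C) 0<ε)
        δ , 0<δ , δ≤δ₁ , δ≤δ₂/C = minimum 0<δ₁ (*-pos (⁻¹-pos 0<C) 0<δ₂)
    in δ , 0<δ , λ h h<δ →
      let kh≤Ch = ≤-trans (abs-*-≤ (k h) h)
            (*-mono-≤ (0≤abs h) (proj₁ 0<C) (bound₁ h (<-≤-trans h<δ δ≤δ₁)) ≤-refl)
          h≤ , h≉ = <-≤-trans h<δ δ≤δ₂/C
          Ch≤δ₂ = ≤-cong refl (C*C⁻¹ δ₂) (*-monoˡ-≤ (proj₁ 0<C) h≤)
          -- Strictness: equality with δ₂ would force C |h| = δ₂, which |h| < C⁻¹ δ₂ rules out.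
          small = ≤-trans kh≤Ch Ch≤δ₂ , λ kh≈δ₂ → h≉ (trans (sym (⁻¹-cancelˡ (<⇒≉0 0<C)))
            (*-congˡ (≤-antisym Ch≤δ₂ (≤-cong kh≈δ₂ refl kh≤Ch))))
      in ≤-trans (bound₂ (k h * h) small) (≤-cong refl
           (trans (solve 4 (λ c i e x → i :* e :* (c :* x) := c :* (i :* (e :* x))) refl C (C ⁻¹) ε ∣ h ∣) (C*C⁻¹ _))
           (*-monoˡ-≤ (proj₁ (*-pos (⁻¹-pos 0<C) 0<ε)) kh≤Ch))
    where
    C*C⁻¹ : ∀ x → C * (C ⁻¹ * x) ≈ x
    C*C⁻¹ x = trans (sym (*-assoc _ _ _)) (trans (*-congʳ (⁻¹-inverseʳ (<⇒≉0 0<C))) (*-identityˡ x))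

  -- g(h) = g₀ + L h + o(h). In particular HasDerivativeAt f a L unfolds to
  -- Expansion (λ h → f (a + h)) (f a) L.
  Expansion : (ℝ → ℝ) → ℝ → ℝ → Set
  Expansion g g₀ L = Small (λ h → g h - (g₀ + L * h))

  expansion-cong : ∀ {g g′ g₀ g₀′ L L′} → (∀ h → g h ≈ g′ h) → g₀ ≈ g₀′ → L ≈ L′ →
                   Expansion g g₀ L → Expansion g′ g₀′ L′
  expansion-cong p q s = small-cong (λ h → +-cong (p h) (-‿cong (+-cong q (*-congʳ s))))

  expansion-linear : ∀ a b → Expansion (λ h → a + b * h) a b
  expansion-linear a b = small-cong (λ h → sym (-‿inverseʳ _)) small-0

  expansion-const : ∀ a → Expansion (λ _ → a) a 0#
  expansion-const a = expansion-cong (λ h → trans (+-congˡ (zeroˡ h)) (+-identityʳ a)) refl refl (expansion-linear a 0#)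

  expansion-+ : ∀ {f g f₀ g₀ K L} → Expansion f f₀ K → Expansion g g₀ L →
                Expansion (λ h → f h + g h) (f₀ + g₀) (K + L)
  expansion-+ {f} {g} {f₀} {g₀} {K} {L} ef eg = small-cong
    (λ h → solve 7 (λ f g f₀ g₀ K L h → (f :- (f₀ :+ K :* h)) :+ (g :- (g₀ :+ L :* h))
       := (f :+ g) :- (f₀ :+ g₀ :+ (K :+ L) :* h)) refl (f h) (g h) f₀ g₀ K L h)
    (small-+ ef eg)

  expansion-bounded : ∀ {g g₀ L} → Expansion g g₀ L → LocallyBounded g
  expansion-bounded {g} {g₀} {L} eg = bounded-cong
    (λ h → solve 2 (λ x y → (x :- y) :+ y := x) refl (g h) (g₀ + L * h))
    (bounded-+ (small⇒bounded eg) (bounded-linear g₀ L))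

  -- With remainders R and S of f and g, the remainder of the product is g R + (f₀ + K h) S + K L
  -- h²: two products of a bounded with a small function, and a quadratic term.
  expansion-* : ∀ {f g f₀ g₀ K L} → Expansion f f₀ K → Expansion g g₀ L →
                Expansion (λ h → f h * g h) (f₀ * g₀) (f₀ * L + K * g₀)
  expansion-* {f} {g} {f₀} {g₀} {K} {L} ef eg = small-cong
    (λ h → solve 7 (λ f g f₀ g₀ K L h →
         g :* (f :- (f₀ :+ K :* h)) :+ ((f₀ :+ K :* h) :* (g :- (g₀ :+ L :* h)) :+ K :* L :* (h :* h))
       := f :* g :- (f₀ :* g₀ :+ (f₀ :* L :+ K :* g₀) :* h)) refl (f h) (g h) f₀ g₀ K L h)
    (small-+ (bounded-*-small (expansion-bounded eg) ef)
      (small-+ (bounded-*-small (bounded-linear f₀ K) eg) (bounded-*-small (bounded-const (K * L)) small-square)))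

  expansion-scale : ∀ a {g g₀ L} → Expansion g g₀ L → Expansion (λ h → a * g h) (a * g₀) (a * L)
  expansion-scale a eg = expansion-cong (λ _ → refl) refl (trans (+-congˡ (zeroˡ _)) (+-identityʳ _))
    (expansion-* (expansion-const a) eg)

  expansion-neg : ∀ {g g₀ L} → Expansion g g₀ L → Expansion (λ h → - g h) (- g₀) (- L)
  expansion-neg eg = expansion-cong (λ _ → -1*x≈-x _) (-1*x≈-x _) (-1*x≈-x _) (expansion-scale (- 1#) eg)
    where open RingProperties ring using (-1*x≈-x)

  expansion-sum : ∀ {k} {g : Fin k → ℝ → ℝ} {g₀ L : Fin k → ℝ} → (∀ r → Expansion (g r) (g₀ r) (L r)) →
                  Expansion (λ h → sum (λ r → g r h)) (sum g₀) (sum L)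
  expansion-sum {zero}  eg = expansion-const 0#
  expansion-sum {suc k} eg = expansion-+ (eg zero) (expansion-sum (eg ∘ suc))

  -- The case of the chain rule that φ calls for: along a coordinate line its exponent changes by (a
  -- + b h) h.
  expansion-∘-quadratic : ∀ {g g₀ L} a b → Expansion g g₀ L →
                          Expansion (λ h → g ((a + b * h) * h)) g₀ (L * a)
  expansion-∘-quadratic {g} {g₀} {L} a b eg = small-cong
    (λ h → solve 6 (λ g g₀ L a b h → (g :- (g₀ :+ L :* ((a :+ b :* h) :* h))) :+ L :* b :* (h :* h)
       := g :- (g₀ :+ L :* a :* h)) refl (g ((a + b * h) * h)) g₀ L a b h)
    (small-+ (small-∘ eg (bounded-linear a b)) (bounded-*-small (bounded-const (L * b)) small-square))

  module _ (𝓕 : ElementaryFunctions) where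

    open ElementaryFunctions 𝓕

    -- A single zero would spread to all of ℝ by the functional equation, and the zero function does
    -- not have derivative 1 at 0.
    exp≉0 : ∀ y → ¬ exp y ≈ 0#
    exp≉0 y exp-y≈0 = <⇒≉0 (*-pos 0<½ 0<h) (≤-antisym
      (≤-cong (trans (+-congʳ (halves h)) (solve 1 (λ z → z :+ z :- z := z) refl (½ * h))) (-‿inverseʳ (½ * h))
        (+-monoˡ-≤ (- (½ * h)) h≤½h))
      (proj₁ (*-pos 0<½ 0<h)))
      where
      exp≈0 : ∀ z → exp z ≈ 0#
      exp≈0 z = begin
        exp z                 ≈⟨ exp-cong (solve 2 (λ y z → z := y :+ (z :- y)) refl y z) ⟩
        exp (y + (z - y))     ≈⟨ exp-+ y (z - y) ⟩
        exp y * exp (z - y)   ≈⟨ trans (*-congʳ exp-y≈0) (zeroˡ _) ⟩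
        0#                    ∎

      halves : ∀ z → z ≈ ½ * z + ½ * z
      halves z = trans (sym (*-identityˡ z)) (trans (*-congʳ (sym ½+½)) (distribʳ z ½ ½))

      -- Any tolerance below 1 would serve: for vanishing `exp` the remainder has absolute value h,
      -- and the bound then reads h ≤ ½ h with h > 0.
      δ = proj₁ (exp-derivative ½ 0<½)
      0<δ : 0# < δ
      0<δ = proj₁ (proj₂ (exp-derivative ½ 0<½))
      bound = proj₂ (proj₂ (exp-derivative ½ 0<½))

      h = ½ * δ
      0<h : 0# < h
      0<h = *-pos 0<½ 0<δ

      ∣h∣≈h : ∣ h ∣ ≈ h
      ∣h∣≈h = nonNeg⇒abs (proj₁ 0<h)

      ∣h∣<δ : ∣ h ∣ < δ
      ∣h∣<δ = ≤-cong (trans (+-identityʳ h) (sym ∣h∣≈h)) (sym (halves δ)) (+-mono-≤ ≤-refl (proj₁ 0<h))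
            , λ ∣h∣≈δ → <⇒≉0 0<h (trans (solve 1 (λ h → h := (h :+ h) :- h) refl h)
                (trans (+-cong (sym (halves δ)) (-‿cong (trans (sym ∣h∣≈h) ∣h∣≈δ))) (-‿inverseʳ δ)))

      remainder : exp (0# + h) - (exp 0# + 1# * h) ≈ - h
      remainder = trans (+-cong (exp≈0 _) (-‿cong (+-cong (exp≈0 0#) (*-identityˡ h))))
        (solve 1 (λ h → con (0 , 0) :- (con (0 , 0) :+ h) := :- h) refl h)

      h≤½h : h ≤ ½ * h
      h≤½h = ≤-cong (trans (trans (abs-cong remainder) (abs-neg h)) ∣h∣≈h) (*-congˡ ∣h∣≈h) (bound h ∣h∣<δ)

-- Degree and factorial of a raised multi-index; lists of directions

𝟎-or-unit : ∀ {n} (i : MultiIndex n) → i ≡ 𝟎 ⊎ (∃[ a ] ∃[ k ] i ≡ unit a ⊹ k)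
𝟎-or-unit []          = inj₁ ≡.refl
𝟎-or-unit (suc m ∷ i) = inj₂ (zero , m ∷ i , ≡.cong (suc m ∷_) (≡.sym (⊹-identityˡ i)))
𝟎-or-unit (zero ∷ i) with 𝟎-or-unit i
... | inj₁ ≡.refl           = inj₁ ≡.refl
... | inj₂ (a , k , ≡.refl) = inj₂ (suc a , 0 ∷ k , ≡.refl)

degree-unit-⊹ : ∀ {n} (a : Fin n) i → degree (unit a ⊹ i) ≡ suc (degree i)
degree-unit-⊹ zero    (m ∷ i) = ≡.cong (λ j → suc (m ℕ.+ degree j)) (⊹-identityˡ i)
degree-unit-⊹ (suc a) (m ∷ i) = ≡.trans (≡.cong (m ℕ.+_) (degree-unit-⊹ a i)) (ℕₚ.+-suc m (degree i))

!ᵐ-unit-⊹ : ∀ {n} (a : Fin n) i → (unit a ⊹ i) !ᵐ ≡ suc (lookup i a) ℕ.* (i !ᵐ)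
!ᵐ-unit-⊹ zero    (m ∷ i) = ≡.trans (≡.cong (λ j → suc m ! ℕ.* (j !ᵐ)) (⊹-identityˡ i)) (ℕₚ.*-assoc (suc m) (m !) (i !ᵐ))
!ᵐ-unit-⊹ (suc a) (m ∷ i) = ≡.trans (≡.cong (m ! ℕ.*_) (!ᵐ-unit-⊹ a i)) (x∙yz≈y∙xz (m !) (suc (lookup i a)) (i !ᵐ))
  where open CommutativeSemigroupProperties ℕₚ.*-commutativeSemigroup using (x∙yz≈y∙xz)

𝟎!ᵐ : ∀ n → 𝟎 {n} !ᵐ ≡ 1
𝟎!ᵐ zero    = ≡.refl
𝟎!ᵐ (suc n) = ≡.trans (ℕₚ.*-identityˡ _) (𝟎!ᵐ n)

module _ {n : ℕ} where

  -- Counts how often each direction occurs. The closed form of the iterated derivative depends on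
  -- the list only through these counts, so all orders of differentiation are treated alike.
  order : List (Fin n) → MultiIndex n
  order []       = 𝟎
  order (r ∷ rs) = unit r ⊹ order rs

  order-++ : ∀ rs ss → order (rs ++ ss) ≡ order rs ⊹ order ss
  order-++ []       ss = ≡.sym (⊹-identityˡ (order ss))
  order-++ (r ∷ rs) ss = ≡.trans (≡.cong (unit r ⊹_) (order-++ rs ss)) (≡.sym (⊹-assoc (unit r) (order rs) (order ss)))

  open Fold ℕₚ.+-0-commutativeMonoid

  lookup-order-replicate : ∀ m r s → lookup (order (replicate m r)) s ≡ m ℕ.* lookup (unit r) s
  lookup-order-replicate zero    r s = Vecₚ.lookup-replicate s 0
  lookup-order-replicate (suc m) r s = ≡.trans (lookup-⊹ (unit r) (order (replicate m r)) s)
    (≡.cong (lookup (unit r) s ℕ.+_) (lookup-order-replicate m r s))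

  lookup-order-concatMap : ∀ (i : MultiIndex n) rs s →
    lookup (order (concatMap (λ r → replicate (lookup i r) r) rs)) s ≡ fold rs (λ r → lookup i r ℕ.* lookup (unit r) s)
  lookup-order-concatMap i []       s = Vecₚ.lookup-replicate s 0
  lookup-order-concatMap i (r ∷ rs) s = ≡.trans
    (≡.cong (λ j → lookup j s) (order-++ (replicate (lookup i r) r) (concatMap (λ r → replicate (lookup i r) r) rs)))
    (≡.trans (lookup-⊹ (order (replicate (lookup i r) r)) _ s)
      (≡.cong₂ ℕ._+_ (lookup-order-replicate (lookup i r) r s) (lookup-order-concatMap i rs s)))

  order-directions : ∀ (i : MultiIndex n) → order (concatMap (λ r → replicate (lookup i r) r) (allFin n)) ≡ i
  order-directions i = ≡.trans (≡.sym (Vecₚ.tabulate∘lookup _))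
    (≡.trans (Vecₚ.tabulate-cong λ s → ≡.trans (lookup-order-concatMap i (allFin n) s)
      (≡.trans (fold-single (λ r → lookup i r ℕ.* lookup (unit r) s) (Uniqueₚ.allFin⁺ n) (∈-allFin s)
        (λ {r} r≢s → ≡.trans (≡.cong (lookup i r ℕ.*_) (lookup-unit-≢ r≢s)) (ℕₚ.*-zeroʳ (lookup i r))))
      (≡.trans (≡.cong (lookup i s ℕ.*_) (lookup-unit s)) (ℕₚ.*-identityʳ _))))
    (Vecₚ.tabulate∘lookup i))

-- Derivatives of the Gaussian density in closed form

module Hermite (𝓡 : CompleteOrderedField) (n : ℕ)
  (M : RealAnalysis.Matrix 𝓡 n) where

  open CompleteOrderedField 𝓡 hiding (zero; sum) renaming (Carrier to ℝ)
  open RealAnalysis 𝓡 using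
    (Point; quadraticForm; IsPartialDerivative; IsIteratedDerivative; directions; IsHermite;
     IsGaussianDensity; ElementaryFunctions)
  open FieldProperties 𝓡
  open Calculus 𝓡
  open Operators commutativeRing
  open Euler commutativeRing
  open Fold +-commutativeMonoid using (fold-cong)
  open Solver commutativeRing
  open Polynomials commutativeRing using (Series)
  open SemiringSum semiring using (sum; sum-cong-≋; sum-replicate-zero; *-distribˡ-sum; ∑-distrib-+)
  open SemiringMult semiring using (×-congˡ)
  open SemiringExp semiring using (^-congˡ)
  open RingProperties ring using (-0#≈0#)
  open ≈-Reasoning setoid

  _≈ₚ_ : Point n → Point n → Set
  x ≈ₚ y = ∀ r → x r ≈ y r

  -- Written with `updateAt` so that `IsPartialDerivative` unfolds to an expansion along
  -- `translate x r`.
  translate : Point n → Fin n → ℝ → Point n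
  translate x r h = updateAt x r (const (x r + h))

  translate-≈ : ∀ x r h a → translate x r h a ≈ x a + δ a r * h
  translate-≈ x r h a with a Finₚ.≟ r
  ... | yes ≡.refl = trans (reflexive (VecFₚ.updateAt-updates r x)) (+-congˡ (sym (trans (*-congʳ (δ-refl r)) (*-identityˡ h))))
  ... | no  a≢r    = trans (reflexive (VecFₚ.updateAt-minimal a r x a≢r))
    (sym (trans (+-congˡ (trans (*-congʳ (δ-≢ a≢r)) (zeroˡ h))) (+-identityʳ _)))

  -- The base point of an unfolded partial derivative is `x` with its own entry written back, which
  -- equals `x` only entrywise; `p-cong` and `φ-cong` bridge the difference.
  overwrite-≈ : ∀ (x : Point n) r → updateAt x r (const (x r)) ≈ₚ x
  overwrite-≈ x r a with a Finₚ.≟ r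
  ... | yes ≡.refl = reflexive (VecFₚ.updateAt-updates r x)
  ... | no  a≢r    = reflexive (VecFₚ.updateAt-minimal a r x a≢r)

  -- The moments of μₓ.
  moments : Point n → Series n
  moments x c = fromℕ (c !ᵐ) * coefficient ½ M x c

  -- E[(−1.β.μₓ)ⁱ] / i!.
  p : Point n → Series n
  p x = partitionSum (moments x)

  B : Fin n → Fin n → ℝ
  B = symmetrized ½ M

  β : Point n → Fin n → ℝ
  β = slope ½ M

  B-sym : ∀ a b → B a b ≈ B b a
  B-sym = symmetrized-sym ½ M

  p-gaussian : ∀ x → Gaussian B (β x) (p x)
  p-gaussian x = euler⇒gaussian ½ M x
    (λ {c} _ → ⁻¹-cancelˡ (fromℕ≉0 (c !ᵐ) (!ᵐ≢0 c))) (partitionSum-euler (moments x))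

  p-cong : ∀ {x y} → x ≈ₚ y → ∀ i → p x i ≈ p y i
  p-cong {x} {y} x≈y i = fold-cong (partitions i) λ {λs} _ → *-congˡ (Products.fold-cong (distinctColumns λs)
    λ {c} _ → ^-congˡ (multiplicity λs c) (*-congˡ (*-congˡ (sum-cong-≋ λ r → sum-cong-≋ λ s →
      *-congˡ (+-cong (+-congˡ (*-congʳ (x≈y s))) (*-congʳ (x≈y r)))))))
    where module Products = Fold *-commutativeMonoid

  β-translate : ∀ x r h a → β (translate x r h) a ≈ β x a + B a r * h
  β-translate x r h a = begin
    sum (λ b → B a b * translate x r h b)
      ≈⟨ sum-cong-≋ (λ b → trans (*-congˡ (translate-≈ x r h b))
           (solve 4 (λ m x d h → m :* (x :+ d :* h) := m :* x :+ d :* (m :* h)) refl (B a b) (x b) (δ b r) h)) ⟩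
    sum (λ b → B a b * x b + δ b r * (B a b * h))
      ≈⟨ ∑-distrib-+ (λ b → B a b * x b) _ ⟩
    β x a + sum (λ b → δ b r * (B a b * h))
      ≈⟨ +-congˡ (sum-δ r (λ b → B a b * h)) ⟩
    β x a + B a r * h ∎

  -- `N` bounds the degree for the induction. For i = `unit a ⊹ k` the Gaussian equation, valid at
  -- every translated point, is solved for the coefficient at `i` by dividing by kₐ + 1. The right
  -- side involves only lower degrees, and `Gaussian-derivative` identifies its slope with the
  -- coefficient of -(B r ⊲ p) at `i`.
  p-expansion : ∀ x r N i → degree i ℕ.< N → Expansion (λ h → p (translate x r h) i) (p x i) (- (B r ⊲ p x) i)
  p-expansion x r (suc N) i i<N with 𝟎-or-unit i
  ... | inj₁ ≡.refl = expansion-cong (λ h → sym (partitionSum-𝟎 (moments (translate x r h)))) (sym (partitionSum-𝟎 (moments x)))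
    (sym (trans (-‿cong vanish) -0#≈0#)) (expansion-const 1#)
    where
    vanish : (B r ⊲ p x) 𝟎 ≈ 0#
    vanish = trans (sum-cong-≋ (λ b → trans (*-congˡ (unit-⊳-0 b (p x) {𝟎} (Vecₚ.lookup-replicate b 0))) (zeroʳ _)))
      (sum-replicate-zero n)
  ... | inj₂ (a , k , ≡.refl) = expansion-cong
      (λ h → trans (*-congˡ (sym (p-gaussian (translate x r h) a k))) (⁻¹-cancelˡ s≉0))
      (trans (*-congˡ (sym (p-gaussian x a k))) (⁻¹-cancelˡ s≉0))
      (trans (*-congˡ (sym (Gaussian-derivative {B = B} {β x} {p x} B-sym (p-gaussian x) r a k))) (⁻¹-cancelˡ s≉0))
      (expansion-scale (fromℕ (suc (lookup k a)) ⁻¹) (expansion-neg (expansion-+ operator product)))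
    where
    s≉0 : ¬ fromℕ (suc (lookup k a)) ≈ 0#
    s≉0 = fromℕ≉0 (suc (lookup k a)) λ ()

    k<N : degree k ℕ.< N
    k<N = ℕₚ.≤-pred (≡.subst (ℕ._< suc N) (degree-unit-⊹ a k) i<N)

    -- This coefficient is either one of `p` two degrees below `i`, covered by the induction, or
    -- identically zero.
    shifted : ∀ b → Expansion (λ h → (unit b ⊳ p (translate x r h)) k) ((unit b ⊳ p x) k)
                              ((unit b ⊳ (λ j → - (B r ⊲ p x) j)) k)
    shifted b with unit-view b k
    ... | inj₁ (l , ≡.refl) = expansion-cong (λ h → sym (⊳-self (unit b) (p (translate x r h)) l))
      (sym (⊳-self (unit b) (p x) l)) (sym (⊳-self (unit b) _ l))
      (p-expansion x r N l (ℕₚ.<-trans (≡.subst (degree l ℕ.<_) (≡.sym (degree-unit-⊹ b l)) (ℕₚ.n<1+n _)) k<N))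
    ... | inj₂ kb≡0 = expansion-cong (λ h → sym (unit-⊳-0 b (p (translate x r h)) {k} kb≡0)) (sym (unit-⊳-0 b (p x) {k} kb≡0))
      (sym (unit-⊳-0 b _ {k} kb≡0)) (expansion-const 0#)

    operator : Expansion (λ h → (B a ⊲ p (translate x r h)) k) ((B a ⊲ p x) k) ((B a ⊲ (λ j → - (B r ⊲ p x) j)) k)
    operator = expansion-sum (λ b → expansion-scale (B a b) (shifted b))

    product : Expansion (λ h → β (translate x r h) a * p (translate x r h) k) (β x a * p x k)
                        (β x a * - (B r ⊲ p x) k + B a r * p x k)
    product = expansion-* (expansion-cong (λ h → sym (β-translate x r h a)) refl refl (expansion-linear (β x a) (B a r)))
      (p-expansion x r N k k<N)

  quadraticForm-cong : ∀ {x y} → x ≈ₚ y → quadraticForm M x ≈ quadraticForm M y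
  quadraticForm-cong x≈y = sum-cong-≋ λ r → sum-cong-≋ λ s → *-cong (*-congʳ (x≈y r)) (x≈y s)

  -- The increment is kept as h times a linear function of h, the form accepted by
  -- `expansion-∘-quadratic`. Row r and column r of `M` both contribute, and half their sum is
  -- `β x r`.
  quadraticForm-translate : ∀ x r h →
    - (½ * quadraticForm M (translate x r h)) ≈ - (½ * quadraticForm M x) + (- β x r + - (½ * M r r) * h) * h
  quadraticForm-translate x r h = begin
    - (½ * quadraticForm M (translate x r h))
      -- Each correction is arranged to start with one delta, ready for `sum-δ`; the mixed term in
      -- h² goes with `δ b r`.
      ≈⟨ -‿cong (*-congˡ (sum-cong-≋ λ a → sum-cong-≋ λ b → trans
           (*-cong (*-congʳ (translate-≈ x r h a)) (translate-≈ x r h b))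
           (solve 6 (λ x y m d e h → (x :+ d :* h) :* m :* (y :+ e :* h)
             := (x :* m :* y :+ d :* (h :* (m :* y))) :+ e :* (h :* (m :* (x :+ d :* h))))
             refl (x a) (x b) (M a b) (δ a r) (δ b r) h))) ⟩
    - (½ * sum (λ a → sum λ b → (x a * M a b * x b + δ a r * (h * (M a b * x b))) + δ b r * (h * (M a b * (x a + δ a r * h)))))
      ≈⟨ -‿cong (*-congˡ (trans (sum-cong-≋ λ a → trans (∑-distrib-+ (λ b → x a * M a b * x b + δ a r * (h * (M a b * x b))) _)
           (+-cong (∑-distrib-+ (λ b → x a * M a b * x b) _) (sum-δ r (λ b → h * (M a b * (x a + δ a r * h))))))
           (trans (∑-distrib-+ (λ a → sum (λ b → x a * M a b * x b) + sum (λ b → δ a r * (h * (M a b * x b)))) _)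
             (+-cong (trans (∑-distrib-+ (λ a → sum λ b → x a * M a b * x b) _) (+-congˡ first)) second)))) ⟩
    - (½ * ((quadraticForm M x + h * row) + (h * column + h * (M r r * h))))
      ≈⟨ solve 6 (λ k q h u v m → :- (k :* ((q :+ h :* u) :+ (h :* v :+ h :* (m :* h))))
           := :- (k :* q) :+ (:- (k :* (u :+ v)) :+ :- (k :* m) :* h) :* h) refl ½ _ h row column (M r r) ⟩
    - (½ * quadraticForm M x) + (- (½ * (row + column)) + - (½ * M r r) * h) * h
      ≈⟨ +-congˡ (*-congʳ (+-congʳ (-‿cong row+column))) ⟩
    - (½ * quadraticForm M x) + (- β x r + - (½ * M r r) * h) * h ∎
    where
    row column : ℝ
    row    = sum (λ b → M r b * x b)
    column = sum (λ a → M a r * x a)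

    first : sum (λ a → sum λ b → δ a r * (h * (M a b * x b))) ≈ h * row
    first = trans (sum-cong-≋ λ a → sym (*-distribˡ-sum (δ a r) (λ b → h * (M a b * x b))))
      (trans (sum-δ r (λ a → sum λ b → h * (M a b * x b))) (sym (*-distribˡ-sum h (λ b → M r b * x b))))

    second : sum (λ a → h * (M a r * (x a + δ a r * h))) ≈ h * column + h * (M r r * h)
    second = begin
      sum (λ a → h * (M a r * (x a + δ a r * h)))
        ≈⟨ sum-cong-≋ (λ a → solve 4 (λ m x d h → h :* (m :* (x :+ d :* h)) := h :* (m :* x) :+ d :* (h :* (m :* h)))
             refl (M a r) (x a) (δ a r) h) ⟩
      sum (λ a → h * (M a r * x a) + δ a r * (h * (M a r * h)))
        ≈⟨ ∑-distrib-+ (λ a → h * (M a r * x a)) _ ⟩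
      sum (λ a → h * (M a r * x a)) + sum (λ a → δ a r * (h * (M a r * h)))
        ≈⟨ +-cong (sym (*-distribˡ-sum h (λ a → M a r * x a))) (sum-δ r (λ a → h * (M a r * h))) ⟩
      h * column + h * (M r r * h) ∎

    row+column : ½ * (row + column) ≈ β x r
    row+column = trans (*-congˡ (sym (∑-distrib-+ (λ b → M r b * x b) _)))
      (trans (*-distribˡ-sum ½ (λ b → M r b * x b + M b r * x b))
        (sum-cong-≋ λ b → solve 4 (λ k m m′ x → k :* (m :* x :+ m′ :* x) := k :* (m :+ m′) :* x) refl ½ (M r b) (M b r) (x b)))

  module Density (𝓕 : ElementaryFunctions) {Σ : RealAnalysis.Matrix 𝓡 n} {φ : Point n → ℝ}
                 (gaussian : IsGaussianDensity 𝓕 Σ M φ) where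

    open ElementaryFunctions 𝓕

    private
      c = proj₁ gaussian
      0<c = proj₁ (proj₂ gaussian)
      φ-spec = proj₂ (proj₂ (proj₂ gaussian))

    φ-cong : ∀ {x y} → x ≈ₚ y → φ x ≈ φ y
    φ-cong x≈y = trans (φ-spec _)
      (trans (*-congˡ (exp-cong (-‿cong (*-congˡ (quadraticForm-cong x≈y))))) (sym (φ-spec _)))

    φ≉0 : ∀ x → ¬ φ x ≈ 0#
    φ≉0 x φ≈0 = exp≉0 𝓕 _ (trans (sym (⁻¹-cancelˡ (<⇒≉0 0<c)))
      (trans (*-congˡ (trans (sym (φ-spec x)) φ≈0)) (zeroʳ _)))

    -- The functional equation splits off exp q, which moves the base point to 0, where the
    -- derivative of `exp` is given.
    φ-expansion : ∀ x r → Expansion (λ h → φ (translate x r h)) (φ x) (- β x r * φ x)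
    φ-expansion x r = expansion-cong
      (λ h → begin
        c * exp q * exp (0# + (- β x r + - (½ * M r r) * h) * h)
          ≈⟨ trans (*-assoc _ _ _) (*-congˡ (trans (*-congˡ (exp-cong (+-identityˡ _))) (sym (exp-+ q _)))) ⟩
        c * exp (q + (- β x r + - (½ * M r r) * h) * h)
          ≈⟨ *-congˡ (exp-cong (quadraticForm-translate x r h)) ⟨
        c * exp (- (½ * quadraticForm M (translate x r h)))
          ≈⟨ φ-spec _ ⟨
        φ (translate x r h) ∎)
      (trans (*-assoc _ _ _) (trans (*-congˡ (trans (sym (exp-+ q 0#)) (exp-cong (+-identityʳ q)))) (sym (φ-spec x))))
      (trans (*-congˡ (*-identityˡ _)) (trans (*-comm _ _) (*-congˡ (sym (φ-spec x)))))
      (expansion-scale (c * exp q) (expansion-∘-quadratic (- β x r) (- (½ * M r r)) exp-derivative))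
      where
      q : ℝ
      q = - (½ * quadraticForm M x)

    -- The candidate for D⁽ⁱ⁾φ: i! times the coefficient of tⁱ in the formal expansion of φ(x + t).
    D : MultiIndex n → Point n → ℝ
    D i x = fromℕ (i !ᵐ) * (p x i * φ x)

    D-partial : ∀ r i → IsPartialDerivative r (D i) (D (unit r ⊹ i))
    D-partial r i x = expansion-cong (λ _ → refl)
      (*-congˡ (*-cong (p-cong (λ a → sym (overwrite-≈ x r a)) i) (φ-cong (λ a → sym (overwrite-≈ x r a)))))
      slope≈
      (expansion-scale (fromℕ (i !ᵐ)) (expansion-* (p-expansion x r (suc (degree i)) i (ℕₚ.n<1+n _)) (φ-expansion x r)))
      where
      slope≈ : fromℕ (i !ᵐ) * (p x i * (- β x r * φ x) + - (B r ⊲ p x) i * φ x) ≈ D (unit r ⊹ i) x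
      slope≈ = begin
        fromℕ (i !ᵐ) * (p x i * (- β x r * φ x) + - (B r ⊲ p x) i * φ x)
          ≈⟨ solve 5 (λ k p b f v → k :* (p :* (:- b :* f) :+ :- v :* f) := k :* (:- (v :+ b :* p) :* f))
               refl _ (p x i) (β x r) (φ x) _ ⟩
        fromℕ (i !ᵐ) * (- ((B r ⊲ p x) i + β x r * p x i) * φ x)
          ≈⟨ *-congˡ (*-congʳ (p-gaussian x r i)) ⟨
        fromℕ (i !ᵐ) * (fromℕ (suc (lookup i r)) * p x (unit r ⊹ i) * φ x)
          ≈⟨ solve 4 (λ k s p f → k :* (s :* p :* f) := (s :* k) :* (p :* f)) refl _ (fromℕ (suc (lookup i r))) _ (φ x) ⟩
        fromℕ (suc (lookup i r)) * fromℕ (i !ᵐ) * (p x (unit r ⊹ i) * φ x)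
          ≈⟨ *-congʳ (trans (×-congˡ (!ᵐ-unit-⊹ r i)) (fromℕ-* (suc (lookup i r)) (i !ᵐ))) ⟨
        D (unit r ⊹ i) x ∎

    D-iterated : ∀ rs → IsIteratedDerivative rs φ (D (order rs))
    D-iterated []       x = sym (trans (*-cong (trans (×-congˡ (𝟎!ᵐ n)) (+-identityʳ 1#)) (*-congʳ (partitionSum-𝟎 (moments x))))
      (trans (*-identityˡ _) (*-identityˡ _)))
    D-iterated (r ∷ rs) = D (order rs) , D-iterated rs , D-partial r (order rs)

    hermite : ∀ i x → IsHermite φ i x ((- 1#) ^ degree i * (fromℕ (i !ᵐ) * p x i))
    hermite i x = D i
      , ≡.subst (λ j → IsIteratedDerivative (directions i) φ (D j)) (order-directions i) (D-iterated (directions i))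
      , sym (trans (*-assoc _ _ _) (*-congˡ (trans
          (solve 4 (λ k p f g → k :* (p :* f) :* g := (k :* p) :* (f :* g)) refl _ (p x i) (φ x) (φ x ⁻¹))
          (trans (*-congˡ (⁻¹-inverseʳ (φ≉0 x))) (*-identityʳ _)))))

-- Transport of the moments to the scalar field

fromReal-isRingHomomorphism : ∀ 𝓡 𝔽 → let open RealAnalysis 𝓡 in
  IsRingHomomorphism (CommutativeRing.rawRing (CompleteOrderedField.commutativeRing 𝓡))
    (CommutativeRing.rawRing (scalars 𝔽)) (fromReal 𝔽)
fromReal-isRingHomomorphism 𝓡 RealAnalysis.real = record
  { isSemiringHomomorphism = record
    { isNearSemiringHomomorphism = record
      { +-isMonoidHomomorphism = record
        { isMagmaHomomorphism = record { isRelHomomorphism = record { cong = λ p → p } ; homo = λ _ _ → refl }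
        ; ε-homo = refl
        }
      ; *-homo = λ _ _ → refl
      }
    ; 1#-homo = refl
    }
  ; -‿homo = λ _ → refl
  }
  where open CompleteOrderedField 𝓡
fromReal-isRingHomomorphism 𝓡 RealAnalysis.complex = record
  { isSemiringHomomorphism = record
    { isNearSemiringHomomorphism = record
      { +-isMonoidHomomorphism = record
        { isMagmaHomomorphism = record
          { isRelHomomorphism = record { cong = λ p → p , refl }
          ; homo = λ _ _ → refl , sym (+-identityˡ 0#)
          }
        ; ε-homo = refl , refl
        }
      ; *-homo = λ _ _ → sym (trans (+-congˡ (trans (-‿cong (zeroˡ _)) -0#≈0#)) (+-identityʳ _))
                       , sym (trans (+-cong (zeroʳ _) (zeroˡ _)) (+-identityˡ _))
      }
    ; 1#-homo = refl , refl
    }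
  ; -‿homo = λ _ → refl , sym -0#≈0#
  }
  where
  open CompleteOrderedField 𝓡
  open RingProperties ring using (-0#≈0#)

module Embedding (𝓡 : CompleteOrderedField) (𝔽 : RealAnalysis.RealOrComplex 𝓡) where

  open RealAnalysis 𝓡 using (scalars)
  open Umbral 𝓡 𝔽 using (ι; ratio; UmbralCalculus; moment; moment[-1·β·_]; generatingFunction; 1+½t_tᵀ; _^_;
    _≋_; _⟨+⟩_; _⟨-⟩_; constant; listProduct; listSum; Poly; IsPolynomial; _[t+_]; _[_])
  private
    module ℝ = CompleteOrderedField 𝓡
    module ℝP = Polynomials ℝ.commutativeRing
    open module R = CommutativeRing (scalars 𝔽) hiding (zero)
    module RFold = Fold +-commutativeMonoid
    module RProduct = Fold *-commutativeMonoid
  open IsRingHomomorphism (fromReal-isRingHomomorphism 𝓡 𝔽) renaming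
    (⟦⟧-cong to ι-cong; 0#-homo to ι-0; 1#-homo to ι-1; +-homo to ι-+; *-homo to ι-*; -‿homo to ι-neg)
  open SemiringSum semiring using (sum; sum-cong-≋)
  open SemiringExp semiring using (^-congˡ)
  open SeriesProperties (scalars 𝔽)
  open Polynomials (scalars 𝔽) using (monomial)
  open Solver (scalars 𝔽)
  open FieldProperties 𝓡 using (partitionSum; weight; fromℕ≉0)
  open Euler ℝ.commutativeRing using (coefficient)
  open ≈-Reasoning setoid

  ι-^ : ∀ a k → ι (a ℝ.^ k) ≈ ι a ^ k
  ι-^ a zero    = ι-1
  ι-^ a (suc k) = trans (ι-* a _) (*-congˡ (ι-^ a k))

  ι-sign : ∀ k → ι ((ℝ.- ℝ.1#) ℝ.^ k) ≈ (- 1#) ^ k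
  ι-sign k = trans (ι-^ _ k) (^-congˡ k (trans (ι-neg ℝ.1#) (-‿cong ι-1)))

  ι-sum : ∀ {k} (f : Fin k → ℝ.Carrier) → ι (ℝ.sum f) ≈ sum (ι ∘ f)
  ι-sum {zero}  f = ι-0
  ι-sum {suc k} f = trans (ι-+ (f zero) _) (+-congˡ (ι-sum (f ∘ suc)))

  ι-listSum : {X : Set} (xs : List X) (f : X → ℝ.Carrier) → ι (ℝP.listSum xs f) ≈ listSum xs (ι ∘ f)
  ι-listSum []       f = ι-0
  ι-listSum (x ∷ xs) f = trans (ι-+ (f x) _) (+-congˡ (ι-listSum xs f))

  ι-listProduct : {X : Set} (xs : List X) (f : X → ℝ.Carrier) → ι (ℝP.listProduct xs f) ≈ listProduct xs (ι ∘ f)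
  ι-listProduct []       f = ι-1
  ι-listProduct (x ∷ xs) f = trans (ι-* (f x) _) (*-congˡ (ι-listProduct xs f))

  ι-monomial : ∀ {n} (d c : MultiIndex n) → ι (ℝP.monomial d c) ≈ monomial d c
  ι-monomial d c with does (c ≟ᵐ d)
  ... | true  = ι-1
  ... | false = ι-0

  module _ {n : ℕ} where

    open CompleteOrderedField 𝓡 using (fromℕ; _⁻¹; ½)

    ι-coefficient : ∀ M (x : Fin n → ℝ.Carrier) c → ι (coefficient ½ M x c) ≈ ι ½ * sum (λ r → sum λ s →
      ι (M r s) * (monomial (unit r ⊹ unit s) c + ι (x s) * monomial (unit r) c + ι (x r) * monomial (unit s) c))
    ι-coefficient M x c = trans (ι-* _ _) (*-congˡ (trans (ι-sum {n} _) (sum-cong-≋ λ r → trans (ι-sum {n} _) (sum-cong-≋ λ s →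
      trans (ι-* _ _) (*-congˡ (trans (ι-+ _ _) (+-cong (trans (ι-+ _ _)
        (+-cong (ι-monomial (unit r ⊹ unit s) c) (trans (ι-* _ _) (*-congˡ (ι-monomial (unit r) c)))))
        (trans (ι-* _ _) (*-congˡ (ι-monomial (unit s) c))))))))))

    -- The scalars form a commutative ring without a chosen inverse, so the division by k is undone
    -- by multiplying with the image of the real number k.
    ratio-cancel : ∀ {k} → k ≢ 0 → ∀ a b → ratio 1 k * a ≈ ι b → a ≈ ι (fromℕ k ℝ.* b)
    ratio-cancel {k} k≢0 a b eq = begin
      a                                      ≈⟨ *-identityˡ a ⟨
      1# * a                                 ≈⟨ *-congʳ (trans (ι-cong inverse) ι-1) ⟨
      ι (fromℕ k ℝ.* (fromℕ 1 ℝ.* fromℕ k ⁻¹)) * a  ≈⟨ trans (*-congʳ (ι-* _ _)) (*-assoc _ _ _) ⟩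
      ι (fromℕ k) * (ratio 1 k * a)          ≈⟨ *-congˡ eq ⟩
      ι (fromℕ k) * ι b                      ≈⟨ ι-* _ _ ⟨
      ι (fromℕ k ℝ.* b)                      ∎
      where
      inverse : fromℕ k ℝ.* (fromℕ 1 ℝ.* fromℕ k ⁻¹) ℝ.≈ ℝ.1#
      inverse = ℝ.trans (ℝ.*-congˡ (ℝ.trans (ℝ.*-congʳ (ℝ.+-identityʳ ℝ.1#)) (ℝ.*-identityˡ _)))
        (ℝ.⁻¹-inverseʳ (fromℕ≉0 k k≢0))

    module _ {A : Set} (𝓤 : UmbralCalculus A) (η : Fin n → Poly A) where

      -- The columns of a partition are nonzero, so moments in positive degree are all that has to
      -- be real. The sum is then the image of a real one, with i! distributed over its terms.
      moment[-1·β]≈partitionSum : ∀ (g : MultiIndex n → ℝ.Carrier) →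
        (∀ {c} → c ≢ 𝟎 → moment 𝓤 η c ≈ ι (g c)) →
        ∀ i → moment[-1·β·_] 𝓤 η i ≈ ι (fromℕ (i !ᵐ) ℝ.* partitionSum g i)
      moment[-1·β]≈partitionSum g η≈g i = sym (begin
        ι (fromℕ (i !ᵐ) ℝ.* partitionSum g i)
          ≈⟨ ι-* _ _ ⟩
        ι (fromℕ (i !ᵐ)) * ι (partitionSum g i)
          ≈⟨ *-congˡ (ι-listSum (partitions i) (weight g)) ⟩
        ι (fromℕ (i !ᵐ)) * listSum (partitions i) (ι ∘ weight g)
          ≈⟨ *-distribˡ-fold _ (partitions i) _ ⟩
        listSum (partitions i) (λ λs → ι (fromℕ (i !ᵐ)) * ι (weight g λs))
          ≈⟨ RFold.fold-cong (partitions i) (λ λs∈ → term (∈-partitions⁻ λs∈)) ⟩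
        moment[-1·β·_] 𝓤 η i ∎)
        where
        term : ∀ {λs} → IsPartition i λs → ι (fromℕ (i !ᵐ)) * ι (weight g λs) ≈
          ratio (i !ᵐ) (denominator λs) * (- 1#) ^ length λs
            * listProduct (distinctColumns λs) (λ c → moment 𝓤 η c ^ multiplicity λs c)
        term {λs} (λs≢𝟎 , _) = begin
          ι (fromℕ (i !ᵐ)) * ι (weight g λs)
            ≈⟨ *-congˡ (trans (ι-* _ _) (*-congʳ (ι-* _ _))) ⟩
          ι (fromℕ (i !ᵐ)) * (ι (fromℕ (denominator λs) ⁻¹) * ι ((ℝ.- ℝ.1#) ℝ.^ length λs)
            * ι (ℝP.listProduct (distinctColumns λs) (λ c → g c ℝ.^ multiplicity λs c)))
            ≈⟨ solve 4 (λ a b c d → a :* (b :* c :* d) := a :* b :* c :* d) refl _ _ _ _ ⟩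
          ι (fromℕ (i !ᵐ)) * ι (fromℕ (denominator λs) ⁻¹) * ι ((ℝ.- ℝ.1#) ℝ.^ length λs)
            * ι (ℝP.listProduct (distinctColumns λs) (λ c → g c ℝ.^ multiplicity λs c))
            ≈⟨ *-cong (*-cong (sym (ι-* _ _)) (ι-sign (length λs)))
                 (trans (ι-listProduct (distinctColumns λs) _) (RProduct.fold-cong (distinctColumns λs) λ {c} c∈ →
                   trans (ι-^ (g c) (multiplicity λs c)) (^-congˡ (multiplicity λs c)
                     (sym (η≈g (All.lookup λs≢𝟎 (∈-distinctColumns⁻ λs c∈))))))) ⟩
          _ ∎

      -- The constants 1 and f(μ, x) live in degree zero, so at `c ≢ 𝟎` only the translated form is
      -- left. The equation for `proj₁ f` exposes the polynomial in which the translation is carried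
      -- out.
      moment-translated : ∀ (M : Fin n → Fin n → ℝ.Carrier) (x : Fin n → ℝ.Carrier) {f₀} (f : IsPolynomial f₀) → proj₁ f ≡ 1+½t M tᵀ →
        generatingFunction 𝓤 η ≋ constant 1# ⟨+⟩ f [t+ ι ∘ x ] ⟨-⟩ constant (f [ ι ∘ x ]) →
        ∀ {c} → c ≢ 𝟎 → moment 𝓤 η c ≈ ι (fromℕ (c !ᵐ) ℝ.* coefficient ½ M x c)
      moment-translated M x f ≡.refl fη {c} c≢𝟎 = ratio-cancel (!ᵐ≢0 c) _ _ (trans (fη c) (begin
        constant 1# c + (f [t+ ι ∘ x ]) c - constant (f [ ι ∘ x ]) c
          ≈⟨ +-cong (+-cong (vanish 1#) (toSeries-shift (ι ½) (λ r s → ι (M r s)) (ι ∘ x) c≢𝟎)) (-‿cong (vanish _)) ⟩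
        0# + _ - 0#
          ≈⟨ solve 1 (λ z → con (0 , 0) :+ z :- con (0 , 0) := z) refl _ ⟩
        _
          ≈⟨ ι-coefficient M x c ⟨
        ι (coefficient ½ M x c) ∎))
        where
        vanish : ∀ a → constant a c ≈ 0#
        vanish a = trans (*-congˡ (monomial-≢ c≢𝟎)) (zeroʳ a)

proposition4p3 :
    (𝓡 : CompleteOrderedField) →
    let open RealAnalysis 𝓡
        ℝ = CompleteOrderedField.Carrier 𝓡 in
    (𝓕 : ElementaryFunctions)
    (n : ℕ) (Σ Σ⁻¹ : Matrix n) →
    IsCovariance Σ → HasFullRank Σ → IsInverse Σ Σ⁻¹ →
    (φ : Point n → ℝ) → IsGaussianDensity 𝓕 Σ Σ⁻¹ φ →
    (𝔽 : RealOrComplex) →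
    let open Umbral 𝓡 𝔽
        open CommutativeRing (scalars 𝔽) in
    (A : Set) (𝓤 : UmbralCalculus A) (x : Point n)
    (μ μₓ : Fin n → Poly A)
    (fμ : generatingFunction 𝓤 μ ≋ toSeries (1+½t Σ⁻¹ tᵀ)) →
    let f : IsPolynomial (generatingFunction 𝓤 μ)
        f = (1+½t Σ⁻¹ tᵀ) , fμ
        𝐱 = λ r → ι (x r) in
    generatingFunction 𝓤 μₓ ≋ constant 1# ⟨+⟩ f [t+ 𝐱 ] ⟨-⟩ constant (f [ 𝐱 ]) →
    (i : MultiIndex n) →
    ∃[ H ] IsHermite φ i x H × ι H ≈ (- 1#) ^ degree i * moment[-1·β·_] 𝓤 μₓ i
proposition4p3 𝓡 𝓕 n Σ Σ⁻¹ _ _ _ φ φ-gaussian 𝔽 A 𝓤 x μ μₓ fμ fμₓ i =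
  -- The omitted witness is (-1)^|i| i! pᵢ(x), determined by the type of `hermite`.
  _ , Hermite.Density.hermite 𝓡 n Σ⁻¹ 𝓕 {Σ} φ-gaussian i x , trans (ι-* _ _) (*-cong (ι-sign (degree i))
    (sym (moment[-1·β]≈partitionSum 𝓤 μₓ (Hermite.moments 𝓡 n Σ⁻¹ x)
      (moment-translated 𝓤 μₓ Σ⁻¹ x ((1+½t Σ⁻¹ tᵀ) , fμ) ≡.refl fμₓ) i)))
  where
  open Umbral 𝓡 𝔽 using (1+½t_tᵀ)
  open CommutativeRing (RealAnalysis.scalars 𝓡 𝔽)
  open IsRingHomomorphism (fromReal-isRingHomomorphism 𝓡 𝔽) using () renaming (*-homo to ι-*)
  open Embedding 𝓡 𝔽
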